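{- Fix $\alpha,\beta>0$. For $n\ge2$ let $S$ be a random $\alpha/\beta$-staircase tableau of size $n$ with law $\mathbb{P}_{n,\alpha,\beta}$, and let $A_n$ be the number of boxes $(n-j,j)$, $1\le j\le n-1$ (the second main diagonal), that contain $\alpha$. Then, as $n\to\infty$, $A_n$ converges in distribution to a Poisson random variable with parameter $1/2$.
   Context: A staircase tableau of size $n$ has boxes $(i,j)$ with $i,j\ge1$ and $i+j\le n+1$, rows numbered from the top and columns from the left. An $\alpha/\beta$-staircase tableau of size $n$ is a filling in which each box is empty or contains $\alpha$ or $\beta$, such that: all boxes in the same column and above an $\alpha$ are empty; all boxes in the same row and to the left of a $\beta$ are empty; every main-diagonal box (with $i+j=n+1$) contains a symbol. $\overline{\mathcal{S}}_n$ is the set of these. The weight is $wt(S)=\alpha^{N_\alpha}\beta^{N_\beta}$ ($N_\alpha,N_\beta$ the numbers of $\alpha$'s, $\beta$'s), and $\mathbb{P}_{n,\alpha,\beta}(S)=wt(S)/\sum_{T\in\overline{\mathcal{S}}_n}wt(T)$. -}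

module Defs where

open import Algebra.Apartness.Bundles using (HeytingField)
open import Algebra.Bundles using (CommutativeRing; Semiring)
import Algebra.Definitions.RawSemiring as RawSemiringDefinitions
import Algebra.Properties.Ring as RingProperties
import Algebra.Apartness.Properties.HeytingCommutativeRing as HeytingProperties
open import Data.Fin.Base using (Fin; toℕ)
open import Data.Fin.Properties using (all?)
open import Data.List.Base as List using (List; []; _∷_; [_]; length; filter; foldr; allFin; cartesianProductWith)
open import Data.List.Membership.Propositional using (_∈_)
open import Data.List.Membership.Propositional.Properties using (∈-cartesianProductWith⁺; ∈-filter⁺)
open import Data.List.Relation.Unary.Any using (here; there)
open import Data.Maybe.Base using (Maybe; just; nothing)
import Data.Maybe.Properties as Maybe
open import Data.Nat.Base as ℕ using (ℕ; zero; suc; _!)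
import Data.Nat.Properties as ℕ
open import Data.Product.Base using (∃-syntax; _×_; _,_; proj₁)
open import Data.Sum.Base using (_⊎_; inj₁; inj₂)
open import Data.Vec.Base as Vec using (Vec; []; _∷_)
import Data.Vec.Properties as Vec
open import Function.Base using (_∘_)
open import Function.Bundles using (_⇔_; Equivalence)
open import Level using (_⊔_) renaming (suc to lsuc)
open import Relation.Binary.Core using (Rel)
open import Relation.Binary.Definitions using (DecidableEquality)
open import Relation.Binary.PropositionalEquality as ≡ using (_≡_; _≢_)
open import Relation.Binary.Structures using (IsStrictPartialOrder)
open import Relation.Nullary using (Dec; yes; no; ¬?; contradiction)
open import Relation.Nullary.Decidable using (map′; _×-dec_; _→-dec_)

------------------------------------------------------------------------
-- Staircase tableaux

data Symbol : Set where
  letterα letterβ : Symbol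

infix 4 _≟ₛ_
_≟ₛ_ : DecidableEquality Symbol
letterα ≟ₛ letterα = yes ≡.refl
letterα ≟ₛ letterβ = no λ ()
letterβ ≟ₛ letterα = no λ ()
letterβ ≟ₛ letterβ = yes ≡.refl

-- The content of a box; `nothing` is an empty box.

Cell : Set
Cell = Maybe Symbol

infix 4 _≟_
_≟_ : DecidableEquality Cell
_≟_ = Maybe.≡-dec _≟ₛ_

-- Removing the top row, which has n + 1 boxes, from the staircase of
-- size n + 1 leaves the staircase of size n.  With `row` and `col`
-- numbered from 1, `Box n` is thus { (i , j) | i, j ≥ 1, i + j ≤ n + 1 }.

data Box : ℕ → Set where
  top   : ∀ {n} → Fin (suc n) → Box (suc n)
  below : ∀ {n} → Box n → Box (suc n)

row col : ∀ {n} → Box n → ℕ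
row (top j)   = 1
row (below b) = suc (row b)
col (top j)   = suc (toℕ j)
col (below b) = col b

boxes : ∀ n → List (Box n)
boxes zero    = []
boxes (suc n) = List.map top (allFin (suc n)) List.++ List.map below (boxes n)

data Filling : ℕ → Set where
  []  : Filling 0
  _∷_ : ∀ {n} → Vec Cell (suc n) → Filling n → Filling (suc n)

infix 5 _at_
_at_ : ∀ {n} → Filling n → Box n → Cell
(r ∷ T) at top j   = Vec.lookup r j
(r ∷ T) at below b = T at b

record IsStaircaseTableau {n} (T : Filling n) : Set where
  constructor mkIsStaircaseTableau
  field
    aboveα   : ∀ b c → T at b ≡ just letterα → col c ≡ col b → row c ℕ.< row b → T at c ≡ nothing
    leftOfβ  : ∀ b c → T at b ≡ just letterβ → row c ≡ row b → col c ℕ.< col b → T at c ≡ nothing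
    diagonal : ∀ b → row b ℕ.+ col b ≡ suc n → T at b ≢ nothing

allBoxes? : ∀ {n p} {P : Box n → Set p} → (∀ b → Dec (P b)) → Dec (∀ b → P b)
allBoxes? {zero}  P? = yes λ ()
allBoxes? {suc n} P? =
  map′ (λ { (p , q) (top j) → p j ; (p , q) (below b) → q b })
       (λ f → f ∘ top , f ∘ below)
       (all? (P? ∘ top) ×-dec allBoxes? (P? ∘ below))

isStaircaseTableau? : ∀ {n} (T : Filling n) → Dec (IsStaircaseTableau T)
isStaircaseTableau? {n} T =
  map′ (λ (p , q , r) → mkIsStaircaseTableau p q r)
       (λ (mkIsStaircaseTableau p q r) → p , q , r)
       (allBoxes? (λ b → allBoxes? λ c →
          (T at b ≟ just letterα) →-dec (col c ℕ.≟ col b) →-dec (row c ℕ.<? row b) →-dec (T at c ≟ nothing))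
        ×-dec
        allBoxes? (λ b → allBoxes? λ c →
          (T at b ≟ just letterβ) →-dec (row c ℕ.≟ row b) →-dec (col c ℕ.<? col b) →-dec (T at c ≟ nothing))
        ×-dec
        allBoxes? (λ b → (row b ℕ.+ col b ℕ.≟ suc n) →-dec ¬? (T at b ≟ nothing)))

-- Each filling occurs exactly once in `fillings n`, so that a sum over
-- `tableaux n` is a sum over the set of staircase tableaux of size n.

cells : List Cell
cells = nothing ∷ just letterα ∷ just letterβ ∷ []

rows : ∀ n → List (Vec Cell n)
rows zero    = [ [] ]
rows (suc n) = cartesianProductWith _∷_ cells (rows n)

fillings : ∀ n → List (Filling n)
fillings zero    = [ [] ]
fillings (suc n) = cartesianProductWith _∷_ (rows (suc n)) (fillings n)

tableaux : ∀ n → List (Filling n)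
tableaux n = filter isStaircaseTableau? (fillings n)

-- The number of boxes containing a given symbol.

N : Symbol → ∀ {n} → Filling n → ℕ
N s {n} T = length (filter (λ b → T at b ≟ just s) (boxes n))

-- The number of α's on the second main diagonal, i.e. in the boxes
-- (n - j , j) with 1 ≤ j ≤ n - 1.

A : ∀ {n} → Filling n → ℕ
A {n} T = length (filter (λ b → (row b ℕ.+ col b ℕ.≟ n) ×-dec (T at b ≟ just letterα)) (boxes n))

-- The partition function is inverted below, which requires a tableau of
-- each size: α on the main diagonal and nothing elsewhere.

tabulateF : ∀ {n} → (Box n → Cell) → Filling n
tabulateF {zero}  f = []
tabulateF {suc n} f = Vec.tabulate (f ∘ top) ∷ tabulateF (f ∘ below)

tabulateF-at : ∀ {n} (f : Box n → Cell) b → tabulateF f at b ≡ f b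
tabulateF-at f (top j)   = Vec.lookup∘tabulate (f ∘ top) j
tabulateF-at f (below b) = tabulateF-at (f ∘ below) b

∈-rows : ∀ {n} (r : Vec Cell n) → r ∈ rows n
∈-rows []      = here ≡.refl
∈-rows (x ∷ r) = ∈-cartesianProductWith⁺ _∷_ (∈-cells x) (∈-rows r)
  where
  ∈-cells : ∀ x → x ∈ cells
  ∈-cells nothing        = here ≡.refl
  ∈-cells (just letterα) = there (here ≡.refl)
  ∈-cells (just letterβ) = there (there (here ≡.refl))

∈-fillings : ∀ {n} (T : Filling n) → T ∈ fillings n
∈-fillings []      = here ≡.refl
∈-fillings (r ∷ T) = ∈-cartesianProductWith⁺ _∷_ (∈-rows r) (∈-fillings T)

diagonalCell : ∀ {n} → Box n → Cell
diagonalCell {n} b with row b ℕ.+ col b ℕ.≟ suc n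
... | yes _ = just letterα
... | no  _ = nothing

diagonalα : ∀ n → Filling n
diagonalα n = tabulateF diagonalCell

diagonalα-isStaircaseTableau : ∀ n → IsStaircaseTableau (diagonalα n)
diagonalα-isStaircaseTableau n = mkIsStaircaseTableau
  (λ b c eq cols rows → ≡.trans (tabulateF-at _ c)
    (off c (ℕ.<⇒≢ (≡.subst₂ ℕ._<_ (≡.cong (row c ℕ.+_) (≡.sym cols)) (α⇒diag b (≡.trans (≡.sym (tabulateF-at _ b)) eq))
      (ℕ.+-monoˡ-< (col b) rows)))))
  (λ b c eq _ _ → contradiction (≡.trans (≡.sym (tabulateF-at _ b)) eq) (noβ b))
  (λ b d eq → on b d (≡.trans (≡.sym (tabulateF-at _ b)) eq))
  where
  off : (b : Box n) → row b ℕ.+ col b ≢ suc n → diagonalCell b ≡ nothing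
  off b ¬d with row b ℕ.+ col b ℕ.≟ suc n
  ... | yes d = contradiction d ¬d
  ... | no  _ = ≡.refl

  on : (b : Box n) → row b ℕ.+ col b ≡ suc n → diagonalCell b ≢ nothing
  on b d with row b ℕ.+ col b ℕ.≟ suc n
  ... | yes _ = λ ()
  ... | no ¬d = contradiction d ¬d

  α⇒diag : (b : Box n) → diagonalCell b ≡ just letterα → row b ℕ.+ col b ≡ suc n
  α⇒diag b eq with row b ℕ.+ col b ℕ.≟ suc n
  α⇒diag b eq | yes d = d
  α⇒diag b () | no _

  noβ : (b : Box n) → diagonalCell b ≢ just letterβ
  noβ b with row b ℕ.+ col b ℕ.≟ suc n
  ... | yes _ = λ ()
  ... | no  _ = λ ()

diagonalα∈tableaux : ∀ n → diagonalα n ∈ tableaux n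
diagonalα∈tableaux n = ∈-filter⁺ isStaircaseTableau? (∈-fillings _) (diagonalα-isStaircaseTableau n)

------------------------------------------------------------------------
-- The real numbers

record OrderedHeytingField c ℓ₁ ℓ₂ : Set (lsuc (c ⊔ ℓ₁ ⊔ ℓ₂)) where
  infix 4 _<_
  field
    heytingField : HeytingField c ℓ₁ ℓ₂

  open HeytingField heytingField public
    hiding (isEquivalence)
    renaming (trans to ≈-trans; sym to ≈-sym; refl to ≈-refl)

  field
    _<_                  : Rel Carrier ℓ₂
    isStrictPartialOrder : IsStrictPartialOrder _≈_ _<_
    #⇔<⊎>                : ∀ {x y} → (x # y) ⇔ (x < y ⊎ y < x)
    +-monoˡ-<            : ∀ {x y} z → x < y → x + z < y + z
    *-pos                : ∀ {x y} → 0# < x → 0# < y → 0# < x * y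

  open IsStrictPartialOrder isStrictPartialOrder public
    using (irrefl; <-resp-≈; <-respʳ-≈; <-respˡ-≈)
    renaming (trans to <-trans)

  commutativeRing : CommutativeRing c ℓ₁
  commutativeRing = record { isCommutativeRing = isCommutativeRing }

  open RawSemiringDefinitions (Semiring.rawSemiring (CommutativeRing.semiring commutativeRing)) public
    using (_^_)
    renaming (_×_ to _·_)

  fromℕ : ℕ → Carrier
  fromℕ n = n · 1#

  -- | x - y | < ε
  Within : Carrier → Carrier → Carrier → Set ℓ₂
  Within ε x y = (x - y < ε) × (y - x < ε)

  Cauchy : (ℕ → Carrier) → Set (c ⊔ ℓ₂)
  Cauchy u = ∀ ε → 0# < ε → ∃[ K ] (∀ m n → K ℕ.≤ m → K ℕ.≤ n → Within ε (u m) (u n))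

  infix 4 _⟶_
  _⟶_ : (ℕ → Carrier) → Carrier → Set (c ⊔ ℓ₂)
  u ⟶ l = ∀ ε → 0# < ε → ∃[ K ] (∀ n → K ℕ.≤ n → Within ε (u n) l)

-- The real numbers, axiomatised as a Cauchy complete Archimedean ordered
-- field.  The axioms are the constructive ones (no decidability of < or
-- ≈), so they cover both Bishop's reals and the classical real field,
-- which is their only classical model up to isomorphism.

record RealField c ℓ₁ ℓ₂ : Set (lsuc (c ⊔ ℓ₁ ⊔ ℓ₂)) where
  field
    orderedHeytingField : OrderedHeytingField c ℓ₁ ℓ₂

  open OrderedHeytingField orderedHeytingField public

  field
    archimedean : ∀ x → ∃[ n ] (x < fromℕ n)
    complete    : ∀ u → Cauchy u → ∃[ l ] (u ⟶ l)

module RealFieldProperties {c ℓ₁ ℓ₂} (R : RealField c ℓ₁ ℓ₂) where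
  open RealField R
  open RingProperties (CommutativeRing.ring commutativeRing) using (-0#≈0#; -1*x≈-x; -‿involutive)
  open HeytingProperties (HeytingField.heytingCommutativeRing heytingField) using (1#0)

  +-pos : ∀ {x y} → 0# < x → 0# < y → 0# < x + y
  +-pos {x} {y} 0<x 0<y = <-trans 0<y (<-respˡ-≈ (+-identityˡ y) (+-monoˡ-< y 0<x))

  0<1 : 0# < 1#
  0<1 with Equivalence.to #⇔<⊎> 1#0
  ... | inj₂ p = p
  ... | inj₁ 1<0 = <-respʳ-≈ (≈-trans (-1*x≈-x (- 1#)) (-‿involutive 1#)) (*-pos 0<-1 0<-1)
    where
    0<-1 : 0# < - 1#
    0<-1 = <-respʳ-≈ (+-identityˡ (- 1#)) (<-respˡ-≈ (-‿inverseʳ 1#) (+-monoˡ-< (- 1#) 1<0))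

  ^-pos : ∀ {x} → 0# < x → ∀ n → 0# < x ^ n
  ^-pos 0<x zero    = 0<1
  ^-pos 0<x (suc n) = *-pos 0<x (^-pos 0<x n)

  fromℕ-pos : ∀ n → .{{ℕ.NonZero n}} → 0# < fromℕ n
  fromℕ-pos (suc zero)    = <-respʳ-≈ (≈-sym (+-identityʳ 1#)) 0<1
  fromℕ-pos (suc (suc n)) = +-pos 0<1 (fromℕ-pos (suc n))

  -- The library inverts x - y for x # y; here y is 0#, and
  -- x - 0# ≈ x.
  inv : ∀ {x} → 0# < x → Carrier
  inv 0<x = proj₁ (#⇒invertible (Equivalence.from #⇔<⊎> (inj₂ 0<x)))

  inv-inverseʳ : ∀ {x} (0<x : 0# < x) → x * inv 0<x ≈ 1#
  inv-inverseʳ {x} 0<x with #⇒invertible (Equivalence.from #⇔<⊎> (inj₂ 0<x))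
  ... | y , _ , eq = ≈-trans (*-congʳ (≈-sym (≈-trans (+-congˡ -0#≈0#) (+-identityʳ x)))) eq

  ½ : Carrier
  ½ = inv (fromℕ-pos 2)

  inv! : ℕ → Carrier
  inv! k = inv (fromℕ-pos (k !) {{k ℕ.!≢0}})

  sumOver : ∀ {a} {X : Set a} → List X → (X → Carrier) → Carrier
  sumOver xs f = foldr (λ x s → f x + s) 0# xs

  sumOver-pos : ∀ {a} {X : Set a} (f : X → Carrier) → (∀ x → 0# < f x) →
                ∀ {x} {xs : List X} → x ∈ xs → 0# < sumOver xs f
  sumOver-pos f 0<f {xs = y ∷ []}     _ = <-respʳ-≈ (≈-sym (+-identityʳ (f y))) (0<f y)
  sumOver-pos f 0<f {xs = y ∷ z ∷ zs} _ = +-pos (0<f y) (sumOver-pos f 0<f {xs = z ∷ zs} (here ≡.refl))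

  partialSum : (ℕ → Carrier) → ℕ → Carrier
  partialSum u zero    = 0#
  partialSum u (suc n) = partialSum u n + u n

  HasSum : (ℕ → Carrier) → Carrier → Set (c ⊔ ℓ₂)
  HasSum u s = partialSum u ⟶ s

  IsExp : Carrier → Carrier → Set (c ⊔ ℓ₂)
  IsExp x y = HasSum (λ k → x ^ k * inv! k) y

  -- Limits are unique, so e = exp (- μ), and p is determined up to ≈.
  IsPoissonPMF : Carrier → (ℕ → Carrier) → Set (c ⊔ ℓ₁ ⊔ ℓ₂)
  IsPoissonPMF μ p = ∃[ e ] (IsExp (- μ) e × (∀ k → p k ≈ e * μ ^ k * inv! k))

  Bounded : (ℕ → Carrier) → Set (c ⊔ ℓ₂)
  Bounded f = ∃[ B ] (∀ k → (- B < f k) × (f k < B))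

  -- 𝔼 n is the expectation on the n-th probability space, X n is a random
  -- variable on it with values in the discrete space ℕ, and p is a
  -- probability mass function on ℕ.  Convergence in distribution is
  -- convergence of 𝔼 f(Xₙ) to Σₖ f(k) p(k) for every bounded continuous f;
  -- on ℕ every f is continuous.
  ConvergesInDistribution : ∀ {a} {Ω : ℕ → Set a} → (𝔼 : ∀ n → (Ω n → Carrier) → Carrier) →
                            (X : ∀ n → Ω n → ℕ) → (p : ℕ → Carrier) → Set (c ⊔ ℓ₂)
  ConvergesInDistribution 𝔼 X p =
    ∀ f → Bounded f → ∃[ s ] (HasSum (λ k → f k * p k) s × ((λ n → 𝔼 n (λ ω → f (X n ω))) ⟶ s))

------------------------------------------------------------------------
-- Random staircase tableaux

module RandomTableau {c ℓ₁ ℓ₂} (R : RealField c ℓ₁ ℓ₂) {α β : RealField.Carrier R}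
                     (0<α : RealField._<_ R (RealField.0# R) α)
                     (0<β : RealField._<_ R (RealField.0# R) β) where
  open RealField R
  open RealFieldProperties R

  wt : ∀ {n} → Filling n → Carrier
  wt T = α ^ N letterα T * β ^ N letterβ T

  Z : ℕ → Carrier
  Z n = sumOver (tableaux n) wt

  Z-pos : ∀ n → 0# < Z n
  Z-pos n = sumOver-pos wt (λ T → *-pos (^-pos 0<α (N letterα T)) (^-pos 0<β (N letterβ T))) (diagonalα∈tableaux n)

  ℙ : ∀ {n} → Filling n → Carrier
  ℙ {n} T = wt T * inv (Z-pos n)

  𝔼 : ∀ n → (Filling n → Carrier) → Carrier
  𝔼 n X = sumOver (tableaux n) (λ T → ℙ T * X T)

{-# OPTIONS --safe #-}

-- Let F n r y be the sum of wt T * binom (A T) r * y ^ k(T) over the tableaux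
-- T of size n, where k(T) is the number of columns of T without α.  A new top
-- row can only use the α-free columns, so summing over it gives
--
--   F (n+2) (r+1) y + αβ βy F n r y
--     = (α+βy) F (n+1) (r+1) (y+α) + αβ (α+βy) F n r (y+α) ,
--
-- whose solution is, for n = m + 2r, the product of the factors α+βy+iαβ with
-- i < m and of α²ʳβʳ times the complete homogeneous polynomial of degree r in
-- 1, 1+β, …, 1+mβ.  At y = 1 this is an exact formula for the binomial moments
-- of Aₙ, and elementary bounds show that they tend to (½)ʳ / r!.
--
-- By Newton's forward difference formula, a function f : ℕ → ℝ bounded by B
-- differs from a combination of the first R binomial coefficients by at most
-- 2ᴿ B binom k R.  As 2ᴿ (½)ᴿ / R! → 0, the binomial moments determine the
-- limit of the expectations of f; the truncated Poisson laws have the same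
-- limiting moments.

module Submission where

open import Defs
open import Algebra.Apartness.Bundles using (HeytingField)
import Algebra.Apartness.Properties.HeytingCommutativeRing as HeytingProperties
open import Algebra.Bundles using (CommutativeRing)
import Algebra.Properties.AbelianGroup
import Algebra.Properties.Ring
import Algebra.Properties.Semiring.Exp
import Algebra.Properties.Semiring.Mult.TCOptimised
import Algebra.Solver.Ring
open import Algebra.Solver.Ring.AlmostCommutativeRing using (_-Raw-AlmostCommutative⟶_; fromCommutativeRing)
open import Data.Bool.Base using (Bool; true; false; _∧_; if_then_else_)
import Data.Bool.Properties as Bool
open import Data.Fin.Base as Fin using (Fin; toℕ; inject₁)
import Data.Fin.Properties as Fin
open import Data.Integer.Base as ℤ using (ℤ; +_; -[1+_])
import Data.Integer.Properties as ℤ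
open import Data.List.Base as List using (List; []; _∷_; length; filter; allFin; cartesianProductWith)
open import Data.Maybe.Base using (Maybe; just; nothing)
open import Data.Nat.Base as ℕ using (ℕ; zero; suc; _!; z≤n; s≤s)
open import Data.Nat.Combinatorics using (_C_; nCk≡n!/k![n-k]!; k![n∸k]!∣n!; k>n⇒nCk≡0; nCk+nC[k+1]≡[n+1]C[k+1])
open import Data.Nat.DivMod using (m/n*n≡m)
import Data.Nat.Properties as ℕ
open import Data.Product.Base using (∃-syntax; _×_; _,_; proj₁; proj₂)
open import Data.Sum.Base using (_⊎_; inj₁; inj₂; [_,_]′)
open import Data.Vec.Base as Vec using (Vec; []; _∷_; _∷ʳ_; lookup)
open import Function.Base using (_∘_; id)
open import Function.Bundles using (mk⇔; Equivalence)
open import Level using (_⊔_)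
import Relation.Binary.Reasoning.Base.Triple
import Relation.Binary.Reasoning.Setoid
open import Relation.Binary.PropositionalEquality as ≡ using (_≡_; _≢_; cong; cong₂)
open import Relation.Binary.Structures using (IsPreorder)
open import Relation.Nullary using (¬_; does; yes; no; contradiction)
open import Relation.Nullary.Decidable using (_×-dec_; does-⇔)
open import Relation.Unary using (Decidable)

-- The number of free columns does not decide whether the second last cell of a new top row may hold
-- α: that cell lies in one particular column, which is free only if the row below ends in β. This
-- is why the recursion removes two rows at once. A row ending in β is otherwise empty, so it keeps
-- the free columns of `T` and adds one. The parameter `y` has to stay general although only y = 1
-- matters in the end, because every removal of a row replaces it by y + α.
--
-- The order on the reals is undecidable, so no proof may split into x ≤ y and y ≤ x. Weak
-- inequalities are negated strict ones, and estimates are stated with products instead of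
-- quotients. The limit of the expectations has to be produced as well: equality of moments, applied
-- to the truncated Poisson laws alone, makes their expectations a Cauchy sequence, and the tableau
-- laws then share its limit. Likewise exp(-½) is built as the reciprocal of exp(½) and identified
-- with its series afterwards.

module IntegerCoefficients {c ℓ} (CR : CommutativeRing c ℓ) where
  open CommutativeRing CR
  open Algebra.Properties.Ring ring
  open Algebra.Properties.AbelianGroup +-abelianGroup using (⁻¹-∙-comm)
  open Algebra.Properties.Semiring.Mult.TCOptimised semiring renaming (_×_ to _·_)
  open Relation.Binary.Reasoning.Setoid setoid

  private
    -- The optimised multiple computes `⟦ + 1 ⟧` to `1#` and `⟦ + 2 ⟧` to `1# + 1#`, so that `con`
    -- meets the constants of the goals as they are written. A numeral under `fromℕ` keeps its
    -- trailing `0#` and is spelled out in calls of `solve`.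
    ⟦_⟧ : ℤ → Carrier
    ⟦ + n ⟧      = n · 1#
    ⟦ -[1+ n ] ⟧ = - (suc n · 1#)

    neg-homo : ∀ i → ⟦ ℤ.- i ⟧ ≈ - ⟦ i ⟧
    neg-homo (+ zero)   = sym -0#≈0#
    neg-homo (+ suc n)  = refl
    neg-homo (-[1+ n ]) = sym (-‿involutive _)

    cancel : ∀ x y z → (x + y) - (x + z) ≈ y - z
    cancel x y z = begin
      (x + y) - (x + z)       ≈⟨ +-congˡ (⁻¹-∙-comm x z) ⟨
      (x + y) + (- x + - z)   ≈⟨ +-congʳ (+-comm x y) ⟩
      (y + x) + (- x + - z)   ≈⟨ +-assoc y x _ ⟩
      y + (x + (- x + - z))   ≈⟨ +-congˡ (+-assoc x _ _) ⟨
      y + ((x + - x) + - z)   ≈⟨ +-congˡ (+-congʳ (-‿inverseʳ x)) ⟩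
      y + (0# + - z)          ≈⟨ +-congˡ (+-identityˡ _) ⟩
      y - z                   ∎

    ⊖-homo : ∀ m n → ⟦ m ℤ.⊖ n ⟧ ≈ m · 1# - n · 1#
    ⊖-homo zero    zero    = sym (-‿inverseʳ 0#)
    ⊖-homo zero    (suc n) = sym (+-identityˡ _)
    ⊖-homo (suc m) zero    = sym (trans (+-congˡ -0#≈0#) (+-identityʳ _))
    ⊖-homo (suc m) (suc n) = begin
      ⟦ suc m ℤ.⊖ suc n ⟧                ≈⟨ reflexive (≡.cong ⟦_⟧ (ℤ.[1+m]⊖[1+n]≡m⊖n m n)) ⟩
      ⟦ m ℤ.⊖ n ⟧                        ≈⟨ ⊖-homo m n ⟩
      m · 1# - n · 1#                    ≈⟨ cancel 1# _ _ ⟨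
      (1# + m · 1#) - (1# + n · 1#)      ≈⟨ +-cong (1+× m 1#) (-‿cong (1+× n 1#)) ⟨
      suc m · 1# - suc n · 1#            ∎

    +-homo : ∀ i j → ⟦ i ℤ.+ j ⟧ ≈ ⟦ i ⟧ + ⟦ j ⟧
    +-homo (+ m)      (+ n)      = ×-homo-+ 1# m n
    +-homo (+ m)      (-[1+ n ]) = ⊖-homo m (suc n)
    +-homo (-[1+ m ]) (+ n)      = trans (⊖-homo n (suc m)) (+-comm _ _)
    +-homo (-[1+ m ]) (-[1+ n ]) = begin
      - (suc (suc (m ℕ.+ n)) · 1#)      ≈⟨ -‿cong (reflexive (≡.cong (λ k → suc k · 1#) (≡.sym (ℕ.+-suc m n)))) ⟩
      - ((suc m ℕ.+ suc n) · 1#)        ≈⟨ -‿cong (×-homo-+ 1# (suc m) (suc n)) ⟩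
      - (suc m · 1# + suc n · 1#)       ≈⟨ ⁻¹-∙-comm _ _ ⟨
      - (suc m · 1#) + - (suc n · 1#)   ∎

    pos-*-homo : ∀ m j → ⟦ + m ℤ.* j ⟧ ≈ m · 1# * ⟦ j ⟧
    pos-*-homo zero    j = trans (reflexive (≡.cong ⟦_⟧ (ℤ.*-zeroˡ j))) (sym (zeroˡ _))
    pos-*-homo (suc m) j = begin
      ⟦ + suc m ℤ.* j ⟧           ≈⟨ reflexive (≡.cong ⟦_⟧ (ℤ.suc-* (+ m) j)) ⟩
      ⟦ j ℤ.+ + m ℤ.* j ⟧         ≈⟨ +-homo j (+ m ℤ.* j) ⟩
      ⟦ j ⟧ + ⟦ + m ℤ.* j ⟧       ≈⟨ +-cong (sym (*-identityˡ _)) (pos-*-homo m j) ⟩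
      1# * ⟦ j ⟧ + m · 1# * ⟦ j ⟧ ≈⟨ distribʳ _ _ _ ⟨
      (1# + m · 1#) * ⟦ j ⟧       ≈⟨ *-congʳ (1+× m 1#) ⟨
      suc m · 1# * ⟦ j ⟧          ∎

    *-homo : ∀ i j → ⟦ i ℤ.* j ⟧ ≈ ⟦ i ⟧ * ⟦ j ⟧
    *-homo (+ m)      j = pos-*-homo m j
    *-homo (-[1+ m ]) j = begin
      ⟦ -[1+ m ] ℤ.* j ⟧         ≈⟨ reflexive (≡.cong ⟦_⟧ (≡.sym (ℤ.neg-distribˡ-* (+ suc m) j))) ⟩
      ⟦ ℤ.- (+ suc m ℤ.* j) ⟧    ≈⟨ neg-homo (+ suc m ℤ.* j) ⟩
      - ⟦ + suc m ℤ.* j ⟧        ≈⟨ -‿cong (pos-*-homo (suc m) j) ⟩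
      - (suc m · 1# * ⟦ j ⟧)     ≈⟨ -‿distribˡ-* _ _ ⟩
      - (suc m · 1#) * ⟦ j ⟧     ∎

    morphism : ℤ.+-*-rawRing -Raw-AlmostCommutative⟶ fromCommutativeRing CR
    morphism = record
      { ⟦_⟧    = ⟦_⟧
      ; +-homo = +-homo
      ; *-homo = *-homo
      ; -‿homo = neg-homo
      ; 0-homo = refl
      ; 1-homo = refl
      }

    -- Equality on the carrier is undecidable; integer coefficients have a decidable one, which lets
    -- normal forms with cancelling terms be recognised.
    _≟ᶻ_ : ∀ i j → Maybe (⟦ i ⟧ ≈ ⟦ j ⟧)
    i ≟ᶻ j with i ℤ.≟ j
    ... | yes i≡j = just (reflexive (≡.cong ⟦_⟧ i≡j))
    ... | no  _   = nothing

  open Algebra.Solver.Ring ℤ.+-*-rawRing (fromCommutativeRing CR) morphism _≟ᶻ_ public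

-- Ordered fields without decidable order

module OrderedFieldProperties {c ℓ₁ ℓ₂} (R : RealField c ℓ₁ ℓ₂) where
  open RealField R
  open RealFieldProperties R
  open IntegerCoefficients commutativeRing
  open HeytingProperties (HeytingField.heytingCommutativeRing heytingField) using (invertibleʳ⇒#; x-0≈x)

  -- The substitute for trichotomy: apartness is cotransitive, and an apartness is a strict
  -- inequality in one of the two directions.
  <-cotrans : ∀ {x y} z → x < y → x < z ⊎ z < y
  <-cotrans {x} {y} z x<y with #-cotrans (Equivalence.from #⇔<⊎> (inj₁ x<y)) z
  ... | inj₁ x#z with Equivalence.to #⇔<⊎> x#z
  ...   | inj₁ x<z = inj₁ x<z
  ...   | inj₂ z<x = inj₂ (<-trans z<x x<y)
  <-cotrans {x} {y} z x<y | inj₂ z#y with Equivalence.to #⇔<⊎> z#y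
  ...   | inj₁ z<y = inj₂ z<y
  ...   | inj₂ y<z = inj₁ (<-trans x<y y<z)

  infix 4 _≤_
  _≤_ : Carrier → Carrier → Set ℓ₂
  x ≤ y = ¬ (y < x)

  <-asym : ∀ {x y} → x < y → ¬ (y < x)
  <-asym x<y y<x = irrefl ≈-refl (<-trans x<y y<x)

  <⇒≤ : ∀ {x y} → x < y → x ≤ y
  <⇒≤ = <-asym

  ≤-reflexive : ∀ {x y} → x ≈ y → x ≤ y
  ≤-reflexive x≈y y<x = irrefl (≈-sym x≈y) y<x

  ≤-refl : ∀ {x} → x ≤ x
  ≤-refl = ≤-reflexive ≈-refl

  ≤-trans : ∀ {x y z} → x ≤ y → y ≤ z → x ≤ z
  ≤-trans {y = y} x≤y y≤z z<x with <-cotrans y z<x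
  ... | inj₁ z<y = y≤z z<y
  ... | inj₂ y<x = x≤y y<x

  <-≤-trans : ∀ {x y z} → x < y → y ≤ z → x < z
  <-≤-trans {z = z} x<y y≤z with <-cotrans z x<y
  ... | inj₁ x<z = x<z
  ... | inj₂ z<y = contradiction z<y y≤z

  ≤-<-trans : ∀ {x y z} → x ≤ y → y < z → x < z
  ≤-<-trans {x = x} x≤y y<z with <-cotrans x y<z
  ... | inj₁ y<x = contradiction y<x x≤y
  ... | inj₂ x<z = x<z

  ≤-antisym : ∀ {x y} → x ≤ y → y ≤ x → x ≈ y
  ≤-antisym x≤y y≤x = proj₁ (tight _ _) λ x#y → [ y≤x , x≤y ]′ (Equivalence.to #⇔<⊎> x#y)

  ≤-isPreorder : IsPreorder _≈_ _≤_
  ≤-isPreorder = record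
    { isEquivalence = CommutativeRing.isEquivalence commutativeRing
    ; reflexive     = ≤-reflexive
    ; trans         = ≤-trans
    }

  module ≤-Reasoning = Relation.Binary.Reasoning.Base.Triple
    ≤-isPreorder <-asym <-trans <-resp-≈ <⇒≤ <-≤-trans ≤-<-trans
  open ≤-Reasoning

  -- With these, an inequality is proved by exhibiting the difference of
  -- its sides as a sum of products of nonnegative differences.

  0<y-x⇒x<y : ∀ {x y} → 0# < y - x → x < y
  0<y-x⇒x<y {x} {y} 0<y-x = begin-strict
    x             ≈⟨ +-identityˡ x ⟨
    0# + x        <⟨ +-monoˡ-< x 0<y-x ⟩
    (y - x) + x   ≈⟨ solve 2 (λ x y → (y :- x) :+ x := y) ≈-refl x y ⟩
    y             ∎

  x<y⇒0<y-x : ∀ {x y} → x < y → 0# < y - x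
  x<y⇒0<y-x {x} {y} x<y = begin-strict
    0#     ≈⟨ -‿inverseʳ x ⟨
    x - x  <⟨ +-monoˡ-< (- x) x<y ⟩
    y - x  ∎

  x≤y⇒0≤y-x : ∀ {x y} → x ≤ y → 0# ≤ y - x
  x≤y⇒0≤y-x {x} {y} x≤y y-x<0 = x≤y (begin-strict
    y             ≈⟨ solve 2 (λ x y → y := (y :- x) :+ x) ≈-refl x y ⟩
    (y - x) + x   <⟨ +-monoˡ-< x y-x<0 ⟩
    0# + x        ≈⟨ +-identityˡ x ⟩
    x             ∎)

  0≤y-x⇒x≤y : ∀ {x y} → 0# ≤ y - x → x ≤ y
  0≤y-x⇒x≤y {x} {y} 0≤y-x y<x = 0≤y-x (begin-strict
    y - x   <⟨ +-monoˡ-< (- x) y<x ⟩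
    x - x   ≈⟨ -‿inverseʳ x ⟩
    0#      ∎)

  ≤-by : ∀ {x y d} → 0# ≤ d → y - x ≈ d → x ≤ y
  ≤-by 0≤d y-x≈d = 0≤y-x⇒x≤y (≤-trans 0≤d (≤-reflexive (≈-sym y-x≈d)))

  <-by : ∀ {x y d} → 0# < d → y - x ≈ d → x < y
  <-by 0<d y-x≈d = 0<y-x⇒x<y (<-respʳ-≈ (≈-sym y-x≈d) 0<d)

  +-monoˡ-≤ : ∀ {x y} z → x ≤ y → x + z ≤ y + z
  +-monoˡ-≤ {x} {y} z x≤y =
    ≤-by (x≤y⇒0≤y-x x≤y) (solve 3 (λ x y z → (y :+ z) :- (x :+ z) := y :- x) ≈-refl x y z)

  +-monoʳ-≤ : ∀ {x y} z → x ≤ y → z + x ≤ z + y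
  +-monoʳ-≤ {x} {y} z x≤y =
    ≤-by (x≤y⇒0≤y-x x≤y) (solve 3 (λ x y z → (z :+ y) :- (z :+ x) := y :- x) ≈-refl x y z)

  +-mono-≤ : ∀ {x y z w} → x ≤ y → z ≤ w → x + z ≤ y + w
  +-mono-≤ {y = y} {z = z} x≤y z≤w = ≤-trans (+-monoˡ-≤ z x≤y) (+-monoʳ-≤ y z≤w)

  +-nonneg : ∀ {x y} → 0# ≤ x → 0# ≤ y → 0# ≤ x + y
  +-nonneg 0≤x 0≤y = ≤-trans (≤-reflexive (≈-sym (+-identityˡ 0#))) (+-mono-≤ 0≤x 0≤y)

  -- The signs of the factors cannot be examined by cases. But a negative product is invertible,
  -- hence so are both factors; being nonnegative and apart from 0 they are positive, and so is the
  -- product.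
  *-nonneg : ∀ {x y} → 0# ≤ x → 0# ≤ y → 0# ≤ x * y
  *-nonneg {x} {y} 0≤x 0≤y xy<0 with #⇒invertible (Equivalence.from #⇔<⊎> (inj₁ xy<0))
  ... | z , _ , xyz≈1 = <-asym (*-pos 0<x 0<y) xy<0
    where
    xyz≈1′ : x * y * z ≈ 1#
    xyz≈1′ = ≈-trans (*-congʳ (≈-sym (x-0≈x (x * y)))) xyz≈1

    pos : ∀ {u v} → 0# ≤ u → u * v ≈ 1# → 0# < u
    pos {u} {v} 0≤u uv≈1 with Equivalence.to #⇔<⊎> (invertibleʳ⇒# (v , ≈-trans (*-congʳ (x-0≈x u)) uv≈1))
    ... | inj₁ u<0 = contradiction u<0 0≤u
    ... | inj₂ 0<u = 0<u

    0<x : 0# < x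
    0<x = pos 0≤x (≈-trans (≈-sym (*-assoc x y z)) xyz≈1′)

    0<y : 0# < y
    0<y = pos 0≤y (≈-trans (solve 3 (λ x y z → y :* (x :* z) := x :* y :* z) ≈-refl x y z) xyz≈1′)

  *-monoˡ-≤ : ∀ {x y z} → 0# ≤ z → x ≤ y → x * z ≤ y * z
  *-monoˡ-≤ {x} {y} {z} 0≤z x≤y =
    ≤-by (*-nonneg (x≤y⇒0≤y-x x≤y) 0≤z) (solve 3 (λ x y z → y :* z :- x :* z := (y :- x) :* z) ≈-refl x y z)

  *-monoʳ-≤ : ∀ {x y z} → 0# ≤ z → x ≤ y → z * x ≤ z * y
  *-monoʳ-≤ {x} {y} {z} 0≤z x≤y =
    ≤-by (*-nonneg 0≤z (x≤y⇒0≤y-x x≤y)) (solve 3 (λ x y z → z :* y :- z :* x := z :* (y :- x)) ≈-refl x y z)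

  *-mono-≤ : ∀ {x y z w} → 0# ≤ z → 0# ≤ y → x ≤ y → z ≤ w → x * z ≤ y * w
  *-mono-≤ 0≤z 0≤y x≤y z≤w = ≤-trans (*-monoˡ-≤ 0≤z x≤y) (*-monoʳ-≤ 0≤y z≤w)

  *-monoʳ-< : ∀ {x y z} → 0# < z → x < y → z * x < z * y
  *-monoʳ-< {x} {y} {z} 0<z x<y =
    <-by (*-pos 0<z (x<y⇒0<y-x x<y)) (solve 3 (λ x y z → z :* y :- z :* x := z :* (y :- x)) ≈-refl x y z)

  *-cancelˡ-≤ : ∀ {x y z} → 0# < z → z * x ≤ z * y → x ≤ y
  *-cancelˡ-≤ 0<z zx≤zy y<x = zx≤zy (*-monoʳ-< 0<z y<x)

  *-cancelˡ-≈ : ∀ {x y z} → 0# < z → z * x ≈ z * y → x ≈ y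
  *-cancelˡ-≈ 0<z eq = ≤-antisym (*-cancelˡ-≤ 0<z (≤-reflexive eq)) (*-cancelˡ-≤ 0<z (≤-reflexive (≈-sym eq)))

  inv-pos : ∀ {x} (0<x : 0# < x) → 0# < inv 0<x
  inv-pos {x} 0<x with <-cotrans (x * inv 0<x) 0<1
  ... | inj₂ q = contradiction q (≤-reflexive (≈-sym (inv-inverseʳ 0<x)))
  ... | inj₁ 0<xi with Equivalence.to #⇔<⊎> (invertibleʳ⇒# (x , ≈-trans (*-congʳ (x-0≈x _)) (≈-trans (*-comm _ x) (inv-inverseʳ 0<x))))
  ...   | inj₂ 0<i = 0<i
  ...   | inj₁ i<0 = contradiction (*-monoʳ-< 0<x i<0) (<-asym (<-respˡ-≈ (≈-sym (zeroʳ x)) 0<xi))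

  ^-nonneg : ∀ {x} → 0# ≤ x → ∀ n → 0# ≤ x ^ n
  ^-nonneg 0≤x zero    = <⇒≤ 0<1
  ^-nonneg 0≤x (suc n) = *-nonneg 0≤x (^-nonneg 0≤x n)

  ^-mono-≤ : ∀ {x y} → 0# ≤ x → x ≤ y → ∀ n → x ^ n ≤ y ^ n
  ^-mono-≤ 0≤x x≤y zero    = ≤-refl
  ^-mono-≤ 0≤x x≤y (suc n) = *-mono-≤ (^-nonneg 0≤x n) (≤-trans 0≤x x≤y) x≤y (^-mono-≤ 0≤x x≤y n)

  fromℕ-nonneg : ∀ n → 0# ≤ fromℕ n
  fromℕ-nonneg zero    = ≤-refl
  fromℕ-nonneg (suc n) = +-nonneg (<⇒≤ 0<1) (fromℕ-nonneg n)

  fromℕ-+ : ∀ m n → fromℕ (m ℕ.+ n) ≈ fromℕ m + fromℕ n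
  fromℕ-+ zero    n = ≈-sym (+-identityˡ _)
  fromℕ-+ (suc m) n = ≈-trans (+-congˡ (fromℕ-+ m n)) (≈-sym (+-assoc _ _ _))

  fromℕ-* : ∀ m n → fromℕ (m ℕ.* n) ≈ fromℕ m * fromℕ n
  fromℕ-* zero    n = ≈-sym (zeroˡ _)
  fromℕ-* (suc m) n = begin-equality
    fromℕ (n ℕ.+ m ℕ.* n)             ≈⟨ fromℕ-+ n (m ℕ.* n) ⟩
    fromℕ n + fromℕ (m ℕ.* n)         ≈⟨ +-congˡ (fromℕ-* m n) ⟩
    fromℕ n + fromℕ m * fromℕ n       ≈⟨ solve 2 (λ m n → n :+ m :* n := (con (+ 1) :+ m) :* n) ≈-refl (fromℕ m) (fromℕ n) ⟩
    (1# + fromℕ m) * fromℕ n          ∎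

  fromℕ-mono-≤ : ∀ {m n} → m ℕ.≤ n → fromℕ m ≤ fromℕ n
  fromℕ-mono-≤ {n = n} ℕ.z≤n = fromℕ-nonneg n
  fromℕ-mono-≤ (ℕ.s≤s m≤n)   = +-monoʳ-≤ 1# (fromℕ-mono-≤ m≤n)

  ½+½≈1 : ½ + ½ ≈ 1#
  ½+½≈1 = ≈-trans (solve 1 (λ h → h :+ h := (con (+ 1) :+ (con (+ 1) :+ con (+ 0))) :* h) ≈-refl ½) (inv-inverseʳ (fromℕ-pos 2))

  0<½ : 0# < ½
  0<½ = inv-pos (fromℕ-pos 2)

  halves : ∀ x → x * ½ + x * ½ ≈ x
  halves x = ≈-trans (≈-sym (distribˡ x ½ ½)) (≈-trans (*-congˡ ½+½≈1) (*-identityʳ x))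

  half-pos : ∀ {ε} → 0# < ε → 0# < ε * ½
  half-pos 0<ε = *-pos 0<ε 0<½

  x≤x+y : ∀ {x y} → 0# ≤ y → x ≤ x + y
  x≤x+y {x} {y} 0≤y = ≤-by 0≤y (solve 2 (λ x y → (x :+ y) :- x := y) ≈-refl x y)

  dominated : ∀ {ε} x → 0# < ε → ∃[ n ] (x < ε * fromℕ n)
  dominated {ε} x 0<ε with archimedean (x * inv 0<ε)
  ... | n , xε⁻¹<n = n , (begin-strict
    x                    ≈⟨ *-identityʳ x ⟨
    x * 1#               ≈⟨ *-congˡ (inv-inverseʳ 0<ε) ⟨
    x * (ε * inv 0<ε)    ≈⟨ solve 3 (λ x e i → x :* (e :* i) := e :* (x :* i)) ≈-refl x ε (inv 0<ε) ⟩
    ε * (x * inv 0<ε)    <⟨ *-monoʳ-< 0<ε xε⁻¹<n ⟩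
    ε * fromℕ n          ∎)

-- Approximation and limits with weak inequalities

module Limits {c ℓ₁ ℓ₂} (R : RealField c ℓ₁ ℓ₂) where
  open RealField R
  open RealFieldProperties R
  open IntegerCoefficients commutativeRing
  open OrderedFieldProperties R
  open ≤-Reasoning

  -- Weak, so that an exact error bound can serve as radius even when it is 0, as the remainder in
  -- Newton's formula may be, and so that estimates pass to limits.
  Near : Carrier → Carrier → Carrier → Set ℓ₂
  Near ε x y = (x ≤ y + ε) × (y ≤ x + ε)

  near-refl : ∀ {ε x} → 0# ≤ ε → Near ε x x
  near-refl 0≤ε = x≤x+y 0≤ε , x≤x+y 0≤ε

  near-sym : ∀ {ε x y} → Near ε x y → Near ε y x
  near-sym (p , q) = q , p

  near-weaken : ∀ {ε δ x y} → ε ≤ δ → Near ε x y → Near δ x y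
  near-weaken ε≤δ (p , q) = ≤-trans p (+-monoʳ-≤ _ ε≤δ) , ≤-trans q (+-monoʳ-≤ _ ε≤δ)

  near-resp : ∀ {ε x x′ y y′} → x ≈ x′ → y ≈ y′ → Near ε x y → Near ε x′ y′
  near-resp x≈x′ y≈y′ (p , q) =
    ≤-trans (≤-reflexive (≈-sym x≈x′)) (≤-trans p (≤-reflexive (+-congʳ y≈y′))) ,
    ≤-trans (≤-reflexive (≈-sym y≈y′)) (≤-trans q (≤-reflexive (+-congʳ x≈x′)))

  near-+ : ∀ {ε δ x y z w} → Near ε x y → Near δ z w → Near (ε + δ) (x + z) (y + w)
  near-+ {ε} {δ} {x} {y} {z} {w} (p , q) (r , s) = lem p r , lem q s
    where
    lem : ∀ {x y z w} → x ≤ y + ε → z ≤ w + δ → x + z ≤ (y + w) + (ε + δ)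
    lem {x} {y} {z} {w} p r = ≤-trans (+-mono-≤ p r)
      (≤-reflexive (solve 4 (λ y w e d → (y :+ e) :+ (w :+ d) := (y :+ w) :+ (e :+ d)) ≈-refl y w ε δ))

  near-trans : ∀ {ε δ x y z} → Near ε x y → Near δ y z → Near (ε + δ) x z
  near-trans {ε} {δ} {x} {y} {z} (p , q) (r , s) =
    (begin
      x            ≤⟨ p ⟩
      y + ε        ≤⟨ +-monoˡ-≤ ε r ⟩
      (z + δ) + ε  ≈⟨ solve 3 (λ z d e → (z :+ d) :+ e := z :+ (e :+ d)) ≈-refl z δ ε ⟩
      z + (ε + δ)  ∎) ,
    (begin
      z            ≤⟨ s ⟩
      y + δ        ≤⟨ +-monoˡ-≤ δ q ⟩
      (x + ε) + δ  ≈⟨ +-assoc x ε δ ⟩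
      x + (ε + δ)  ∎)

  near-difference : ∀ {ε x y} → Near ε x y → Near ε (x - y) 0#
  near-difference {ε} {x} {y} (p , q) =
    ≤-by (x≤y⇒0≤y-x p) (solve 3 (λ x y e → (con (+ 0) :+ e) :- (x :- y) := (y :+ e) :- x) ≈-refl x y ε) ,
    ≤-by (x≤y⇒0≤y-x q) (solve 3 (λ x y e → ((x :- y) :+ e) :- con (+ 0) := (x :+ e) :- y) ≈-refl x y ε)

  near-0⇒nonneg : ∀ {ε x} → Near ε x 0# → (0# ≤ ε - x) × (0# ≤ ε + x)
  near-0⇒nonneg {ε} {x} (p , q) =
    ≤-trans (x≤y⇒0≤y-x p) (≤-reflexive (+-congʳ (+-identityˡ ε))) ,
    ≤-trans q (≤-reflexive (+-comm x ε))

  -- 2 (ε δ ∓ x y) = (ε ∓ x) (δ + y) + (ε ± x) (δ - y).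
  near-* : ∀ {ε δ x y} → Near ε x 0# → Near δ y 0# → Near (ε * δ) (x * y) 0#
  near-* {ε} {δ} {x} {y} p q =
    let p₁ , p₂ = near-0⇒nonneg p
        q₁ , q₂ = near-0⇒nonneg q in
    half (≤-by (+-nonneg (*-nonneg p₁ q₂) (*-nonneg p₂ q₁))
      (solve 4 (λ e d x y → (con (+ 2) :* (con (+ 0) :+ e :* d)) :- con (+ 2) :* (x :* y)
                            := (e :- x) :* (d :+ y) :+ (e :+ x) :* (d :- y)) ≈-refl ε δ x y)) ,
    half (≤-by (+-nonneg (*-nonneg p₁ q₁) (*-nonneg p₂ q₂))
      (solve 4 (λ e d x y → (con (+ 2) :* (x :* y :+ e :* d)) :- con (+ 2) :* con (+ 0)
                            := (e :- x) :* (d :- y) :+ (e :+ x) :* (d :+ y)) ≈-refl ε δ x y))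
    where
    half : ∀ {a b} → (1# + 1#) * a ≤ (1# + 1#) * b → a ≤ b
    half = *-cancelˡ-≤ (+-pos 0<1 0<1)

  near-0+0 : ∀ {ε δ x y} → Near ε x 0# → Near δ y 0# → Near (ε + δ) (x + y) 0#
  near-0+0 p q = near-resp ≈-refl (+-identityʳ 0#) (near-+ p q)

  near-fromDifference : ∀ {ε x y} → Near ε (x - y) 0# → Near ε x y
  near-fromDifference {ε} {x} {y} (p , q) =
    ≤-by (x≤y⇒0≤y-x p) (solve 3 (λ x y e → (y :+ e) :- x := (con (+ 0) :+ e) :- (x :- y)) ≈-refl x y ε) ,
    ≤-by (x≤y⇒0≤y-x q) (solve 3 (λ x y e → (x :+ e) :- y := ((x :- y) :+ e) :- con (+ 0)) ≈-refl x y ε)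

  near-*-difference : ∀ {ε δ M x x′ y y′} → Near ε x x′ → Near δ y y′ → Near M x′ 0# → Near M y′ 0# →
                      Near (ε * δ + (ε * M + M * δ)) (x * y) (x′ * y′)
  near-*-difference {x = x} {x′} {y} {y′} p q m n = near-fromDifference (near-resp expand ≈-refl
    (near-0+0 (near-* (near-difference p) (near-difference q))
      (near-0+0 (near-* (near-difference p) n) (near-* m (near-difference q)))))
    where
    expand : (x - x′) * (y - y′) + ((x - x′) * y′ + x′ * (y - y′)) ≈ x * y - x′ * y′
    expand = solve 4 (λ x x′ y y′ → (x :- x′) :* (y :- y′) :+ ((x :- x′) :* y′ :+ x′ :* (y :- y′)) := x :* y :- x′ :* y′)
      ≈-refl x x′ y y′

  bound : ∀ x → ∃[ M ] (0# ≤ M × Near M x 0#)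
  bound x =
    let m , x<m  = archimedean x
        n , -x<n = archimedean (- x) in
    fromℕ m + fromℕ n , +-nonneg (fromℕ-nonneg m) (fromℕ-nonneg n) ,
    ≤-by (+-nonneg (x≤y⇒0≤y-x (<⇒≤ x<m)) (fromℕ-nonneg n))
      (solve 3 (λ x m n → (con (+ 0) :+ (m :+ n)) :- x := (m :- x) :+ n) ≈-refl x (fromℕ m) (fromℕ n)) ,
    ≤-by (+-nonneg (x≤y⇒0≤y-x (<⇒≤ -x<n)) (fromℕ-nonneg m))
      (solve 3 (λ x m n → (x :+ (m :+ n)) :- con (+ 0) := (n :- :- x) :+ m) ≈-refl x (fromℕ m) (fromℕ n))

  -- The reciprocal of a positive integer meets both upper bounds without a minimum of reals or a
  -- decision about the sign of `x`.
  small : ∀ {ε} x → 0# < ε → ∃[ δ ] (0# < δ × δ ≤ 1# × δ * x ≤ ε)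
  small {ε} x 0<ε = δ , 0<δ , δ≤1 , (begin
    δ * x                    ≤⟨ *-monoʳ-≤ (<⇒≤ 0<δ) (<⇒≤ x<εn) ⟩
    δ * (ε * fromℕ n)        ≤⟨ *-monoʳ-≤ (<⇒≤ 0<δ) (*-monoʳ-≤ (<⇒≤ 0<ε) (fromℕ-mono-≤ (ℕ.n≤1+n n))) ⟩
    δ * (ε * fromℕ (suc n))  ≈⟨ solve 3 (λ d e n → d :* (e :* n) := e :* (n :* d)) ≈-refl δ ε (fromℕ (suc n)) ⟩
    ε * (fromℕ (suc n) * δ)  ≈⟨ *-congˡ (inv-inverseʳ (fromℕ-pos (suc n))) ⟩
    ε * 1#                   ≈⟨ *-identityʳ ε ⟩
    ε                        ∎)
    where
    n    = proj₁ (dominated x 0<ε)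
    x<εn = proj₂ (dominated x 0<ε)
    δ = inv (fromℕ-pos (suc n))
    0<δ = inv-pos (fromℕ-pos (suc n))
    δ≤1 : δ ≤ 1#
    δ≤1 = begin
      δ                    ≈⟨ *-identityˡ δ ⟨
      1# * δ               ≤⟨ *-monoˡ-≤ (<⇒≤ 0<δ) (x≤x+y (fromℕ-nonneg n)) ⟩
      fromℕ (suc n) * δ    ≈⟨ inv-inverseʳ (fromℕ-pos (suc n)) ⟩
      1#                   ∎

  infix 4 _⇝_
  _⇝_ : (ℕ → Carrier) → Carrier → Set (c ⊔ ℓ₂)
  u ⇝ l = ∀ ε → 0# < ε → ∃[ K ] (∀ n → K ℕ.≤ n → Near ε (u n) l)

  within⇒near : ∀ {ε x y} → Within ε x y → Near ε x y
  within⇒near {ε} {x} {y} (p , q) = lem p , lem q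
    where
    lem : ∀ {x y} → x - y < ε → x ≤ y + ε
    lem {x} {y} p = ≤-by (x≤y⇒0≤y-x (<⇒≤ p)) (solve 3 (λ x y e → (y :+ e) :- x := e :- (x :- y)) ≈-refl x y ε)

  near⇒within : ∀ {ε δ x y} → δ < ε → Near δ x y → Within ε x y
  near⇒within {ε} {δ} δ<ε (p , q) = lem p , lem q
    where
    lem : ∀ {x y} → x ≤ y + δ → x - y < ε
    lem {x} {y} p = ≤-<-trans
      (≤-by (x≤y⇒0≤y-x p) (solve 3 (λ x y e → e :- (x :- y) := (y :+ e) :- x) ≈-refl x y δ)) δ<ε

  half-< : ∀ {ε} → 0# < ε → ε * ½ < ε
  half-< {ε} 0<ε = <-by (half-pos 0<ε) (≈-trans (+-congʳ (≈-sym (halves ε)))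
    (solve 1 (λ h → (h :+ h) :- h := h) ≈-refl (ε * ½)))

  ⟶⇒⇝ : ∀ {u l} → u ⟶ l → u ⇝ l
  ⟶⇒⇝ u⟶l ε 0<ε = let K , h = u⟶l ε 0<ε in K , λ n K≤n → within⇒near (h n K≤n)

  ⇝⇒⟶ : ∀ {u l} → u ⇝ l → u ⟶ l
  ⇝⇒⟶ u⇝l ε 0<ε = let K , h = u⇝l (ε * ½) (half-pos 0<ε) in K , λ n K≤n → near⇒within (half-< 0<ε) (h n K≤n)

  ⇝-const : ∀ {x} → (λ _ → x) ⇝ x
  ⇝-const ε 0<ε = 0 , λ _ _ → near-refl (<⇒≤ 0<ε)

  ⇝-cong : ∀ {u v l m} → (∀ n → u n ≈ v n) → l ≈ m → u ⇝ l → v ⇝ m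
  ⇝-cong u≈v l≈m u⇝l ε 0<ε = let K , h = u⇝l ε 0<ε in K , λ n K≤n → near-resp (u≈v n) l≈m (h n K≤n)

  ⇝-+ : ∀ {u v l m} → u ⇝ l → v ⇝ m → (λ n → u n + v n) ⇝ l + m
  ⇝-+ u⇝l v⇝m ε 0<ε =
    let K , g = u⇝l (ε * ½) (half-pos 0<ε)
        L , h = v⇝m (ε * ½) (half-pos 0<ε)
    in K ℕ.⊔ L , λ n K⊔L≤n → near-weaken (≤-reflexive (halves ε))
    (near-+ (g n (ℕ.m⊔n≤o⇒m≤o K L K⊔L≤n)) (h n (ℕ.m⊔n≤o⇒n≤o K L K⊔L≤n)))

  ⇝-* : ∀ {u v l m} → u ⇝ l → v ⇝ m → (λ n → u n * v n) ⇝ l * m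
  ⇝-* {u} {v} {l} {m} u⇝l v⇝m ε 0<ε =
    let L , 0≤L , l≤L       = bound l
        M , 0≤M , m≤M       = bound m
        -- As δ ≤ 1, the total error δδ + 2δ(L + M) is at most δ(1 + 2(L + M)).
        δ , 0<δ , δ≤1 , δ≤  = small (1# + ((L + M) + (L + M))) 0<ε
        J , g               = u⇝l δ 0<δ
        K , h               = v⇝m δ 0<δ
    in J ℕ.⊔ K , λ n J⊔K≤n → near-weaken (le (<⇒≤ 0<δ) δ≤1 δ≤)
    (near-*-difference (g n (ℕ.m⊔n≤o⇒m≤o J K J⊔K≤n)) (h n (ℕ.m⊔n≤o⇒n≤o J K J⊔K≤n))
      (near-weaken (x≤x+y 0≤M) l≤L) (near-weaken (≤-trans (x≤x+y 0≤L) (≤-reflexive (+-comm M L))) m≤M))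
    where
    le : ∀ {δ s} → 0# ≤ δ → δ ≤ 1# → δ * (1# + (s + s)) ≤ ε → δ * δ + (δ * s + s * δ) ≤ ε
    le {δ} {s} 0≤δ δ≤1 δ≤ = begin
      δ * δ + (δ * s + s * δ)    ≤⟨ +-monoˡ-≤ _ (*-monoʳ-≤ 0≤δ δ≤1) ⟩
      δ * 1# + (δ * s + s * δ)   ≈⟨ solve 2 (λ d s → d :* con (+ 1) :+ (d :* s :+ s :* d) := d :* (con (+ 1) :+ (s :+ s))) ≈-refl δ s ⟩
      δ * (1# + (s + s))         ≤⟨ δ≤ ⟩
      ε                          ∎

  ⇝-*ˡ : ∀ {u l} x → u ⇝ l → (λ n → x * u n) ⇝ x * l
  ⇝-*ˡ x = ⇝-* ⇝-const

  ⇝-shift : ∀ {u l} k → (λ n → u (k ℕ.+ n)) ⇝ l → u ⇝ l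
  ⇝-shift {u} k v⇝l ε 0<ε = let K , h = v⇝l ε 0<ε in k ℕ.+ K , λ n k+K≤n → ≡.subst (λ m → Near ε (u m) _)
    (ℕ.m+[n∸m]≡n (ℕ.m+n≤o⇒m≤o k k+K≤n))
    (h (n ℕ.∸ k) (ℕ.≤-trans (ℕ.≤-reflexive (≡.sym (ℕ.m+n∸m≡n k K))) (ℕ.∸-monoˡ-≤ k k+K≤n)))

  ⇝-lowerBound : ∀ {u v l m} K → (∀ n → K ℕ.≤ n → u n ≤ v n) → u ⇝ l → v ⇝ m → l ≤ m
  ⇝-lowerBound {u} {v} {l} {m} K u≤v u⇝l v⇝m m<l = half-bad (begin
      l                   ≤⟨ proj₂ (g n₀ (ℕ.m⊔n≤o⇒m≤o I J (ℕ.m⊔n≤o⇒n≤o K (I ℕ.⊔ J) ℕ.≤-refl))) ⟩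
      u n₀ + η             ≤⟨ +-monoˡ-≤ η (u≤v n₀ (ℕ.m⊔n≤o⇒m≤o K (I ℕ.⊔ J) ℕ.≤-refl)) ⟩
      v n₀ + η             ≤⟨ +-monoˡ-≤ η (proj₁ (h n₀ (ℕ.m⊔n≤o⇒n≤o I J (ℕ.m⊔n≤o⇒n≤o K (I ℕ.⊔ J) ℕ.≤-refl)))) ⟩
      m + η + η           ≈⟨ +-assoc m η η ⟩
      m + (η + η)         ≈⟨ +-congˡ (halves _) ⟩
      m + (l - m) * ½     ∎)
    where
    -- A quarter of the supposed gap: the two errors together use up only half of it.
    η = (l - m) * ½ * ½
    0<η = half-pos (half-pos (x<y⇒0<y-x m<l))
    I = proj₁ (u⇝l η 0<η)
    g = proj₂ (u⇝l η 0<η)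
    J = proj₁ (v⇝m η 0<η)
    h = proj₂ (v⇝m η 0<η)
    n₀ = K ℕ.⊔ (I ℕ.⊔ J)
    half-bad : ¬ (l ≤ m + (l - m) * ½)
    half-bad p = p (<-by (half-pos (x<y⇒0<y-x m<l))
      (≈-trans (solve 3 (λ l m h → l :- (m :+ h) := (l :- m) :- h) ≈-refl l m ((l - m) * ½))
      (≈-trans (+-congʳ (≈-sym (halves (l - m))))
        (solve 1 (λ h → (h :+ h) :- h := h) ≈-refl ((l - m) * ½)))))

  -- The quadratic term is absorbed by ε ≤ 1, at the price of doubling `a` in each step.
  [1+ε]^k-linear : ∀ k → ∃[ a ] (0# ≤ a × (∀ ε → 0# ≤ ε → ε ≤ 1# → (1# + ε) ^ k ≤ 1# + ε * a))
  [1+ε]^k-linear zero    = 0# , ≤-refl , λ ε _ _ → ≤-reflexive (solve 1 (λ e → con (+ 1) := con (+ 1) :+ e :* con (+ 0)) ≈-refl ε)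
  [1+ε]^k-linear (suc k) = let a , 0≤a , h = [1+ε]^k-linear k in 1# + (a + a) , +-nonneg (<⇒≤ 0<1) (+-nonneg 0≤a 0≤a) , λ ε 0≤ε ε≤1 → begin
    (1# + ε) * (1# + ε) ^ k       ≤⟨ *-monoʳ-≤ (+-nonneg (<⇒≤ 0<1) 0≤ε) (h ε 0≤ε ε≤1) ⟩
    (1# + ε) * (1# + ε * a)       ≤⟨ ≤-by (*-nonneg (*-nonneg 0≤ε 0≤a) (x≤y⇒0≤y-x ε≤1))
                                       (solve 2 (λ e a → (con (+ 1) :+ e :* (con (+ 1) :+ (a :+ a))) :- (con (+ 1) :+ e) :* (con (+ 1) :+ e :* a)
                                                         := e :* a :* (con (+ 1) :- e)) ≈-refl ε a) ⟩
    1# + ε * (1# + (a + a))       ∎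

  -- A squeeze between the k-th powers of w / (w + D) and (w + D) / w, where w = mγ tends to
  -- infinity and `D` is constant. The hypotheses are multiplied out, so that they make sense for m
  -- = 0, where w vanishes.
  ratio⇝1 : ∀ k {γ D} → 0# < γ → ∀ (M : ℕ → Carrier) → (∀ m → 0# ≤ M m) →
            (∀ m → M m * (fromℕ m * γ) ^ k ≤ (fromℕ m * γ + D) ^ k) →
            (∀ m → (fromℕ m * γ) ^ k ≤ M m * (fromℕ m * γ + D) ^ k) →
            0# ≤ D → M ⇝ 1#
  ratio⇝1 k {γ} {D} 0<γ M 0≤M upper lower 0≤D η 0<η =
    let a , 0≤a , lin               = [1+ε]^k-linear k
        -- The lower estimate loses M η′, and M ≤ 1 + η′ ≤ 2, so twice `η′` has to fit below `η`.
        η′ , 0<η′ , η′≤1 , 2η′≤η    = small (1# + 1#) 0<η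
        ε , 0<ε , ε≤1 , εa≤η′       = small a 0<η′
        L , D<εγL                   = dominated D (*-pos 0<ε 0<γ)
    -- Starting at `suc L` makes m a successor, so that w is positive and its power can be
    -- cancelled.
    in suc L , close 0<η′ η′≤1 2η′≤η 0<ε (≤-trans (lin ε (<⇒≤ 0<ε) ε≤1) (+-monoʳ-≤ 1# εa≤η′)) L D<εγL
    where
    close : ∀ {ε η′} → 0# < η′ → η′ ≤ 1# → η′ * (1# + 1#) ≤ η → 0# < ε → (1# + ε) ^ k ≤ 1# + η′ →
            ∀ L → D < ε * γ * fromℕ L → ∀ m → L ℕ.< m → Near η (M m) 1#
    close {ε} {η′} 0<η′ η′≤1 2η′≤η 0<ε t≤1+η′ L D<εγL m@(suc m-1) L<m = M≤1+η , 1≤M+η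
      where
      w = fromℕ m * γ
      0<w = *-pos (fromℕ-pos m) 0<γ
      0<wᵏ = ^-pos 0<w k
      t = (1# + ε) ^ k

      w+D≤ : w + D ≤ (1# + ε) * w
      w+D≤ = begin
        w + D                        ≤⟨ +-monoʳ-≤ w (<⇒≤ D<εγL) ⟩
        w + ε * γ * fromℕ L          ≤⟨ +-monoʳ-≤ w (*-monoʳ-≤ (<⇒≤ (*-pos 0<ε 0<γ)) (fromℕ-mono-≤ (ℕ.<⇒≤ L<m))) ⟩
        w + ε * γ * fromℕ m          ≈⟨ solve 3 (λ e g m → m :* g :+ e :* g :* m := (con (+ 1) :+ e) :* (m :* g)) ≈-refl ε γ (fromℕ m) ⟩
        (1# + ε) * w                 ∎

      power : ∀ x y k → (x * y) ^ k ≈ y ^ k * x ^ k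
      power x y zero    = ≈-sym (*-identityˡ 1#)
      power x y (suc k) = ≈-trans (*-congˡ (power x y k))
        (solve 4 (λ x y u v → x :* y :* (u :* v) := (y :* u) :* (x :* v)) ≈-refl x y (y ^ k) (x ^ k))

      [w+D]ᵏ≤ : (w + D) ^ k ≤ w ^ k * t
      [w+D]ᵏ≤ = ≤-trans (^-mono-≤ (+-nonneg (<⇒≤ 0<w) 0≤D) w+D≤ k) (≤-reflexive (power (1# + ε) w k))

      M≤t : M m ≤ t
      M≤t = *-cancelˡ-≤ 0<wᵏ (≤-trans (≤-reflexive (*-comm _ (M m))) (≤-trans (upper m) [w+D]ᵏ≤))

      1≤Mt : 1# ≤ M m * t
      1≤Mt = *-cancelˡ-≤ 0<wᵏ (begin
        w ^ k * 1#           ≈⟨ *-identityʳ _ ⟩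
        w ^ k                ≤⟨ lower m ⟩
        M m * (w + D) ^ k    ≤⟨ *-monoʳ-≤ (0≤M m) [w+D]ᵏ≤ ⟩
        M m * (w ^ k * t)    ≈⟨ solve 3 (λ m w t → m :* (w :* t) := w :* (m :* t)) ≈-refl (M m) (w ^ k) t ⟩
        w ^ k * (M m * t)    ∎)

      η′≤η : η′ ≤ η
      η′≤η = ≤-trans (x≤x+y (<⇒≤ 0<η′)) (≤-trans (≤-reflexive (solve 1 (λ e → e :+ e := e :* (con (+ 1) :+ con (+ 1))) ≈-refl η′)) 2η′≤η)

      M≤1+η : M m ≤ 1# + η
      M≤1+η = ≤-trans M≤t (≤-trans t≤1+η′ (+-monoʳ-≤ 1# η′≤η))

      1≤M+η : 1# ≤ M m + η
      1≤M+η = begin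
        1#                      ≤⟨ 1≤Mt ⟩
        M m * t                 ≤⟨ *-monoʳ-≤ (0≤M m) t≤1+η′ ⟩
        M m * (1# + η′)         ≈⟨ distribˡ (M m) 1# η′ ⟩
        M m * 1# + M m * η′     ≤⟨ +-mono-≤ (≤-reflexive (*-identityʳ _)) (*-monoˡ-≤ (<⇒≤ 0<η′) (≤-trans M≤t (≤-trans t≤1+η′ (+-monoʳ-≤ 1# η′≤1)))) ⟩
        M m + (1# + 1#) * η′    ≤⟨ +-monoʳ-≤ (M m) (≤-trans (≤-reflexive (*-comm _ η′)) 2η′≤η) ⟩
        M m + η                 ∎

-- Partial sums, Newton's formula and the method of moments

module Moments {c ℓ₁ ℓ₂} (R : RealField c ℓ₁ ℓ₂) where
  open RealField R
  open RealFieldProperties R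
  open IntegerCoefficients commutativeRing
  open OrderedFieldProperties R
  open Limits R
  open ≤-Reasoning

  partialSum-cong : ∀ {u v} → (∀ k → u k ≈ v k) → ∀ n → partialSum u n ≈ partialSum v n
  partialSum-cong u≈v zero    = ≈-refl
  partialSum-cong u≈v (suc n) = +-cong (partialSum-cong u≈v n) (u≈v n)

  partialSum-mono : ∀ {u v} → (∀ k → u k ≤ v k) → ∀ n → partialSum u n ≤ partialSum v n
  partialSum-mono u≤v zero    = ≤-refl
  partialSum-mono u≤v (suc n) = +-mono-≤ (partialSum-mono u≤v n) (u≤v n)

  partialSum-+ : ∀ u v n → partialSum (λ k → u k + v k) n ≈ partialSum u n + partialSum v n
  partialSum-+ u v zero    = ≈-sym (+-identityˡ 0#)
  partialSum-+ u v (suc n) = ≈-trans (+-congʳ (partialSum-+ u v n))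
    (solve 4 (λ s t x y → (s :+ t) :+ (x :+ y) := (s :+ x) :+ (t :+ y)) ≈-refl (partialSum u n) (partialSum v n) (u n) (v n))

  partialSum-*ˡ : ∀ x u n → partialSum (λ k → x * u k) n ≈ x * partialSum u n
  partialSum-*ˡ x u zero    = ≈-sym (zeroʳ x)
  partialSum-*ˡ x u (suc n) = ≈-trans (+-congʳ (partialSum-*ˡ x u n)) (≈-sym (distribˡ x _ _))

  partialSum-split : ∀ u m n → partialSum u (m ℕ.+ n) ≈ partialSum u m + partialSum (λ k → u (m ℕ.+ k)) n
  partialSum-split u m zero    = ≈-trans (≡⇒≈ (≡.cong (partialSum u) (ℕ.+-identityʳ m))) (≈-sym (+-identityʳ _))
    where
    ≡⇒≈ : ∀ {x y} → x ≡ y → x ≈ y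
    ≡⇒≈ ≡.refl = ≈-refl
  partialSum-split u m (suc n) rewrite ℕ.+-suc m n =
    ≈-trans (+-congʳ (partialSum-split u m n)) (+-assoc _ _ _)

  partialSum-head : ∀ u n → partialSum u (suc n) ≈ u 0 + partialSum (u ∘ suc) n
  partialSum-head u n = ≈-trans (partialSum-split u 1 n) (+-congʳ (+-identityˡ _))

  partialSum-zero : ∀ {u} n → (∀ k → k ℕ.< n → u k ≈ 0#) → partialSum u n ≈ 0#
  partialSum-zero zero    u≈0 = ≈-refl
  partialSum-zero (suc n) u≈0 =
    ≈-trans (+-cong (partialSum-zero n λ k k<n → u≈0 k (ℕ.m<n⇒m<1+n k<n)) (u≈0 n ℕ.≤-refl)) (+-identityˡ 0#)

  ⇝-partialSum : ∀ {u : ℕ → ℕ → Carrier} {l : ℕ → Carrier} n → (∀ r → (λ m → u m r) ⇝ l r) →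
                 (λ m → partialSum (u m) n) ⇝ partialSum l n
  ⇝-partialSum zero    u⇝l = ⇝-const
  ⇝-partialSum (suc n) u⇝l = ⇝-+ (⇝-partialSum n u⇝l) (u⇝l n)

  near-*ˡ : ∀ {ε x y z} → 0# ≤ x → Near ε y z → Near (x * ε) (x * y) (x * z)
  near-*ˡ {x = x} 0≤x (p , q) =
    ≤-trans (*-monoʳ-≤ 0≤x p) (≤-reflexive (distribˡ x _ _)) , ≤-trans (*-monoʳ-≤ 0≤x q) (≤-reflexive (distribˡ x _ _))

  near-0⇒radius-nonneg : ∀ {ε x} → Near ε x 0# → 0# ≤ ε
  near-0⇒radius-nonneg {ε} {x} p =
    let p₁ , p₂ = near-0⇒nonneg p in
    *-cancelˡ-≤ (+-pos 0<1 0<1) (≤-by (+-nonneg p₁ p₂)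
      (solve 2 (λ e x → con (+ 2) :* e :- con (+ 2) :* con (+ 0) := (e :- x) :+ (e :+ x)) ≈-refl ε x))

  -- Newton's forward difference formula with remainder

  binom : ℕ → ℕ → Carrier
  binom r k = fromℕ (k C r)

  binom-nonneg : ∀ r k → 0# ≤ binom r k
  binom-nonneg r k = fromℕ-nonneg (k C r)

  fromℕ-cong : ∀ {m n} → m ≡ n → fromℕ m ≈ fromℕ n
  fromℕ-cong ≡.refl = ≈-refl

  binom-0 : ∀ k → binom 0 k ≈ 1#
  binom-0 k = +-identityʳ 1#

  binom-pascal : ∀ r k → binom (suc r) (suc k) ≈ binom (suc r) k + binom r k
  binom-pascal r k = ≈-trans (fromℕ-cong (≡.sym (nCk+nC[k+1]≡[n+1]C[k+1] k r)))
    (≈-trans (fromℕ-+ (k C r) (k C suc r)) (+-comm _ _))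

  Δ : (ℕ → Carrier) → ℕ → Carrier
  Δ f k = f (suc k) - f k

  -- The innermost difference is taken first, so that an induction on the order passes from `f` to
  -- `Δ f`.
  Δ^ : ℕ → (ℕ → Carrier) → ℕ → Carrier
  Δ^ zero    f = f
  Δ^ (suc r) f = Δ^ r (Δ f)

  newton : ℕ → (ℕ → Carrier) → ℕ → Carrier
  newton n f k = partialSum (λ r → binom r k * Δ^ r f 0) n

  newton-zero : ∀ n f → newton (suc n) f 0 ≈ f 0
  newton-zero n f = begin-equality
    newton (suc n) f 0                                                     ≈⟨ partialSum-head (λ r → binom r 0 * Δ^ r f 0) n ⟩
    binom 0 0 * f 0 + partialSum (λ r → binom (suc r) 0 * Δ^ (suc r) f 0) n ≈⟨ +-cong (*-congʳ (binom-0 0)) (partialSum-zero n λ r _ → zeroˡ _) ⟩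
    1# * f 0 + 0#                                                          ≈⟨ solve 1 (λ x → con (+ 1) :* x :+ con (+ 0) := x) ≈-refl (f 0) ⟩
    f 0                                                                    ∎

  -- Pascal's rule makes the interpolant mirror f(k + 1) = f(k) + Δf(k), with one term fewer for the
  -- difference.
  newton-suc : ∀ n f k → newton (suc n) f (suc k) ≈ newton (suc n) f k + newton n (Δ f) k
  newton-suc n f k = begin-equality
    newton (suc n) f (suc k)
      ≈⟨ partialSum-head (λ r → binom r (suc k) * Δ^ r f 0) n ⟩
    binom 0 (suc k) * f 0 + partialSum (λ r → binom (suc r) (suc k) * Δ^ (suc r) f 0) n
      ≈⟨ +-congˡ (partialSum-cong (λ r → ≈-trans (*-congʳ (binom-pascal r k)) (distribʳ _ _ _)) n) ⟩
    binom 0 k * f 0 + partialSum (λ r → binom (suc r) k * Δ^ (suc r) f 0 + binom r k * Δ^ r (Δ f) 0) n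
      ≈⟨ +-congˡ (partialSum-+ (λ r → binom (suc r) k * Δ^ (suc r) f 0) (λ r → binom r k * Δ^ r (Δ f) 0) n) ⟩
    binom 0 k * f 0 + (partialSum (λ r → binom (suc r) k * Δ^ (suc r) f 0) n + newton n (Δ f) k)
      ≈⟨ +-assoc _ _ _ ⟨
    (binom 0 k * f 0 + partialSum (λ r → binom (suc r) k * Δ^ (suc r) f 0) n) + newton n (Δ f) k
      ≈⟨ +-congʳ (partialSum-head (λ r → binom r k * Δ^ r f 0) n) ⟨
    newton (suc n) f k + newton n (Δ f) k ∎

  2^ : ℕ → Carrier
  2^ r = (1# + 1#) ^ r

  -- Induction on both `n` and `k`. The interpolant is exact at 0, and a step in `k` adds the
  -- remainder of order n - 1 for `Δ f`. Since `Δ f` is bounded by 2B, the power of 2 is the same in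
  -- both radii, and Pascal's rule adds them up.
  newton-remainder : ∀ n {B} f → (∀ k → Near B (f k) 0#) → ∀ k → Near (2^ n * B * binom n k) (f k) (newton n f k)
  newton-remainder zero {B} f f≤B k =
    near-weaken (≤-reflexive (≈-sym (≈-trans (*-congˡ (binom-0 k)) (solve 1 (λ b → con (+ 1) :* b :* con (+ 1) := b) ≈-refl B)))) (f≤B k)
  newton-remainder (suc n) {B} f f≤B zero =
    near-resp ≈-refl (≈-sym (newton-zero n f))
      (near-refl (*-nonneg (*-nonneg (^-nonneg (<⇒≤ (+-pos 0<1 0<1)) (suc n)) (near-0⇒radius-nonneg (f≤B 0))) (binom-nonneg (suc n) 0)))
  newton-remainder (suc n) {B} f f≤B (suc k) =
    near-resp (solve 2 (λ x y → x :+ (y :- x) := y) ≈-refl (f k) (f (suc k))) (≈-sym (newton-suc n f k))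
      (near-weaken (≤-reflexive radius)
        (near-+ (newton-remainder (suc n) f f≤B k) (newton-remainder n (Δ f) Δf≤2B k)))
    where
    Δf≤2B : ∀ k → Near (B + B) (Δ f k) 0#
    Δf≤2B k = near-difference (near-trans (f≤B (suc k)) (near-sym (f≤B k)))

    radius : 2^ (suc n) * B * binom (suc n) k + 2^ n * (B + B) * binom n k ≈ 2^ (suc n) * B * binom (suc n) (suc k)
    radius = ≈-trans
      (solve 4 (λ p b x y → (con (+ 2) :* p) :* b :* x :+ p :* (b :+ b) :* y := (con (+ 2) :* p) :* b :* (x :+ y))
        ≈-refl (2^ n) B (binom (suc n) k) (binom n k))
      (*-congˡ (≈-sym (binom-pascal n k)))

  -- The method of moments

  -- Covers the tableau laws and the truncated Poisson sums alike. The total mass is left free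
  -- because truncated Poisson weights, and the unnormalised weights `μ`, have to qualify too.
  record IsPositiveFunctional (L : (ℕ → Carrier) → Carrier) : Set (c ⊔ ℓ₁ ⊔ ℓ₂) where
    field
      mono  : ∀ {f g} → (∀ k → f k ≤ g k) → L f ≤ L g
      +-hom : ∀ f g → L (λ k → f k + g k) ≈ L f + L g
      *-hom : ∀ x f → L (λ k → x * f k) ≈ x * L f

    L-cong : ∀ {f g} → (∀ k → f k ≈ g k) → L f ≈ L g
    L-cong f≈g = ≤-antisym (mono λ k → ≤-reflexive (f≈g k)) (mono λ k → ≤-reflexive (≈-sym (f≈g k)))

    L-near : ∀ {b f g} → (∀ k → Near (b k) (f k) (g k)) → Near (L b) (L f) (L g)
    L-near f≈g = ≤-trans (mono (proj₁ ∘ f≈g)) (≤-reflexive (+-hom _ _)) , ≤-trans (mono (proj₂ ∘ f≈g)) (≤-reflexive (+-hom _ _))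

    L-partialSum : ∀ (u : ℕ → ℕ → Carrier) n → L (λ k → partialSum (λ r → u r k) n) ≈ partialSum (λ r → L (u r)) n
    L-partialSum u zero    = ≈-trans (L-cong (λ _ → ≈-sym (zeroˡ 0#))) (≈-trans (*-hom 0# (λ _ → 0#)) (zeroˡ _))
    L-partialSum u (suc n) = ≈-trans (+-hom _ _) (+-congʳ (L-partialSum u n))

    -- The remainder is a multiple of a binomial coefficient, so its expectation is again a binomial
    -- moment.
    L-newton : ∀ n {B} f → (∀ k → Near B (f k) 0#) →
               Near (2^ n * B * L (binom n)) (L f) (partialSum (λ r → L (binom r) * Δ^ r f 0) n)
    L-newton n {B} f f≤B = near-resp ≈-refl
      (≈-trans (L-partialSum (λ r k → binom r k * Δ^ r f 0) n)
        (partialSum-cong (λ r → ≈-trans (L-cong λ k → *-comm _ _) (≈-trans (*-hom _ _) (*-comm _ _))) n))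
      (near-weaken (≤-reflexive (*-hom _ _)) (L-near (newton-remainder n f f≤B)))

  open IsPositiveFunctional

  HasMoments : (ℕ → (ℕ → Carrier) → Carrier) → (ℕ → Carrier) → Set (c ⊔ ℓ₂)
  HasMoments L μ = ∀ r → (λ n → L n (binom r)) ⇝ μ r

  newtonSum : (ℕ → Carrier) → (ℕ → Carrier) → ℕ → Carrier
  newtonSum μ f = partialSum (λ r → μ r * Δ^ r f 0)

  module _ {L : ℕ → (ℕ → Carrier) → Carrier} {μ : ℕ → Carrier} (L⁺ : ∀ (n : ℕ) → IsPositiveFunctional (L n)) (moments : HasMoments L μ)
           {f : ℕ → Carrier} {B : Carrier} (f≤B : ∀ (k : ℕ) → Near B (f k) 0#) where

    near-newtonSum : ∀ r ε → 0# < ε → ∃[ K ] (∀ n → K ℕ.≤ n → Near (2^ r * B * μ r + ε) (L n f) (newtonSum μ f r))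
    near-newtonSum r ε 0<ε =
      let J , g = ⇝-*ˡ (2^ r * B) (moments r) (ε * ½) (half-pos 0<ε)
          K , h = ⇝-partialSum r (λ s → ⇝-* (moments s) (⇝-const {Δ^ s f 0})) (ε * ½) (half-pos 0<ε)
      in J ℕ.⊔ K , λ n J⊔K≤n →
        near-weaken (≤-reflexive (≈-trans (+-assoc _ _ _) (+-congˡ (halves ε))))
          (near-trans (near-weaken (proj₁ (g n (ℕ.m⊔n≤o⇒m≤o J K J⊔K≤n))) (L-newton (L⁺ n) r f f≤B))
            (h n (ℕ.m⊔n≤o⇒n≤o J K J⊔K≤n)))

    -- The limit removes the slack `ε` of `near-newtonSum`; the resulting explicit radius gives the
    -- rate of convergence of the series for exp(-½).
    limit-near-newtonSum : ∀ {s} → (λ n → L n f) ⇝ s → ∀ r → Near (2^ r * B * μ r) s (newtonSum μ f r)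
    limit-near-newtonSum Lf⇝s r =
      ⇝-lowerBound 0 (λ n _ → proj₁ (L-newton (L⁺ n) r f f≤B)) Lf⇝s (⇝-+ sums radii) ,
      ⇝-lowerBound 0 (λ n _ → proj₂ (L-newton (L⁺ n) r f f≤B)) sums (⇝-+ Lf⇝s radii)
      where
      sums  = ⇝-partialSum r (λ s → ⇝-* (moments s) (⇝-const {Δ^ s f 0}))
      radii = ⇝-*ˡ (2^ r * B) (moments r)

  module _ {L L′ : ℕ → (ℕ → Carrier) → Carrier} {μ : ℕ → Carrier} (L⁺ : ∀ (n : ℕ) → IsPositiveFunctional (L n)) (L′⁺ : ∀ (n : ℕ) → IsPositiveFunctional (L′ n))
           (moments : HasMoments L μ) (moments′ : HasMoments L′ μ)
           (vanish : ∀ (B ε : Carrier) → 0# < ε → ∃[ r ] (2^ r * B * μ r ≤ ε))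
           {f : ℕ → Carrier} {B : Carrier} (f≤B : ∀ (k : ℕ) → Near B (f k) 0#) where

    -- The order `r` is fixed first to make the remainder small; then both expectations approach the
    -- same number `newtonSum μ f r`. The indices `m` and `n` are independent, so that the case of
    -- two equal sequences is the Cauchy property.
    equalMoments⇒near : ∀ ε → 0# < ε → ∃[ K ] (∀ m n → K ℕ.≤ m → K ℕ.≤ n → Near ε (L m f) (L′ n f))
    equalMoments⇒near ε 0<ε =
      let r , small-r = vanish B (ε * ½ * ½) (half-pos (half-pos 0<ε))
          J , g = near-newtonSum L⁺ moments f≤B r (ε * ½ * ½) (half-pos (half-pos 0<ε))
          K , h = near-newtonSum L′⁺ moments′ f≤B r (ε * ½ * ½) (half-pos (half-pos 0<ε))
          η≤ : 2^ r * B * μ r + ε * ½ * ½ ≤ ε * ½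
          η≤ = ≤-trans (+-monoˡ-≤ _ small-r) (≤-reflexive (halves (ε * ½)))
      in J ℕ.⊔ K , λ m n J⊔K≤m J⊔K≤n →
        near-weaken (≤-reflexive (halves ε))
          (near-trans (near-weaken η≤ (g m (ℕ.m⊔n≤o⇒m≤o J K J⊔K≤m)))
                      (near-sym (near-weaken η≤ (h n (ℕ.m⊔n≤o⇒n≤o J K J⊔K≤n)))))

  cauchy⇒⇝ : ∀ u → (∀ ε → 0# < ε → ∃[ K ] (∀ m n → K ℕ.≤ m → K ℕ.≤ n → Near ε (u m) (u n))) → ∃[ l ] (u ⇝ l)
  cauchy⇒⇝ u cauchy =
    let l , u⟶l = complete u λ ε 0<ε →
          let K , h = cauchy (ε * ½) (half-pos 0<ε)
          in K , λ m n K≤m K≤n → near⇒within (half-< 0<ε) (h m n K≤m K≤n)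
    in l , ⟶⇒⇝ u⟶l

  module _ {L L′ : ℕ → (ℕ → Carrier) → Carrier} {μ : ℕ → Carrier} (L⁺ : ∀ (n : ℕ) → IsPositiveFunctional (L n)) (L′⁺ : ∀ (n : ℕ) → IsPositiveFunctional (L′ n))
           (moments : HasMoments L μ) (moments′ : HasMoments L′ μ)
           (vanish : ∀ (B ε : Carrier) → 0# < ε → ∃[ r ] (2^ r * B * μ r ≤ ε))
           {f : ℕ → Carrier} {B : Carrier} (f≤B : ∀ (k : ℕ) → Near B (f k) 0#) where

    equalMoments⇒equalLimits : ∃[ s ] ((λ n → L′ n f) ⇝ s × (λ n → L n f) ⇝ s)
    equalMoments⇒equalLimits =
      let s , L′f⇝s = cauchy⇒⇝ (λ n → L′ n f) (equalMoments⇒near L′⁺ L′⁺ moments′ moments′ vanish f≤B)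
      in s , L′f⇝s , λ ε 0<ε →
        let J , g = equalMoments⇒near L⁺ L′⁺ moments moments′ vanish f≤B (ε * ½) (half-pos 0<ε)
            K , h = L′f⇝s (ε * ½) (half-pos 0<ε)
        in J ℕ.⊔ K , λ n J⊔K≤n → near-weaken (≤-reflexive (halves ε))
          (near-trans (g n n (ℕ.m⊔n≤o⇒m≤o J K J⊔K≤n) (ℕ.m⊔n≤o⇒m≤o J K J⊔K≤n)) (h n (ℕ.m⊔n≤o⇒n≤o J K J⊔K≤n)))

-- The Poisson law with parameter ½

module Poisson {c ℓ₁ ℓ₂} (R : RealField c ℓ₁ ℓ₂) where
  open RealField R
  open RealFieldProperties R
  open IntegerCoefficients commutativeRing
  open OrderedFieldProperties R
  open Limits R
  open Moments R
  open ≤-Reasoning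
  open Algebra.Properties.Ring (CommutativeRing.ring commutativeRing) using (-1*x≈-x)

  -- Truncation at `n` gives a finite sum for every `f`, and the convergence of these sums as `n`
  -- grows is what `HasSum` asks for.
  weighted : (ℕ → Carrier) → ℕ → (ℕ → Carrier) → Carrier
  weighted w n f = partialSum (λ k → f k * w k) n

  weighted⁺ : ∀ {w} → (∀ k → 0# ≤ w k) → ∀ n → IsPositiveFunctional (weighted w n)
  weighted⁺ {w} 0≤w n = record
    { mono  = λ f≤g → partialSum-mono (λ k → *-monoˡ-≤ (0≤w k) (f≤g k)) n
    ; +-hom = λ f g → ≈-trans (partialSum-cong (λ k → distribʳ (w k) (f k) (g k)) n) (partialSum-+ _ _ n)
    ; *-hom = λ x f → ≈-trans (partialSum-cong (λ k → *-assoc x (f k) (w k)) n) (partialSum-*ˡ x _ n)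
    }

  inv!-inverseʳ : ∀ k → fromℕ (k !) * inv! k ≈ 1#
  inv!-inverseʳ k = inv-inverseʳ (fromℕ-pos (k !) {{k ℕ.!≢0}})

  0<inv! : ∀ k → 0# < inv! k
  0<inv! k = inv-pos (fromℕ-pos (k !) {{k ℕ.!≢0}})

  0<k! : ∀ k → 0# < fromℕ (k !)
  0<k! k = fromℕ-pos (k !) {{k ℕ.!≢0}}

  -- Plays two roles: the Poisson weights up to normalisation, and the binomial moments of the
  -- Poisson law.
  μ : ℕ → Carrier
  μ k = ½ ^ k * inv! k

  0<μ : ∀ k → 0# < μ k
  0<μ k = *-pos (^-pos 0<½ k) (0<inv! k)

  nonneg-μ : ∀ k → 0# ≤ μ k
  nonneg-μ k = <⇒≤ (0<μ k)

  2^*½^ : ∀ n → 2^ n * ½ ^ n ≈ 1#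
  2^*½^ zero    = *-identityˡ 1#
  2^*½^ (suc n) = begin-equality
    (1# + 1#) * 2^ n * (½ * ½ ^ n)   ≈⟨ solve 3 (λ p q h → con (+ 2) :* p :* (h :* q) := (h :+ h) :* (p :* q)) ≈-refl (2^ n) (½ ^ n) ½ ⟩
    (½ + ½) * (2^ n * ½ ^ n)         ≈⟨ *-cong ½+½≈1 (2^*½^ n) ⟩
    1# * 1#                          ≈⟨ *-identityˡ 1# ⟩
    1#                               ∎

  2^*μ : ∀ n → 2^ n * μ n ≈ inv! n
  2^*μ n = ≈-trans (≈-sym (*-assoc _ _ _)) (≈-trans (*-congʳ (2^*½^ n)) (*-identityˡ _))

  n≤n! : ∀ n → n ℕ.≤ n !
  n≤n! zero    = ℕ.z≤n
  n≤n! (suc n) = ℕ.≤-trans (ℕ.≤-reflexive (≡.sym (ℕ.*-identityʳ (suc n)))) (ℕ.*-monoʳ-≤ (suc n) (ℕ.1≤n! n))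

  inv!-vanishes : ∀ B ε → 0# < ε → ∃[ K ] (∀ n → K ℕ.≤ n → B * inv! n ≤ ε)
  inv!-vanishes B ε 0<ε =
    let K , B<εK = dominated B 0<ε in K , λ n K≤n → begin
      B * inv! n                      ≤⟨ *-monoˡ-≤ (<⇒≤ (0<inv! n)) (<⇒≤ B<εK) ⟩
      ε * fromℕ K * inv! n            ≤⟨ *-monoˡ-≤ (<⇒≤ (0<inv! n)) (*-monoʳ-≤ (<⇒≤ 0<ε) (fromℕ-mono-≤ (ℕ.≤-trans K≤n (n≤n! n)))) ⟩
      ε * fromℕ (n !) * inv! n        ≈⟨ *-assoc _ _ _ ⟩
      ε * (fromℕ (n !) * inv! n)      ≈⟨ *-congˡ (inv!-inverseʳ n) ⟩
      ε * 1#                          ≈⟨ *-identityʳ ε ⟩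
      ε                               ∎

  μ-vanishes : ∀ B ε → 0# < ε → ∃[ r ] (2^ r * B * μ r ≤ ε)
  μ-vanishes B ε 0<ε =
    let K , h = inv!-vanishes B ε 0<ε in
    K , ≤-trans (≤-reflexive (≈-trans (solve 3 (λ p b m → p :* b :* m := b :* (p :* m)) ≈-refl (2^ K) B (μ K)) (*-congˡ (2^*μ K)))) (h K ℕ.≤-refl)

  ½^+ : ∀ m n → ½ ^ (m ℕ.+ n) ≈ ½ ^ m * ½ ^ n
  ½^+ zero    n = ≈-sym (*-identityˡ _)
  ½^+ (suc m) n = ≈-trans (*-congˡ (½^+ m n)) (≈-sym (*-assoc _ _ _))

  C*!*! : ∀ r j → ((r ℕ.+ j) C r) ℕ.* (r ! ℕ.* j !) ≡ (r ℕ.+ j) !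
  C*!*! r j = ≡.trans (≡.cong (λ i → ((r ℕ.+ j) C r) ℕ.* (r ! ℕ.* i !)) (≡.sym (ℕ.m+n∸m≡n r j)))
    (≡.trans (≡.cong (ℕ._* (r ! ℕ.* (r ℕ.+ j ℕ.∸ r) !)) (nCk≡n!/k![n-k]! r≤r+j)) (m/n*n≡m (k![n∸k]!∣n! r≤r+j)))
    where
    r≤r+j = ℕ.m≤m+n r j
    instance _ = r ℕ.!* (r ℕ.+ j ℕ.∸ r) !≢0

  -- This identity is the reason for the double role of `μ`: weighting by a binomial coefficient
  -- shifts the weights by `r` and takes out the factor `μ r`. All factorials are multiplied
  -- through, and only then cancelled.
  binom-μ : ∀ r j → binom r (r ℕ.+ j) * μ (r ℕ.+ j) ≈ μ r * μ j
  binom-μ r j = *-cancelˡ-≈ (0<k! (r ℕ.+ j)) (*-cancelˡ-≈ (*-pos (0<k! r) (0<k! j)) (begin-equality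
      a * b * (n * (b₁ * (½ ^ (r ℕ.+ j) * inv! (r ℕ.+ j))))  ≈⟨ *-congˡ (*-congˡ (*-congˡ (*-congʳ (½^+ r j)))) ⟩
      a * b * (n * (b₁ * (½ ^ r * ½ ^ j * inv! (r ℕ.+ j))))  ≈⟨ solve 7 (λ a b n C p q i → a :* b :* (n :* (C :* (p :* q :* i))) := C :* (a :* b) :* (n :* i) :* (p :* q)) ≈-refl a b n b₁ (½ ^ r) (½ ^ j) (inv! (r ℕ.+ j)) ⟩
      b₁ * (a * b) * (n * inv! (r ℕ.+ j)) * (½ ^ r * ½ ^ j)  ≈⟨ *-congʳ (*-cong C*a*b≈n (inv!-inverseʳ (r ℕ.+ j))) ⟩
      n * 1# * (½ ^ r * ½ ^ j)                              ≈⟨ *-congʳ (*-congˡ (≈-sym (≈-trans (*-cong (inv!-inverseʳ r) (inv!-inverseʳ j)) (*-identityˡ 1#)))) ⟩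
      n * (a * inv! r * (b * inv! j)) * (½ ^ r * ½ ^ j)     ≈⟨ solve 7 (λ a b n i j p q → n :* (a :* i :* (b :* j)) :* (p :* q) := a :* b :* (n :* ((p :* i) :* (q :* j)))) ≈-refl a b n (inv! r) (inv! j) (½ ^ r) (½ ^ j) ⟩
      a * b * (n * (μ r * μ j))                             ∎))
    where
    a = fromℕ (r !)
    b = fromℕ (j !)
    n = fromℕ ((r ℕ.+ j) !)
    b₁ = binom r (r ℕ.+ j)
    C*a*b≈n : b₁ * (a * b) ≈ n
    C*a*b≈n = ≈-trans (*-congˡ (≈-sym (fromℕ-* (r !) (j !))))
      (≈-trans (≈-sym (fromℕ-* ((r ℕ.+ j) C r) (r ! ℕ.* j !))) (fromℕ-cong (C*!*! r j)))

  ½^n≤1 : ∀ n → ½ ^ n ≤ 1#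
  ½^n≤1 zero    = ≤-refl
  ½^n≤1 (suc n) = ≤-trans (*-mono-≤ (^-nonneg (<⇒≤ 0<½) n) (<⇒≤ 0<1) ½≤1 (½^n≤1 n)) (≤-reflexive (*-identityˡ 1#))
    where
    ½≤1 : ½ ≤ 1#
    ½≤1 = ≤-trans (x≤x+y (<⇒≤ 0<½)) (≤-reflexive ½+½≈1)

  ½^n*[n+1]≤1 : ∀ n → ½ ^ n * fromℕ (suc n) ≤ 1#
  ½^n*[n+1]≤1 zero    = ≤-reflexive (≈-trans (*-identityˡ _) (+-identityʳ 1#))
  ½^n*[n+1]≤1 (suc n) = begin
    ½ * ½ ^ n * (1# + fromℕ (suc n))            ≈⟨ solve 3 (λ h p n → h :* p :* (con (+ 1) :+ n) := h :* p :+ h :* (p :* n)) ≈-refl ½ (½ ^ n) (fromℕ (suc n)) ⟩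
    ½ * ½ ^ n + ½ * (½ ^ n * fromℕ (suc n))     ≤⟨ +-mono-≤ (*-monoʳ-≤ (<⇒≤ 0<½) (½^n≤1 n)) (*-monoʳ-≤ (<⇒≤ 0<½) (½^n*[n+1]≤1 n)) ⟩
    ½ * 1# + ½ * 1#                             ≈⟨ +-cong (*-identityʳ ½) (*-identityʳ ½) ⟩
    ½ + ½                                       ≈⟨ ½+½≈1 ⟩
    1#                                          ∎

  ½^-vanishes : ∀ ε → 0# < ε → ∃[ K ] (½ ^ K + ½ ^ K ≤ ε)
  ½^-vanishes ε 0<ε =
    let K , 2<εK = dominated (1# + 1#) 0<ε
        0<K+1 = fromℕ-pos (suc K)
    in K , *-cancelˡ-≤ 0<K+1 (begin
      fromℕ (suc K) * (½ ^ K + ½ ^ K)    ≈⟨ solve 2 (λ n h → n :* (h :+ h) := h :* n :+ h :* n) ≈-refl (fromℕ (suc K)) (½ ^ K) ⟩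
      ½ ^ K * fromℕ (suc K) + ½ ^ K * fromℕ (suc K)   ≤⟨ +-mono-≤ (½^n*[n+1]≤1 K) (½^n*[n+1]≤1 K) ⟩
      1# + 1#                            ≤⟨ <⇒≤ 2<εK ⟩
      ε * fromℕ K                        ≤⟨ *-monoʳ-≤ (<⇒≤ 0<ε) (fromℕ-mono-≤ (ℕ.n≤1+n K)) ⟩
      ε * fromℕ (suc K)                  ≈⟨ *-comm _ _ ⟩
      fromℕ (suc K) * ε                  ∎)

  inv!≤1 : ∀ k → inv! k ≤ 1#
  inv!≤1 k = *-cancelˡ-≤ (0<k! k) (begin
    fromℕ (k !) * inv! k   ≈⟨ inv!-inverseʳ k ⟩
    1#                     ≈⟨ +-identityʳ 1# ⟨
    fromℕ 1                ≤⟨ fromℕ-mono-≤ (ℕ.1≤n! k) ⟩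
    fromℕ (k !)            ≈⟨ *-identityʳ _ ⟨
    fromℕ (k !) * 1#       ∎)

  Σμ : ℕ → Carrier
  Σμ = partialSum μ

  -- Twice ½ⁿ is the tail of the geometric series from index n on; it dominates the tail of `Σμ`
  -- because 1 / k! ≤ 1.
  Σμ-upper : ∀ m n → Σμ (m ℕ.+ n) + (½ ^ (m ℕ.+ n) + ½ ^ (m ℕ.+ n)) ≤ Σμ m + (½ ^ m + ½ ^ m)
  Σμ-upper m zero    rewrite ℕ.+-identityʳ m = ≤-refl
  Σμ-upper m (suc n) rewrite ℕ.+-suc m n = ≤-trans step (Σμ-upper m n)
    where
    k = m ℕ.+ n
    step : Σμ k + μ k + (½ * ½ ^ k + ½ * ½ ^ k) ≤ Σμ k + (½ ^ k + ½ ^ k)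
    step = begin
      Σμ k + μ k + (½ * ½ ^ k + ½ * ½ ^ k)      ≤⟨ +-monoˡ-≤ _ (+-monoʳ-≤ _ (*-monoʳ-≤ (^-nonneg (<⇒≤ 0<½) k) (inv!≤1 k))) ⟩
      Σμ k + ½ ^ k * 1# + (½ * ½ ^ k + ½ * ½ ^ k) ≈⟨ solve 3 (λ s p h → s :+ p :* con (+ 1) :+ (h :* p :+ h :* p) := s :+ (p :+ (h :+ h) :* p)) ≈-refl (Σμ k) (½ ^ k) ½ ⟩
      Σμ k + (½ ^ k + (½ + ½) * ½ ^ k)          ≈⟨ +-congˡ (+-congˡ (≈-trans (*-congʳ ½+½≈1) (*-identityˡ _))) ⟩
      Σμ k + (½ ^ k + ½ ^ k)                    ∎

  Σμ-mono : ∀ m n → Σμ m ≤ Σμ (m ℕ.+ n)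
  Σμ-mono m zero    rewrite ℕ.+-identityʳ m = ≤-refl
  Σμ-mono m (suc n) rewrite ℕ.+-suc m n = ≤-trans (Σμ-mono m n) (x≤x+y (nonneg-μ (m ℕ.+ n)))

  Σμ-near : ∀ m n → m ℕ.≤ n → Near (½ ^ m + ½ ^ m) (Σμ n) (Σμ m)
  Σμ-near m n m≤n = ≡.subst (λ k → Near (½ ^ m + ½ ^ m) (Σμ k) (Σμ m)) (ℕ.m+[n∸m]≡n m≤n)
    (≤-trans (x≤x+y (+-nonneg ½^k ½^k)) (Σμ-upper m (n ℕ.∸ m)) ,
     ≤-trans (Σμ-mono m (n ℕ.∸ m)) (x≤x+y (+-nonneg ½^m ½^m)))
    where
    ½^k = ^-nonneg (<⇒≤ 0<½) (m ℕ.+ (n ℕ.∸ m))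
    ½^m = ^-nonneg (<⇒≤ 0<½) m

  Σμ-converges : ∃[ E ] (Σμ ⇝ E)
  Σμ-converges = cauchy⇒⇝ Σμ λ ε 0<ε →
    let K , h = ½^-vanishes (ε * ½) (half-pos 0<ε)
    in K , λ m n K≤m K≤n → near-weaken (≤-reflexive (halves ε))
      (near-trans (near-weaken h (Σμ-near K m K≤m)) (near-sym (near-weaken h (Σμ-near K n K≤n))))

  exp½ : Carrier
  exp½ = proj₁ Σμ-converges

  Σμ⇝exp½ : Σμ ⇝ exp½
  Σμ⇝exp½ = proj₂ Σμ-converges

  Σμ₁≈1 : Σμ 1 ≈ 1#
  Σμ₁≈1 = ≈-trans (+-identityˡ _) (≈-trans (*-identityˡ _) (≈-trans (≈-sym (*-identityˡ _))
    (≈-trans (*-congʳ (≈-sym (+-identityʳ 1#))) (inv!-inverseʳ 0))))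

  0<exp½ : 0# < exp½
  0<exp½ = <-≤-trans 0<1 (⇝-lowerBound 1 (λ { (suc n) _ → ≤-trans (≤-reflexive (≈-sym Σμ₁≈1)) (Σμ-mono 1 n) }) ⇝-const Σμ⇝exp½)

  -- The terms below index `r` vanish and `binom-μ` shifts the others. The factor `x` allows both
  -- uses: the weights `μ` themselves, with total mass `exp½`, and the normalised ones, with total
  -- mass 1.
  weighted-moments : ∀ {w E} x → (∀ k → w k ≈ x * μ k) → x * exp½ ≈ E → HasMoments (weighted w) (λ r → μ r * E)
  weighted-moments {w} {E} x w≈xμ xe≈E r = ⇝-shift r
    (⇝-cong (λ n → ≈-sym (moment n))
      (≈-trans (*-congˡ (*-comm _ _)) (≈-trans (solve 3 (λ x m e → x :* (e :* m) := m :* (x :* e)) ≈-refl x (μ r) exp½) (*-congˡ xe≈E)))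
      (⇝-*ˡ x (⇝-*ˡ (μ r) Σμ⇝exp½)))
    where
    moment : ∀ n → weighted w (r ℕ.+ n) (binom r) ≈ x * (μ r * Σμ n)
    moment n = begin-equality
      weighted w (r ℕ.+ n) (binom r)
        ≈⟨ partialSum-split _ r n ⟩
      partialSum (λ k → binom r k * w k) r + partialSum (λ k → binom r (r ℕ.+ k) * w (r ℕ.+ k)) n
        ≈⟨ +-cong (partialSum-zero r λ k k<r → ≈-trans (*-congʳ (fromℕ-cong (k>n⇒nCk≡0 k<r))) (zeroˡ _))
             (partialSum-cong (λ k → ≈-trans (*-congˡ (w≈xμ (r ℕ.+ k))) (≈-trans
                (solve 3 (λ b x m → b :* (x :* m) := x :* (b :* m)) ≈-refl (binom r (r ℕ.+ k)) x (μ (r ℕ.+ k)))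
                (*-congˡ (binom-μ r k)))) n) ⟩
      0# + partialSum (λ k → x * (μ r * μ k)) n
        ≈⟨ +-identityˡ _ ⟩
      partialSum (λ k → x * (μ r * μ k)) n
        ≈⟨ partialSum-*ˡ x (λ k → μ r * μ k) n ⟩
      x * partialSum (λ k → μ r * μ k) n
        ≈⟨ *-congˡ (partialSum-*ˡ (μ r) μ n) ⟩
      x * (μ r * Σμ n) ∎

  -- A reciprocal by definition; `isExp-½` identifies it with the sum of the exponential series at
  -- -½.
  exp-½ : Carrier
  exp-½ = inv 0<exp½

  -- Newton's formula for the indicator of 0, whose iterated differences
  -- at 0 are (-1)ʳ, yields exp ½ * exp (- ½) = 1.
  δ₀ : ℕ → Carrier
  δ₀ zero    = 1#
  δ₀ (suc k) = 0#

  Δδ₀ : ∀ k → Δ δ₀ k ≈ - δ₀ k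
  Δδ₀ zero    = +-identityˡ _
  Δδ₀ (suc k) = +-identityˡ _

  Δ^-scale : ∀ r x f g → (∀ k → f k ≈ x * g k) → ∀ k → Δ^ r f k ≈ x * Δ^ r g k
  Δ^-scale zero    x f g f≈xg = f≈xg
  Δ^-scale (suc r) x f g f≈xg = Δ^-scale r x (Δ f) (Δ g) λ k →
    ≈-trans (+-cong (f≈xg (suc k)) (-‿cong (f≈xg k))) (solve 3 (λ x a b → x :* a :- x :* b := x :* (a :- b)) ≈-refl x (g (suc k)) (g k))

  Δ^δ₀ : ∀ r → Δ^ r δ₀ 0 ≈ (- 1#) ^ r
  Δ^δ₀ zero    = ≈-refl
  Δ^δ₀ (suc r) = ≈-trans (Δ^-scale r (- 1#) (Δ δ₀) δ₀ (λ k → ≈-trans (Δδ₀ k) (≈-sym (-1*x≈-x _))) 0) (*-congˡ (Δ^δ₀ r))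

  δ₀≤1 : ∀ k → Near 1# (δ₀ k) 0#
  δ₀≤1 zero    = ≤-reflexive (≈-sym (+-identityˡ 1#)) , +-nonneg (<⇒≤ 0<1) (<⇒≤ 0<1)
  δ₀≤1 (suc k) = near-refl (<⇒≤ 0<1)

  weighted-δ₀ : ∀ n → weighted μ (suc n) δ₀ ≈ 1#
  weighted-δ₀ n = begin-equality
    weighted μ (suc n) δ₀                                ≈⟨ partialSum-head (λ k → δ₀ k * μ k) n ⟩
    1# * μ 0 + partialSum (λ k → 0# * μ (suc k)) n       ≈⟨ +-cong (*-identityˡ _) (partialSum-zero n λ k _ → zeroˡ _) ⟩
    μ 0 + 0#                                             ≈⟨ +-comm _ _ ⟩
    Σμ 1                                                 ≈⟨ Σμ₁≈1 ⟩
    1#                                                   ∎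

  [-½]^ : ∀ r → (- 1#) ^ r * ½ ^ r ≈ (- ½) ^ r
  [-½]^ zero    = *-identityˡ 1#
  [-½]^ (suc r) = ≈-trans (solve 3 (λ h m p → :- con (+ 1) :* m :* (h :* p) := :- h :* (m :* p)) ≈-refl ½ ((- 1#) ^ r) (½ ^ r))
    (*-congˡ ([-½]^ r))

  -- Under the weights `μ` the expectation of `δ₀` is `μ 0`, that is 1, while its Newton sum is
  -- `exp½` times a partial sum of the series at -½. Multiplication by `exp-½` removes `exp½` from
  -- the Newton sum and from the radius, of which 1 / r! remains.
  near-exp-½ : ∀ r → Near (inv! r) (partialSum (λ k → (- ½) ^ k * inv! k) r) exp-½
  near-exp-½ r = near-sym (near-resp (*-identityʳ exp-½) sum
    (near-weaken (≤-reflexive radius)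
      (near-*ˡ (<⇒≤ (inv-pos 0<exp½)) (limit-near-newtonSum (weighted⁺ nonneg-μ)
        (weighted-moments 1# (λ k → ≈-sym (*-identityˡ _)) (*-identityˡ _)) δ₀≤1 δ₀⇝1 r))))
    where
    δ₀⇝1 : (λ n → weighted μ n δ₀) ⇝ 1#
    δ₀⇝1 = ⇝-shift 1 (⇝-cong (λ n → ≈-sym (weighted-δ₀ n)) ≈-refl ⇝-const)

    radius : exp-½ * (2^ r * 1# * (μ r * exp½)) ≈ inv! r
    radius = begin-equality
      exp-½ * (2^ r * 1# * (μ r * exp½))   ≈⟨ solve 4 (λ e p m E → e :* (p :* con (+ 1) :* (m :* E)) := (E :* e) :* (p :* m)) ≈-refl exp-½ (2^ r) (μ r) exp½ ⟩
      (exp½ * exp-½) * (2^ r * μ r)        ≈⟨ *-cong (inv-inverseʳ 0<exp½) (2^*μ r) ⟩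
      1# * inv! r                          ≈⟨ *-identityˡ _ ⟩
      inv! r                               ∎

    sum : exp-½ * newtonSum (λ k → μ k * exp½) δ₀ r ≈ partialSum (λ k → (- ½) ^ k * inv! k) r
    sum = ≈-trans (≈-sym (partialSum-*ˡ exp-½ _ r)) (partialSum-cong (λ k → begin-equality
      exp-½ * (½ ^ k * inv! k * exp½ * Δ^ k δ₀ 0)   ≈⟨ *-congˡ (*-congˡ (Δ^δ₀ k)) ⟩
      exp-½ * (½ ^ k * inv! k * exp½ * (- 1#) ^ k)  ≈⟨ solve 5 (λ e p i E m → e :* (p :* i :* E :* m) := (E :* e) :* (m :* p :* i)) ≈-refl exp-½ (½ ^ k) (inv! k) exp½ ((- 1#) ^ k) ⟩
      (exp½ * exp-½) * ((- 1#) ^ k * ½ ^ k * inv! k) ≈⟨ *-cong (inv-inverseʳ 0<exp½) (*-congʳ ([-½]^ k)) ⟩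
      1# * ((- ½) ^ k * inv! k)                     ≈⟨ *-identityˡ _ ⟩
      (- ½) ^ k * inv! k                            ∎) r)

  isExp-½ : IsExp (- ½) exp-½
  isExp-½ = ⇝⇒⟶ λ ε 0<ε →
    let K , h = inv!-vanishes 1# ε 0<ε
    in K , λ n K≤n → near-weaken (≤-trans (≤-reflexive (≈-sym (*-identityˡ _))) (h n K≤n)) (near-exp-½ n)

  poisson : ℕ → Carrier
  poisson k = exp-½ * ½ ^ k * inv! k

  isPoissonPMF : IsPoissonPMF ½ poisson
  isPoissonPMF = exp-½ , isExp-½ , λ k → ≈-refl

  poisson-nonneg : ∀ k → 0# ≤ poisson k
  poisson-nonneg k = <⇒≤ (*-pos (*-pos (inv-pos 0<exp½) (^-pos 0<½ k)) (0<inv! k))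

  poisson-moments : HasMoments (weighted poisson) μ
  poisson-moments r = ⇝-cong (λ _ → ≈-refl) (*-identityʳ _)
    (weighted-moments exp-½ (λ k → *-assoc _ _ _) (≈-trans (*-comm _ _) (inv-inverseʳ 0<exp½)) r)

  bounded⇒near : ∀ {f} → Bounded f → ∃[ B ] (∀ k → Near B (f k) 0#)
  bounded⇒near {f} (B , -B<f<B) = B , λ k →
    let -B<f , f<B = -B<f<B k in
    ≤-trans (<⇒≤ f<B) (≤-reflexive (≈-sym (+-identityˡ B))) ,
    ≤-by (x≤y⇒0≤y-x (<⇒≤ -B<f)) (solve 2 (λ f b → (f :+ b) :- con (+ 0) := f :- (:- b)) ≈-refl (f k) B)

  momentsConverge⇒poissonLimit : ∀ {L : ℕ → (ℕ → Carrier) → Carrier} → (∀ n → IsPositiveFunctional (L n)) → HasMoments L μ →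
    ∀ f → Bounded f → ∃[ s ] (HasSum (λ k → f k * poisson k) s × ((λ n → L n f) ⟶ s))
  momentsConverge⇒poissonLimit L⁺ moments f bounded =
    let B , f≤B = bounded⇒near bounded
        s , poisson⇝s , L⇝s = equalMoments⇒equalLimits L⁺ (weighted⁺ poisson-nonneg) moments poisson-moments μ-vanishes f≤B
    in s , ⇝⇒⟶ poisson⇝s , ⇝⇒⟶ L⇝s

-- Adding a top row to a tableau

notα : Cell → Bool
notα (just letterα) = false
notα _              = true

-- T has n columns; the last cell of r is the only cell of column n + 1 of r ∷ T.
newFree : ∀ {n} → Vec Bool n → Vec Cell (suc n) → Vec Bool (suc n)
newFree []      (x ∷ _) = notα x ∷ []
newFree (u ∷ v) (x ∷ r) = (u ∧ notα x) ∷ newFree v r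

-- All that a new top row has to know about `T`: an α closes its column upwards, whereas a β
-- restricts only its own row.
free : ∀ {n} → Filling n → Vec Bool n
free []      = []
free (r ∷ T) = newFree (free T) r

-- No β may occur to the right of a symbol: fits₀ is fits for rows without β.
fits₀ : ∀ {n} → Vec Bool n → Vec Cell (suc n) → Bool
fits₀ []      (just letterα ∷ _) = true
fits₀ []      (_            ∷ _) = false
fits₀ (u ∷ v) (nothing      ∷ r) = fits₀ v r
fits₀ (u ∷ v) (just letterα ∷ r) = u ∧ fits₀ v r
fits₀ (u ∷ v) (just letterβ ∷ r) = false

fits : ∀ {n} → Vec Bool n → Vec Cell (suc n) → Bool
fits []      (nothing ∷ _) = false
fits []      (just _  ∷ _) = true
fits (u ∷ v) (nothing ∷ r) = fits v r
fits (u ∷ v) (just _  ∷ r) = u ∧ fits₀ v r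

-- The cell by cell counterpart of the Boolean scan `fits`, in the shape of the fields of
-- `IsStaircaseTableau`.
record Compatible {n} (v : Vec Bool n) (r : Vec Cell (suc n)) : Set where
  field
    covered : ∀ i → lookup v i ≡ false → lookup r (inject₁ i) ≡ nothing
    leftOfβ : ∀ i j → lookup r j ≡ just letterβ → toℕ i ℕ.< toℕ j → lookup r i ≡ nothing
    corner  : lookup r (Fin.fromℕ n) ≢ nothing

open Compatible

∧-true : ∀ {b c} → b ∧ c ≡ true → b ≡ true × c ≡ true
∧-true {true} {true} ≡.refl = ≡.refl , ≡.refl

fits₀⇒noβ : ∀ {n} (v : Vec Bool n) r → fits₀ v r ≡ true → ∀ j → lookup r j ≢ just letterβ
fits₀⇒noβ []      (just letterα ∷ []) _ Fin.zero ()
fits₀⇒noβ (u ∷ v) (nothing ∷ r)      p (Fin.suc j) = fits₀⇒noβ v r p j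
fits₀⇒noβ (u ∷ v) (just letterα ∷ r) p Fin.zero ()
fits₀⇒noβ (u ∷ v) (just letterα ∷ r) p (Fin.suc j) = fits₀⇒noβ v r (proj₂ (∧-true {u} p)) j

fits₀⇒fits : ∀ {n} (v : Vec Bool n) r → fits₀ v r ≡ true → fits v r ≡ true
fits₀⇒fits []      (just letterα ∷ _) p = ≡.refl
fits₀⇒fits (u ∷ v) (nothing ∷ r)      p = fits₀⇒fits v r p
fits₀⇒fits (u ∷ v) (just letterα ∷ r) p = p

fits⇒fits₀ : ∀ {n} (v : Vec Bool n) r → fits v r ≡ true → (∀ j → lookup r j ≢ just letterβ) → fits₀ v r ≡ true
fits⇒fits₀ []      (just letterα ∷ _) p noβ = ≡.refl
fits⇒fits₀ []      (just letterβ ∷ _) p noβ = contradiction ≡.refl (noβ Fin.zero)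
fits⇒fits₀ (u ∷ v) (nothing ∷ r)      p noβ = fits⇒fits₀ v r p (noβ ∘ Fin.suc)
fits⇒fits₀ (u ∷ v) (just letterα ∷ r) p noβ = p
fits⇒fits₀ (u ∷ v) (just letterβ ∷ r) p noβ = contradiction ≡.refl (noβ Fin.zero)

fits⇒compatible : ∀ {n} (v : Vec Bool n) r → fits v r ≡ true → Compatible v r
fits⇒compatible [] (just s ∷ []) p = record
  { covered = λ ()
  ; leftOfβ = λ { Fin.zero Fin.zero _ () }
  ; corner  = λ ()
  }
fits⇒compatible (u ∷ v) (nothing ∷ r) p = record
  { covered = λ { Fin.zero _ → ≡.refl ; (Fin.suc i) → covered rest i }
  ; leftOfβ = λ { Fin.zero j _ _ → ≡.refl ; (Fin.suc i) (Fin.suc j) eq (s≤s i<j) → leftOfβ rest i j eq i<j }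
  ; corner  = corner rest
  }
  where rest = fits⇒compatible v r p
fits⇒compatible (u ∷ v) (just s ∷ r) p = record
  { covered = λ { Fin.zero u≡false → contradiction (≡.trans (≡.sym u≡false) (proj₁ (∧-true p))) λ () ; (Fin.suc i) → covered rest i }
  ; leftOfβ = λ { Fin.zero (Fin.suc j) eq _ → contradiction eq (fits₀⇒noβ v r fits₀-r j)
                ; (Fin.suc i) (Fin.suc j) eq (s≤s i<j) → leftOfβ rest i j eq i<j
                ; Fin.zero Fin.zero _ ()
                }
  ; corner  = corner rest
  }
  where
  fits₀-r = proj₂ (∧-true {u} p)
  rest    = fits⇒compatible v r (fits₀⇒fits v r fits₀-r)

compatible⇒fits : ∀ {n} (v : Vec Bool n) r → Compatible v r → fits v r ≡ true
compatible⇒fits []      (nothing ∷ []) c = contradiction ≡.refl (corner c)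
compatible⇒fits []      (just s ∷ [])  c = ≡.refl
compatible⇒fits (u ∷ v) (x ∷ r) c = cases x c
  where
  rest : ∀ {x} → Compatible (u ∷ v) (x ∷ r) → fits v r ≡ true
  rest c = compatible⇒fits v r record
    { covered = λ i → covered c (Fin.suc i)
    ; leftOfβ = λ i j eq i<j → leftOfβ c (Fin.suc i) (Fin.suc j) eq (s≤s i<j)
    ; corner  = corner c
    }

  cases : ∀ x → Compatible (u ∷ v) (x ∷ r) → fits (u ∷ v) (x ∷ r) ≡ true
  cases nothing  c = rest c
  cases (just s) c = cong₂ _∧_ u≡true (fits⇒fits₀ v r (rest c) λ j eq →
    contradiction (leftOfβ c Fin.zero (Fin.suc j) eq (s≤s z≤n)) λ ())
    where
    u≡true : u ≡ true
    u≡true = Bool.¬-not λ u≡false → contradiction (covered c Fin.zero u≡false) λ ()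

newFree-α : ∀ {n} (v : Vec Bool n) r j → lookup r j ≡ just letterα → lookup (newFree v r) j ≡ false
newFree-α []      (x ∷ []) Fin.zero    ≡.refl = ≡.refl
newFree-α (u ∷ v) (x ∷ r)  Fin.zero    ≡.refl = Bool.∧-zeroʳ u
newFree-α (u ∷ v) (x ∷ r)  (Fin.suc j) eq   = newFree-α v r j eq

newFree-covered : ∀ {n} (v : Vec Bool n) r i → lookup v i ≡ false → lookup (newFree v r) (inject₁ i) ≡ false
newFree-covered (u ∷ v) (x ∷ r) Fin.zero    ≡.refl = ≡.refl
newFree-covered (u ∷ v) (x ∷ r) (Fin.suc i) eq   = newFree-covered v r i eq

newFree-false : ∀ {n} (v : Vec Bool n) r j → lookup (newFree v r) j ≡ false →
                lookup r j ≡ just letterα ⊎ ∃[ i ] (j ≡ inject₁ i × lookup v i ≡ false)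
newFree-false []          (just letterα ∷ _) Fin.zero    _  = inj₁ ≡.refl
newFree-false (true ∷ v)  (just letterα ∷ _) Fin.zero    _  = inj₁ ≡.refl
newFree-false (false ∷ v) (x ∷ _)            Fin.zero    _  = inj₂ (Fin.zero , ≡.refl , ≡.refl)
newFree-false (u ∷ v)     (x ∷ r)            (Fin.suc j) eq with newFree-false v r j eq
... | inj₁ p             = inj₁ p
... | inj₂ (i , p , q)   = inj₂ (Fin.suc i , cong Fin.suc p , q)

-- Turns `col` into an index for `free`. Each row is one cell longer than the row below it, at its
-- right end, hence `inject₁`.
column : ∀ {n} → Box n → Fin n
column (top j)   = j
column (below b) = inject₁ (column b)

col≡column : ∀ {n} (b : Box n) → col b ≡ suc (toℕ (column b))
col≡column (top j)   = ≡.refl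
col≡column (below b) = ≡.trans (col≡column b) (cong suc (≡.sym (Fin.toℕ-inject₁ (column b))))

col⇒column : ∀ {n} (b c : Box n) → col b ≡ col c → column b ≡ column c
col⇒column b c eq = Fin.toℕ-injective (ℕ.suc-injective (≡.trans (≡.sym (col≡column b)) (≡.trans eq (col≡column c))))

column⇒col : ∀ {n} (b c : Box n) → column b ≡ column c → col b ≡ col c
column⇒col b c eq = ≡.trans (col≡column b) (≡.trans (cong (suc ∘ toℕ) eq) (≡.sym (col≡column c)))

row-pos : ∀ {n} (b : Box n) → 0 ℕ.< row b
row-pos (top j)   = s≤s z≤n
row-pos (below b) = s≤s z≤n

α⇒¬free : ∀ {n} (T : Filling n) b → T at b ≡ just letterα → lookup (free T) (column b) ≡ false
α⇒¬free (r ∷ T) (top j)   eq = newFree-α (free T) r j eq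
α⇒¬free (r ∷ T) (below b) eq = newFree-covered (free T) r (column b) (α⇒¬free T b eq)

¬free⇒α : ∀ {n} (T : Filling n) j → lookup (free T) j ≡ false → ∃[ b ] (column b ≡ j × T at b ≡ just letterα)
¬free⇒α (r ∷ T) j eq with newFree-false (free T) r j eq
... | inj₁ p = top j , ≡.refl , p
... | inj₂ (i , ≡.refl , q) with ¬free⇒α T i q
...   | b , ≡.refl , at-b = below b , ≡.refl , at-b

open IsStaircaseTableau

tableau-∷⁺ : ∀ {n} (r : Vec Cell (suc n)) (T : Filling n) →
             IsStaircaseTableau T × Compatible (free T) r → IsStaircaseTableau (r ∷ T)
tableau-∷⁺ {n} r T (t , c) = mkIsStaircaseTableau above left diag
  where
  above : ∀ b d → (r ∷ T) at b ≡ just letterα → col d ≡ col b → row d ℕ.< row b → (r ∷ T) at d ≡ nothing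
  above (top j)   d         _  _ d<1       = contradiction (row-pos d) (ℕ.<⇒≱ d<1)
  above (below b) (top j)   eq cols _      =
    ≡.trans (cong (lookup r) (col⇒column (top j) (below b) cols)) (covered c (column b) (α⇒¬free T b eq))
  above (below b) (below d) eq cols (s≤s rows) = aboveα t b d eq cols rows

  left : ∀ b d → (r ∷ T) at b ≡ just letterβ → row d ≡ row b → col d ℕ.< col b → (r ∷ T) at d ≡ nothing
  left (top j)   (top i)   eq _    (s≤s i<j) = Compatible.leftOfβ c i j eq i<j
  left (top j)   (below d) _  rows _         = contradiction (ℕ.suc-injective rows) (ℕ.m<n⇒n≢0 (row-pos d))
  left (below b) (top i)   _  rows _         = contradiction (ℕ.suc-injective (≡.sym rows)) (ℕ.m<n⇒n≢0 (row-pos b))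
  left (below b) (below d) eq rows cols      = leftOfβ t b d eq (ℕ.suc-injective rows) cols

  diag : ∀ b → row b ℕ.+ col b ≡ suc (suc n) → (r ∷ T) at b ≢ nothing
  diag (top j)   eq p = corner c (≡.trans (cong (lookup r) (≡.sym j≡n)) p)
    where
    j≡n : j ≡ Fin.fromℕ n
    j≡n = Fin.toℕ-injective (≡.trans (ℕ.suc-injective (ℕ.suc-injective eq)) (≡.sym (Fin.toℕ-fromℕ n)))
  diag (below b) eq = diagonal t b (ℕ.suc-injective eq)

tableau-∷⁻ : ∀ {n} (r : Vec Cell (suc n)) (T : Filling n) →
             IsStaircaseTableau (r ∷ T) → IsStaircaseTableau T × Compatible (free T) r
tableau-∷⁻ {n} r T t =
  mkIsStaircaseTableau
    (λ b d eq cols rows → aboveα t (below b) (below d) eq cols (s≤s rows))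
    (λ b d eq rows → leftOfβ t (below b) (below d) eq (cong suc rows))
    (λ b eq → diagonal t (below b) (cong suc eq)) ,
  record
    { covered = λ i ¬free → let b , b≡i , at-b = ¬free⇒α T i ¬free in
        aboveα t (below b) (top (inject₁ i)) at-b
          (column⇒col (top (inject₁ i)) (below b) (cong inject₁ (≡.sym b≡i))) (s≤s (row-pos b))
    ; leftOfβ = λ i j eq i<j → leftOfβ t (top j) (top i) eq ≡.refl (s≤s i<j)
    ; corner  = diagonal t (top (Fin.fromℕ n)) (cong (suc ∘ suc) (Fin.toℕ-fromℕ n))
    }

-- An equation of Booleans, so that the guard of a filtered sum splits into a factor depending on
-- `T` alone and a condition on the row.
does-tableau-∷ : ∀ {n} (r : Vec Cell (suc n)) (T : Filling n) →
                 does (isStaircaseTableau? (r ∷ T)) ≡ does (isStaircaseTableau? T) ∧ fits (free T) r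
does-tableau-∷ r T = ≡.trans
  (does-⇔ (mk⇔ (λ t → let t′ , c = tableau-∷⁻ r T t in t′ , compatible⇒fits (free T) r c)
               (λ (t , p) → tableau-∷⁺ r T (t , fits⇒compatible (free T) r p)))
          (isStaircaseTableau? (r ∷ T)) (isStaircaseTableau? T ×-dec (fits (free T) r Bool.≟ true)))
  (cong (does (isStaircaseTableau? T) ∧_) (does-≟-true (fits (free T) r)))
  where
  does-≟-true : ∀ b → does (b Bool.≟ true) ≡ b
  does-≟-true true  = ≡.refl
  does-≟-true false = ≡.refl

-- Counting symbols after a top row is added

bit : Bool → ℕ
bit b = if b then 1 else 0

tally : ∀ {n} → (Fin n → Bool) → ℕ
tally {zero}  p = 0
tally {suc n} p = bit (p Fin.zero) ℕ.+ tally (p ∘ Fin.suc)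

module _ {a p} {X : Set a} {P : X → Set p} (P? : Decidable P) where

  length-filter-∷ : ∀ x xs → length (filter P? (x ∷ xs)) ≡ bit (does (P? x)) ℕ.+ length (filter P? xs)
  length-filter-∷ x xs with does (P? x)
  ... | true  = ≡.refl
  ... | false = ≡.refl

  length-filter-++ : ∀ xs ys → length (filter P? (xs List.++ ys)) ≡ length (filter P? xs) ℕ.+ length (filter P? ys)
  length-filter-++ []       ys = ≡.refl
  length-filter-++ (x ∷ xs) ys = ≡.trans (length-filter-∷ x (xs List.++ ys))
    (≡.trans (cong (bit (does (P? x)) ℕ.+_) (length-filter-++ xs ys))
      (≡.trans (≡.sym (ℕ.+-assoc (bit (does (P? x))) _ _)) (cong (ℕ._+ length (filter P? ys)) (≡.sym (length-filter-∷ x xs)))))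

  length-filter-map-tabulate : ∀ {b} {Y : Set b} (f : Y → X) {n} (g : Fin n → Y) →
    length (filter P? (List.map f (List.tabulate g))) ≡ tally (λ j → does (P? (f (g j))))
  length-filter-map-tabulate f {zero}  g = ≡.refl
  length-filter-map-tabulate f {suc n} g = ≡.trans (length-filter-∷ _ _)
    (cong (bit (does (P? (f (g Fin.zero)))) ℕ.+_) (length-filter-map-tabulate f (g ∘ Fin.suc)))

  length-filter-map : ∀ {b q} {Y : Set b} {Q : Y → Set q} (Q? : Decidable Q) (f : Y → X) →
    (∀ y → does (P? (f y)) ≡ does (Q? y)) → ∀ ys → length (filter P? (List.map f ys)) ≡ length (filter Q? ys)
  length-filter-map Q? f eq []       = ≡.refl
  length-filter-map Q? f eq (y ∷ ys) with does (P? (f y)) | does (Q? y) | eq y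
  ... | true  | true  | ≡.refl = cong suc (length-filter-map Q? f eq ys)
  ... | false | false | ≡.refl = length-filter-map Q? f eq ys

countSymbol : Symbol → ∀ {n} → Vec Cell n → ℕ
countSymbol s r = tally (λ j → does (lookup r j ≟ just s))

N-∷ : ∀ s {n} (r : Vec Cell (suc n)) (T : Filling n) → N s (r ∷ T) ≡ countSymbol s r ℕ.+ N s T
N-∷ s {n} r T = ≡.trans (length-filter-++ (λ b → (r ∷ T) at b ≟ just s) (List.map top (allFin (suc n))) (List.map below (boxes n)))
  (cong₂ ℕ._+_ (length-filter-map-tabulate (λ b → (r ∷ T) at b ≟ just s) top id)
    (length-filter-map (λ b → (r ∷ T) at b ≟ just s) (λ b → T at b ≟ just s) below (λ _ → ≡.refl) (boxes n)))

-- Of the boxes in the top row, only the second last one is on the second main diagonal.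
secondLastα : ∀ {n} → Vec Cell (suc n) → Bool
secondLastα {zero}        _       = false
secondLastα {suc zero}    (x ∷ _) = does (x ≟ just letterα)
secondLastα {suc (suc n)} (_ ∷ r) = secondLastα r

secondLastα-tally : ∀ {n} (r : Vec Cell (suc n)) →
  tally (λ j → does ((1 ℕ.+ suc (toℕ j) ℕ.≟ suc n) ×-dec (lookup r j ≟ just letterα))) ≡ bit (secondLastα r)
secondLastα-tally {zero}        r       = ≡.refl
secondLastα-tally {suc zero}    (x ∷ r) = ℕ.+-identityʳ _
secondLastα-tally {suc (suc n)} (_ ∷ r) = secondLastα-tally r

A-∷ : ∀ {n} (r : Vec Cell (suc n)) (T : Filling n) → A (r ∷ T) ≡ bit (secondLastα r) ℕ.+ A T
A-∷ {n} r T = ≡.trans (length-filter-++ P? (List.map top (allFin (suc n))) (List.map below (boxes n)))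
  (cong₂ ℕ._+_ (≡.trans (length-filter-map-tabulate P? top id) (secondLastα-tally r))
    (length-filter-map P? (λ b → (row b ℕ.+ col b ℕ.≟ n) ×-dec (T at b ≟ just letterα)) below (λ _ → ≡.refl) (boxes n)))
  where
  P? = λ (b : Box (suc n)) → (row b ℕ.+ col b ℕ.≟ suc n) ×-dec ((r ∷ T) at b ≟ just letterα)

trues : ∀ {n} → Vec Bool n → ℕ
trues []      = 0
trues (u ∷ v) = bit u ℕ.+ trues v

cornerβ : ∀ n → Vec Cell (suc n)
cornerβ zero    = just letterβ ∷ []
cornerβ (suc n) = nothing ∷ cornerβ n

newFree-cornerβ : ∀ {n} (v : Vec Bool n) → newFree v (cornerβ n) ≡ v ∷ʳ true
newFree-cornerβ []      = ≡.refl
newFree-cornerβ (u ∷ v) = cong₂ _∷_ (Bool.∧-identityʳ u) (newFree-cornerβ v)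

secondLastα-cornerβ : ∀ n → secondLastα (cornerβ n) ≡ false
secondLastα-cornerβ zero          = ≡.refl
secondLastα-cornerβ (suc zero)    = ≡.refl
secondLastα-cornerβ (suc (suc n)) = secondLastα-cornerβ (suc n)

-- Finite sums over lists with Boolean guards

module Sums {c ℓ₁ ℓ₂} (R : RealField c ℓ₁ ℓ₂) where
  open RealField R
  open RealFieldProperties R
  open IntegerCoefficients commutativeRing
  open OrderedFieldProperties R

  sumOver-cong : ∀ {a} {X : Set a} (xs : List X) {f g : X → Carrier} → (∀ x → f x ≈ g x) → sumOver xs f ≈ sumOver xs g
  sumOver-cong []       f≈g = ≈-refl
  sumOver-cong (x ∷ xs) f≈g = +-cong (f≈g x) (sumOver-cong xs f≈g)

  sumOver-mono : ∀ {a} {X : Set a} (xs : List X) {f g : X → Carrier} → (∀ x → f x ≤ g x) → sumOver xs f ≤ sumOver xs g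
  sumOver-mono []       f≤g = ≤-refl
  sumOver-mono (x ∷ xs) f≤g = +-mono-≤ (f≤g x) (sumOver-mono xs f≤g)

  sumOver-+ : ∀ {a} {X : Set a} (xs : List X) (f g : X → Carrier) →
              sumOver xs (λ x → f x + g x) ≈ sumOver xs f + sumOver xs g
  sumOver-+ []       f g = ≈-sym (+-identityˡ 0#)
  sumOver-+ (x ∷ xs) f g = ≈-trans (+-congˡ (sumOver-+ xs f g))
    (solve 4 (λ x y s t → (x :+ y) :+ (s :+ t) := (x :+ s) :+ (y :+ t)) ≈-refl (f x) (g x) (sumOver xs f) (sumOver xs g))

  sumOver-*ˡ : ∀ {a} {X : Set a} (xs : List X) k (f : X → Carrier) → sumOver xs (λ x → k * f x) ≈ k * sumOver xs f
  sumOver-*ˡ []       k f = ≈-sym (zeroʳ k)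
  sumOver-*ˡ (x ∷ xs) k f = ≈-trans (+-congˡ (sumOver-*ˡ xs k f)) (≈-sym (distribˡ k _ _))

  sumOver-zero : ∀ {a} {X : Set a} (xs : List X) {f : X → Carrier} → (∀ x → f x ≈ 0#) → sumOver xs f ≈ 0#
  sumOver-zero []       f≈0 = ≈-refl
  sumOver-zero (x ∷ xs) f≈0 = ≈-trans (+-cong (f≈0 x) (sumOver-zero xs f≈0)) (+-identityˡ 0#)

  sumOver-++ : ∀ {a} {X : Set a} (xs ys : List X) (f : X → Carrier) →
               sumOver (xs List.++ ys) f ≈ sumOver xs f + sumOver ys f
  sumOver-++ []       ys f = ≈-sym (+-identityˡ _)
  sumOver-++ (x ∷ xs) ys f = ≈-trans (+-congˡ (sumOver-++ xs ys f)) (≈-sym (+-assoc _ _ _))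

  sumOver-map : ∀ {a b} {X : Set a} {Y : Set b} (h : X → Y) (xs : List X) (f : Y → Carrier) →
                sumOver (List.map h xs) f ≈ sumOver xs (f ∘ h)
  sumOver-map h []       f = ≈-refl
  sumOver-map h (x ∷ xs) f = +-congˡ (sumOver-map h xs f)

  sumOver-cartesianProductWith : ∀ {a b d} {X : Set a} {Y : Set b} {W : Set d} (h : X → Y → W) xs ys (f : W → Carrier) →
    sumOver (cartesianProductWith h xs ys) f ≈ sumOver xs (λ x → sumOver ys (λ y → f (h x y)))
  sumOver-cartesianProductWith h []       ys f = ≈-refl
  sumOver-cartesianProductWith h (x ∷ xs) ys f = ≈-trans (sumOver-++ (List.map (h x) ys) _ f)
    (+-cong (sumOver-map (h x) ys f) (sumOver-cartesianProductWith h xs ys f))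

  sumOver-swap : ∀ {a b} {X : Set a} {Y : Set b} (xs : List X) (ys : List Y) (f : X → Y → Carrier) →
    sumOver xs (λ x → sumOver ys (f x)) ≈ sumOver ys (λ y → sumOver xs (λ x → f x y))
  sumOver-swap []       ys f = ≈-sym (sumOver-zero ys λ _ → ≈-refl)
  sumOver-swap (x ∷ xs) ys f = ≈-trans (+-congˡ (sumOver-swap xs ys f)) (≈-sym (sumOver-+ ys (f x) _))

  infix 8 [_]_
  [_]_ : Bool → Carrier → Carrier
  [ b ] x = if b then x else 0#

  []-cong : ∀ b {x y} → x ≈ y → [ b ] x ≈ [ b ] y
  []-cong true  x≈y = x≈y
  []-cong false x≈y = ≈-refl

  []-*ˡ : ∀ b k x → [ b ] (k * x) ≈ k * [ b ] x
  []-*ˡ true  k x = ≈-refl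
  []-*ˡ false k x = ≈-sym (zeroʳ k)

  []-+ : ∀ b x y → [ b ] (x + y) ≈ [ b ] x + [ b ] y
  []-+ true  x y = ≈-refl
  []-+ false x y = ≈-sym (+-identityˡ 0#)

  sumOver-[] : ∀ {a} {X : Set a} (xs : List X) b (p : X → Bool) (f : X → Carrier) →
               sumOver xs (λ x → [ b ∧ p x ] (f x)) ≈ [ b ] sumOver xs (λ x → [ p x ] (f x))
  sumOver-[] xs true  p f = ≈-refl
  sumOver-[] xs false p f = sumOver-zero xs λ _ → ≈-refl

  sumOver-filter : ∀ {a p} {X : Set a} {P : X → Set p} (P? : Decidable P) xs (f : X → Carrier) →
                   sumOver (filter P? xs) f ≈ sumOver xs (λ x → [ does (P? x) ] (f x))
  sumOver-filter P? []       f = ≈-refl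
  sumOver-filter P? (x ∷ xs) f with does (P? x)
  ... | true  = +-congˡ (sumOver-filter P? xs f)
  ... | false = ≈-trans (sumOver-filter P? xs f) (≈-sym (+-identityˡ _))

-- Weighted sums over the possible top rows

module TableauSums {c ℓ₁ ℓ₂} (R : RealField c ℓ₁ ℓ₂) {α β : RealField.Carrier R}
                   (0<α : RealField._<_ R (RealField.0# R) α)
                   (0<β : RealField._<_ R (RealField.0# R) β) where
  open RealField R
  open RealFieldProperties R
  open RandomTableau R 0<α 0<β
  open IntegerCoefficients commutativeRing
  open OrderedFieldProperties R
  open Moments R
  open Sums R
  open Algebra.Properties.Semiring.Exp (CommutativeRing.semiring commutativeRing) using (^-homo-*)
  open ≤-Reasoning

  cellWeight : Cell → Carrier
  cellWeight nothing        = 1#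
  cellWeight (just letterα) = α
  cellWeight (just letterβ) = β

  rowWeight : ∀ {n} → Vec Cell n → Carrier
  rowWeight []      = 1#
  rowWeight (x ∷ r) = cellWeight x * rowWeight r

  rowWeight-count : ∀ {n} (r : Vec Cell n) → α ^ countSymbol letterα r * β ^ countSymbol letterβ r ≈ rowWeight r
  rowWeight-count []                    = *-identityˡ 1#
  rowWeight-count (nothing ∷ r)         = ≈-trans (rowWeight-count r) (≈-sym (*-identityˡ _))
  rowWeight-count (just letterα ∷ r)    = ≈-trans (*-assoc _ _ _) (*-congˡ (rowWeight-count r))
  rowWeight-count (just letterβ ∷ r)    = ≈-trans (solve 3 (λ b x y → x :* (b :* y) := b :* (x :* y)) ≈-refl β _ _) (*-congˡ (rowWeight-count r))

  wt-∷ : ∀ {n} (r : Vec Cell (suc n)) (T : Filling n) → wt (r ∷ T) ≈ wt T * rowWeight r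
  wt-∷ r T = begin-equality
    α ^ N letterα (r ∷ T) * β ^ N letterβ (r ∷ T)
      ≈⟨ *-cong (power letterα α) (power letterβ β) ⟩
    (α ^ countSymbol letterα r * α ^ N letterα T) * (β ^ countSymbol letterβ r * β ^ N letterβ T)
      ≈⟨ solve 4 (λ a b x y → (a :* x) :* (b :* y) := (x :* y) :* (a :* b)) ≈-refl _ _ _ _ ⟩
    wt T * (α ^ countSymbol letterα r * β ^ countSymbol letterβ r)
      ≈⟨ *-congˡ (rowWeight-count r) ⟩
    wt T * rowWeight r ∎
    where
    power : ∀ s x → x ^ N s (r ∷ T) ≈ x ^ countSymbol s r * x ^ N s T
    power s x rewrite N-∷ s r T = ^-homo-* x (countSymbol s r) (N s T)

  fitSum fitSum₀ : ∀ {n} → Vec Bool n → (Vec Cell (suc n) → Carrier) → Carrier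
  fitSum  {n} v Φ = sumOver (rows (suc n)) (λ r → [ fits v r ] (rowWeight r * Φ r))
  fitSum₀ {n} v Φ = sumOver (rows (suc n)) (λ r → [ fits₀ v r ] (rowWeight r * Φ r))

  sumOver-rows : ∀ {n} (f : Vec Cell (suc n) → Carrier) → sumOver (rows (suc n)) f ≈
    sumOver (rows n) (f ∘ (nothing ∷_)) + (sumOver (rows n) (f ∘ (just letterα ∷_)) + sumOver (rows n) (f ∘ (just letterβ ∷_)))
  sumOver-rows {n} f = ≈-trans (sumOver-cartesianProductWith _∷_ cells (rows n) f) (+-congˡ (+-congˡ (+-identityʳ _)))

  private
    dropNothing : ∀ {n} (p : Vec Cell n → Bool) (Φ : Vec Cell (suc n) → Carrier) →
      sumOver (rows n) (λ r → [ p r ] (rowWeight (nothing ∷ r) * Φ (nothing ∷ r))) ≈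
      sumOver (rows n) (λ r → [ p r ] (rowWeight r * Φ (nothing ∷ r)))
    dropNothing {n} p Φ = sumOver-cong (rows n) λ r → []-cong (p r) (*-congʳ (*-identityˡ _))

    dropSymbol : ∀ {n} s (p : Vec Cell n → Bool) (Φ : Vec Cell (suc n) → Carrier) →
      sumOver (rows n) (λ r → [ p r ] (rowWeight (s ∷ r) * Φ (s ∷ r))) ≈
      cellWeight s * sumOver (rows n) (λ r → [ p r ] (rowWeight r * Φ (s ∷ r)))
    dropSymbol {n} s p Φ = ≈-trans
      (sumOver-cong (rows n) λ r → ≈-trans ([]-cong (p r) (*-assoc _ _ _)) ([]-*ˡ (p r) _ _))
      (sumOver-*ˡ (rows n) _ _)

    vanish : ∀ {n} s (Φ : Vec Cell (suc n) → Carrier) →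
      sumOver (rows n) (λ r → [ false ] (rowWeight (s ∷ r) * Φ (s ∷ r))) ≈ 0#
    vanish {n} s Φ = sumOver-zero (rows n) λ _ → ≈-refl

  fitSum-[] : ∀ Φ → fitSum [] Φ ≈ α * Φ (just letterα ∷ []) + β * Φ (just letterβ ∷ [])
  fitSum-[] Φ = solve 4 (λ a b x y → con (+ 0) :+ ((a :* con (+ 1)) :* x :+ ((b :* con (+ 1)) :* y :+ con (+ 0))) := a :* x :+ b :* y)
    ≈-refl α β (Φ (just letterα ∷ [])) (Φ (just letterβ ∷ []))

  fitSum₀-[] : ∀ Φ → fitSum₀ [] Φ ≈ α * Φ (just letterα ∷ [])
  fitSum₀-[] Φ = solve 2 (λ a x → con (+ 0) :+ ((a :* con (+ 1)) :* x :+ (con (+ 0) :+ con (+ 0))) := a :* x)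
    ≈-refl α (Φ (just letterα ∷ []))

  fitSum-true : ∀ {n} (v : Vec Bool n) Φ → fitSum (true ∷ v) Φ ≈
    fitSum v (Φ ∘ (nothing ∷_)) + (α * fitSum₀ v (Φ ∘ (just letterα ∷_)) + β * fitSum₀ v (Φ ∘ (just letterβ ∷_)))
  fitSum-true v Φ = ≈-trans (sumOver-rows (λ r → [ fits (true ∷ v) r ] (rowWeight r * Φ r)))
    (+-cong (dropNothing (fits v) Φ) (+-cong (dropSymbol (just letterα) (fits₀ v) Φ) (dropSymbol (just letterβ) (fits₀ v) Φ)))

  fitSum-false : ∀ {n} (v : Vec Bool n) Φ → fitSum (false ∷ v) Φ ≈ fitSum v (Φ ∘ (nothing ∷_))
  fitSum-false v Φ = ≈-trans (sumOver-rows (λ r → [ fits (false ∷ v) r ] (rowWeight r * Φ r)))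
    (≈-trans (+-cong (dropNothing (fits v) Φ) (≈-trans (+-cong (vanish (just letterα) Φ) (vanish (just letterβ) Φ)) (+-identityˡ 0#))) (+-identityʳ _))

  fitSum₀-true : ∀ {n} (v : Vec Bool n) Φ → fitSum₀ (true ∷ v) Φ ≈
    fitSum₀ v (Φ ∘ (nothing ∷_)) + α * fitSum₀ v (Φ ∘ (just letterα ∷_))
  fitSum₀-true v Φ = ≈-trans (sumOver-rows (λ r → [ fits₀ (true ∷ v) r ] (rowWeight r * Φ r)))
    (+-cong (dropNothing (fits₀ v) Φ) (≈-trans (+-cong (dropSymbol (just letterα) (fits₀ v) Φ) (vanish (just letterβ) Φ)) (+-identityʳ _)))

  fitSum₀-false : ∀ {n} (v : Vec Bool n) Φ → fitSum₀ (false ∷ v) Φ ≈ fitSum₀ v (Φ ∘ (nothing ∷_))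
  fitSum₀-false v Φ = ≈-trans (sumOver-rows (λ r → [ fits₀ (false ∷ v) r ] (rowWeight r * Φ r)))
    (≈-trans (+-cong (dropNothing (fits₀ v) Φ) (≈-trans (+-cong (vanish (just letterα) Φ) (vanish (just letterβ) Φ)) (+-identityˡ 0#))) (+-identityʳ _))

  fitSum-cong : ∀ {n} (v : Vec Bool n) {Φ Ψ} → (∀ r → Φ r ≈ Ψ r) → fitSum v Φ ≈ fitSum v Ψ
  fitSum-cong {n} v Φ≈Ψ = sumOver-cong (rows (suc n)) λ r → []-cong (fits v r) (*-congˡ (Φ≈Ψ r))

  fitSum₀-cong : ∀ {n} (v : Vec Bool n) {Φ Ψ} → (∀ r → Φ r ≈ Ψ r) → fitSum₀ v Φ ≈ fitSum₀ v Ψ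
  fitSum₀-cong {n} v Φ≈Ψ = sumOver-cong (rows (suc n)) λ r → []-cong (fits₀ v r) (*-congˡ (Φ≈Ψ r))

  fitSum-*ˡ : ∀ {n} (v : Vec Bool n) k Φ → fitSum v (λ r → k * Φ r) ≈ k * fitSum v Φ
  fitSum-*ˡ {n} v k Φ = ≈-trans
    (sumOver-cong (rows (suc n)) λ r → ≈-trans
      ([]-cong (fits v r) (solve 3 (λ w k x → w :* (k :* x) := k :* (w :* x)) ≈-refl (rowWeight r) k (Φ r))) ([]-*ˡ (fits v r) k _))
    (sumOver-*ˡ (rows (suc n)) k _)

  fitSum₀-*ˡ : ∀ {n} (v : Vec Bool n) k Φ → fitSum₀ v (λ r → k * Φ r) ≈ k * fitSum₀ v Φ
  fitSum₀-*ˡ {n} v k Φ = ≈-trans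
    (sumOver-cong (rows (suc n)) λ r → ≈-trans
      ([]-cong (fits₀ v r) (solve 3 (λ w k x → w :* (k :* x) := k :* (w :* x)) ≈-refl (rowWeight r) k (Φ r))) ([]-*ˡ (fits₀ v r) k _))
    (sumOver-*ˡ (rows (suc n)) k _)

  fitSum-+ : ∀ {n} (v : Vec Bool n) Φ Ψ → fitSum v (λ r → Φ r + Ψ r) ≈ fitSum v Φ + fitSum v Ψ
  fitSum-+ {n} v Φ Ψ = ≈-trans
    (sumOver-cong (rows (suc n)) λ r → ≈-trans ([]-cong (fits v r) (distribˡ _ _ _)) ([]-+ (fits v r) _ _))
    (sumOver-+ (rows (suc n)) _ _)

  -- Once the sums over rows and fillings are interchanged, the guard and the weight of `T` leave
  -- the inner sum, which depends on the shape of `T` only through `free T` and `Φ`.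
  sumOver-tableaux : ∀ {n} (Φ : Filling (suc n) → Carrier) →
    sumOver (tableaux (suc n)) (λ T → wt T * Φ T) ≈ sumOver (tableaux n) (λ T → wt T * fitSum (free T) (λ r → Φ (r ∷ T)))
  sumOver-tableaux {n} Φ = begin-equality
    sumOver (tableaux (suc n)) (λ T → wt T * Φ T)
      ≈⟨ sumOver-filter isStaircaseTableau? (fillings (suc n)) _ ⟩
    sumOver (fillings (suc n)) (λ T → [ does (isStaircaseTableau? T) ] (wt T * Φ T))
      ≈⟨ sumOver-cartesianProductWith _∷_ (rows (suc n)) (fillings n) _ ⟩
    sumOver (rows (suc n)) (λ r → sumOver (fillings n) (λ T → [ does (isStaircaseTableau? (r ∷ T)) ] (wt (r ∷ T) * Φ (r ∷ T))))
      ≈⟨ sumOver-swap (rows (suc n)) (fillings n) _ ⟩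
    sumOver (fillings n) (λ T → sumOver (rows (suc n)) (λ r → [ does (isStaircaseTableau? (r ∷ T)) ] (wt (r ∷ T) * Φ (r ∷ T))))
      ≈⟨ sumOver-cong (fillings n) (λ T → ≈-trans (sumOver-cong (rows (suc n)) (split T)) (≈-trans
           (sumOver-[] (rows (suc n)) (does (isStaircaseTableau? T)) (fits (free T)) _)
           ([]-cong (does (isStaircaseTableau? T)) (≈-trans
             (sumOver-cong (rows (suc n)) λ r → []-*ˡ (fits (free T) r) (wt T) _)
             (sumOver-*ˡ (rows (suc n)) (wt T) _))))) ⟩
    sumOver (fillings n) (λ T → [ does (isStaircaseTableau? T) ] (wt T * fitSum (free T) (λ r → Φ (r ∷ T))))
      ≈⟨ sumOver-filter isStaircaseTableau? (fillings n) _ ⟨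
    sumOver (tableaux n) (λ T → wt T * fitSum (free T) (λ r → Φ (r ∷ T))) ∎
    where
    split : ∀ T r → [ does (isStaircaseTableau? (r ∷ T)) ] (wt (r ∷ T) * Φ (r ∷ T)) ≈
                    [ does (isStaircaseTableau? T) ∧ fits (free T) r ] (wt T * (rowWeight r * Φ (r ∷ T)))
    split T r rewrite does-tableau-∷ r T =
      []-cong (does (isStaircaseTableau? T) ∧ fits (free T) r) (≈-trans (*-congʳ (wt-∷ r T)) (*-assoc _ _ _))

  infix 8 _^ᶠ_
  _^ᶠ_ : ∀ {n} → Carrier → Vec Bool n → Carrier
  y ^ᶠ v = y ^ trues v

  -- A free column contributes y if its new cell is empty and α if it is filled, since it is then
  -- free no more. The last cell has to be α and closes its own column, whence the single factor α.
  fitSum₀-free : ∀ y {n} (v : Vec Bool n) → fitSum₀ v (λ r → y ^ᶠ newFree v r) ≈ α * (y + α) ^ᶠ v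
  fitSum₀-free y []          = fitSum₀-[] (λ r → y ^ᶠ newFree [] r)
  fitSum₀-free y (false ∷ v) = ≈-trans (fitSum₀-false v _) (fitSum₀-free y v)
  fitSum₀-free y (true ∷ v)  = begin-equality
    fitSum₀ (true ∷ v) (λ r → y ^ᶠ newFree (true ∷ v) r)
      ≈⟨ fitSum₀-true v _ ⟩
    fitSum₀ v (λ r → y * y ^ᶠ newFree v r) + α * fitSum₀ v (λ r → y ^ᶠ newFree v r)
      ≈⟨ +-congʳ (fitSum₀-*ˡ v y _) ⟩
    y * fitSum₀ v (λ r → y ^ᶠ newFree v r) + α * fitSum₀ v (λ r → y ^ᶠ newFree v r)
      ≈⟨ distribʳ _ y α ⟨
    (y + α) * fitSum₀ v (λ r → y ^ᶠ newFree v r)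
      ≈⟨ *-congˡ (fitSum₀-free y v) ⟩
    (y + α) * (α * (y + α) ^ᶠ v)
      ≈⟨ solve 3 (λ s a p → s :* (a :* p) := a :* (s :* p)) ≈-refl (y + α) α ((y + α) ^ᶠ v) ⟩
    α * ((y + α) * (y + α) ^ᶠ v) ∎

  -- Grouped by the leftmost symbol of the row: it contributes α + βy, because a column stays free
  -- under β; the empty cells to its left and the cells to its right telescope to a power of y + α.
  fitSum-free : ∀ y {n} (v : Vec Bool n) → fitSum v (λ r → y ^ᶠ newFree v r) ≈ (α + β * y) * (y + α) ^ᶠ v
  fitSum-free y []          = ≈-trans (fitSum-[] (λ r → y ^ᶠ newFree [] r))
    (solve 3 (λ a b y → a :* con (+ 1) :+ b :* (y :* con (+ 1)) := (a :+ b :* y) :* con (+ 1)) ≈-refl α β y)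
  fitSum-free y (false ∷ v) = ≈-trans (fitSum-false v _) (fitSum-free y v)
  fitSum-free y (true ∷ v)  = begin-equality
    fitSum (true ∷ v) (λ r → y ^ᶠ newFree (true ∷ v) r)
      ≈⟨ fitSum-true v _ ⟩
    fitSum v (λ r → y * y ^ᶠ newFree v r) + (α * fitSum₀ v (λ r → y ^ᶠ newFree v r) + β * fitSum₀ v (λ r → y * y ^ᶠ newFree v r))
      ≈⟨ +-cong (fitSum-*ˡ v y _) (+-congˡ (*-congˡ (fitSum₀-*ˡ v y _))) ⟩
    y * fitSum v (λ r → y ^ᶠ newFree v r) + (α * fitSum₀ v (λ r → y ^ᶠ newFree v r) + β * (y * fitSum₀ v (λ r → y ^ᶠ newFree v r)))
      ≈⟨ +-cong (*-congˡ (fitSum-free y v)) (+-cong (*-congˡ (fitSum₀-free y v)) (*-congˡ (*-congˡ (fitSum₀-free y v)))) ⟩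
    y * ((α + β * y) * p) + (α * (α * p) + β * (y * (α * p)))
      ≈⟨ solve 4 (λ y a b p → y :* ((a :+ b :* y) :* p) :+ (a :* (a :* p) :+ b :* (y :* (a :* p))) := (a :+ b :* y) :* ((y :+ a) :* p)) ≈-refl y α β p ⟩
    (α + β * y) * ((y + α) * p) ∎
    where p = (y + α) ^ᶠ v

  secondLastWeight : Carrier → ∀ {n} → Vec Bool n → Vec Cell (suc n) → Carrier
  secondLastWeight y v r = fromℕ (bit (secondLastα r)) * y ^ᶠ newFree v r

  secondLastSum : Carrier → ∀ {n} → Vec Bool n → Carrier
  secondLastSum y v = fitSum v (secondLastWeight y v)

  secondLastSum₀ : Carrier → ∀ {n} → Vec Bool n → Carrier
  secondLastSum₀ y v = fitSum₀ v (secondLastWeight y v)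

  secondLastSum-[] : ∀ y → secondLastSum y [] ≈ 0#
  secondLastSum-[] y = ≈-trans (fitSum-[] (secondLastWeight y []))
    (solve 3 (λ a b y → a :* (con (+ 0) :* con (+ 1)) :+ b :* (con (+ 0) :* (y :* con (+ 1))) := con (+ 0)) ≈-refl α β y)

  -- As `v` is nonempty, the cell placed in front is not the second last one and does not affect
  -- `secondLastα`.
  module _ (y : Carrier) {n} (v : Vec Bool (suc n)) where

    private
      Φ₁ Φy : Vec Cell (suc (suc n)) → Carrier
      Φ₁ = secondLastWeight y v
      Φy r = y * Φ₁ r

      pull-y : ∀ (r : Vec Cell (suc (suc n))) → fromℕ (bit (secondLastα r)) * (y * y ^ᶠ newFree v r) ≈ Φy r
      pull-y r = solve 3 (λ y x p → x :* (y :* p) := y :* (x :* p)) ≈-refl y (fromℕ (bit (secondLastα r))) (y ^ᶠ newFree v r)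

    secondLastSum-true : secondLastSum y (true ∷ v) ≈ y * secondLastSum y v + (α + β * y) * secondLastSum₀ y v
    secondLastSum-true = begin-equality
      secondLastSum y (true ∷ v)
        ≈⟨ fitSum-true v (secondLastWeight y (true ∷ v)) ⟩
      fitSum v (secondLastWeight y (true ∷ v) ∘ (nothing ∷_)) + (α * fitSum₀ v Φ₁ + β * fitSum₀ v (secondLastWeight y (true ∷ v) ∘ (just letterβ ∷_)))
        ≈⟨ +-cong (≈-trans (fitSum-cong v pull-y) (fitSum-*ˡ v y Φ₁))
             (+-congˡ (*-congˡ (≈-trans (fitSum₀-cong v pull-y) (fitSum₀-*ˡ v y Φ₁)))) ⟩
      y * secondLastSum y v + (α * secondLastSum₀ y v + β * (y * secondLastSum₀ y v))
        ≈⟨ solve 5 (λ y a b s t → y :* s :+ (a :* t :+ b :* (y :* t)) := y :* s :+ (a :+ b :* y) :* t) ≈-refl y α β (secondLastSum y v) (secondLastSum₀ y v) ⟩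
      y * secondLastSum y v + (α + β * y) * secondLastSum₀ y v ∎

    secondLastSum-false : secondLastSum y (false ∷ v) ≈ secondLastSum y v
    secondLastSum-false = fitSum-false v (secondLastWeight y (false ∷ v))

    secondLastSum₀-true : secondLastSum₀ y (true ∷ v) ≈ (y + α) * secondLastSum₀ y v
    secondLastSum₀-true = begin-equality
      secondLastSum₀ y (true ∷ v)
        ≈⟨ fitSum₀-true v (secondLastWeight y (true ∷ v)) ⟩
      fitSum₀ v (secondLastWeight y (true ∷ v) ∘ (nothing ∷_)) + α * fitSum₀ v Φ₁
        ≈⟨ +-congʳ (≈-trans (fitSum₀-cong v pull-y) (fitSum₀-*ˡ v y Φ₁)) ⟩
      y * secondLastSum₀ y v + α * secondLastSum₀ y v
        ≈⟨ distribʳ _ y α ⟨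
      (y + α) * secondLastSum₀ y v ∎

    secondLastSum₀-false : secondLastSum₀ y (false ∷ v) ≈ secondLastSum₀ y v
    secondLastSum₀-false = fitSum₀-false v (secondLastWeight y (false ∷ v))

  -- The last entry of the pattern belongs to the second last cell of the new row, and a closed
  -- column forces that cell to be empty.
  secondLastSum₀-∷ʳfalse : ∀ y {n} (w : Vec Bool n) → secondLastSum₀ y (w ∷ʳ false) ≈ 0#
  secondLastSum₀-∷ʳfalse y []          = ≈-trans (fitSum₀-false [] (secondLastWeight y (false ∷ [])))
    (≈-trans (fitSum₀-[] (secondLastWeight y (false ∷ []) ∘ (nothing ∷_)))
      (solve 1 (λ a → a :* (con (+ 0) :* con (+ 1)) := con (+ 0)) ≈-refl α))
  secondLastSum₀-∷ʳfalse y (false ∷ w) = ≈-trans (secondLastSum₀-false y (w ∷ʳ false)) (secondLastSum₀-∷ʳfalse y w)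
  secondLastSum₀-∷ʳfalse y (true ∷ w)  = ≈-trans (secondLastSum₀-true y (w ∷ʳ false))
    (≈-trans (*-congˡ (secondLastSum₀-∷ʳfalse y w)) (zeroʳ _))

  secondLastSum-∷ʳfalse : ∀ y {n} (w : Vec Bool n) → secondLastSum y (w ∷ʳ false) ≈ 0#
  secondLastSum-∷ʳfalse y []          = ≈-trans (fitSum-false [] (secondLastWeight y (false ∷ [])))
    (≈-trans (fitSum-[] (secondLastWeight y (false ∷ []) ∘ (nothing ∷_)))
      (solve 3 (λ a b y → a :* (con (+ 0) :* con (+ 1)) :+ b :* (con (+ 0) :* (y :* con (+ 1))) := con (+ 0)) ≈-refl α β y))
  secondLastSum-∷ʳfalse y (false ∷ w) = ≈-trans (secondLastSum-false y (w ∷ʳ false)) (secondLastSum-∷ʳfalse y w)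
  secondLastSum-∷ʳfalse y (true ∷ w)  = ≈-trans (secondLastSum-true y (w ∷ʳ false))
    (≈-trans (+-cong (≈-trans (*-congˡ (secondLastSum-∷ʳfalse y w)) (zeroʳ _)) (≈-trans (*-congˡ (secondLastSum₀-∷ʳfalse y w)) (zeroʳ _)))
      (+-identityˡ 0#))

  secondLastSum₀-∷ʳtrue : ∀ y {n} (w : Vec Bool n) → secondLastSum₀ y (w ∷ʳ true) ≈ α * (α * (y + α) ^ᶠ w)
  secondLastSum₀-∷ʳtrue y []          = ≈-trans (fitSum₀-true [] Ψ)
    (≈-trans (+-cong (fitSum₀-[] (Ψ ∘ (nothing ∷_))) (*-congˡ (fitSum₀-[] (Ψ ∘ (just letterα ∷_)))))
      (solve 2 (λ a y → a :* (con (+ 0) :* (y :* con (+ 1))) :+ a :* (a :* ((con (+ 1) :+ con (+ 0)) :* con (+ 1))) := a :* (a :* con (+ 1))) ≈-refl α y))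
    where Ψ = secondLastWeight y (true ∷ [])
  secondLastSum₀-∷ʳtrue y (false ∷ w) = ≈-trans (secondLastSum₀-false y (w ∷ʳ true)) (secondLastSum₀-∷ʳtrue y w)
  secondLastSum₀-∷ʳtrue y (true ∷ w)  = ≈-trans (secondLastSum₀-true y (w ∷ʳ true))
    (≈-trans (*-congˡ (secondLastSum₀-∷ʳtrue y w))
      (solve 3 (λ s a p → s :* (a :* (a :* p)) := a :* (a :* (s :* p))) ≈-refl (y + α) α ((y + α) ^ᶠ w)))

  -- A fitting row with α in its second last cell ends in α. Cutting off the last cell leaves a row
  -- over `w` with α in its corner. These are all the rows of `fitSum-free` except the one with β in
  -- its corner, which is otherwise empty and contributes βy times `y ^ᶠ w`; it is added on the left
  -- to avoid a subtraction.
  secondLastSum-∷ʳtrue : ∀ y {n} (w : Vec Bool n) →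
    secondLastSum y (w ∷ʳ true) + α * β * y * y ^ᶠ w ≈ α * (α + β * y) * (y + α) ^ᶠ w
  secondLastSum-∷ʳtrue y []          = ≈-trans (+-congʳ (≈-trans (fitSum-true [] Ψ)
      (+-cong (fitSum-[] (Ψ ∘ (nothing ∷_))) (+-cong (*-congˡ (fitSum₀-[] (Ψ ∘ (just letterα ∷_)))) (*-congˡ (fitSum₀-[] (Ψ ∘ (just letterβ ∷_))))))))
      (solve 3 (λ a b y →
        (a :* (con (+ 0) :* (y :* con (+ 1))) :+ b :* (con (+ 0) :* (y :* (y :* con (+ 1)))) :+
          (a :* (a :* ((con (+ 1) :+ con (+ 0)) :* con (+ 1))) :+ b :* (a :* (con (+ 0) :* (y :* con (+ 1)))))) :+ a :* b :* y :* con (+ 1)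
        := a :* (a :+ b :* y) :* con (+ 1)) ≈-refl α β y)
    where Ψ = secondLastWeight y (true ∷ [])
  secondLastSum-∷ʳtrue y (false ∷ w) = ≈-trans (+-congʳ (secondLastSum-false y (w ∷ʳ true))) (secondLastSum-∷ʳtrue y w)
  secondLastSum-∷ʳtrue y (true ∷ w)  = begin-equality
    secondLastSum y (true ∷ (w ∷ʳ true)) + α * β * y * (y * q)
      ≈⟨ +-congʳ (≈-trans (secondLastSum-true y (w ∷ʳ true)) (+-congˡ (*-congˡ (secondLastSum₀-∷ʳtrue y w)))) ⟩
    y * s + (α + β * y) * (α * (α * p)) + α * β * y * (y * q)
      ≈⟨ solve 6 (λ y a b s p q → y :* s :+ (a :+ b :* y) :* (a :* (a :* p)) :+ a :* b :* y :* (y :* q)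
                  := y :* (s :+ a :* b :* y :* q) :+ (a :+ b :* y) :* (a :* (a :* p))) ≈-refl y α β s p q ⟩
    y * (s + α * β * y * q) + (α + β * y) * (α * (α * p))
      ≈⟨ +-congʳ (*-congˡ (secondLastSum-∷ʳtrue y w)) ⟩
    y * (α * (α + β * y) * p) + (α + β * y) * (α * (α * p))
      ≈⟨ solve 4 (λ y a b p → y :* (a :* (a :+ b :* y) :* p) :+ (a :+ b :* y) :* (a :* (a :* p)) := a :* (a :+ b :* y) :* ((y :+ a) :* p)) ≈-refl y α β p ⟩
    α * (α + β * y) * ((y + α) * p) ∎
    where
    s = secondLastSum y (w ∷ʳ true)
    p = (y + α) ^ᶠ w
    q = y ^ᶠ w

  fitSum₀-cornerα : ∀ {n} (v : Vec Bool n) Φ → (∀ r w → newFree v r ≡ w ∷ʳ false → Φ r ≈ 0#) → fitSum₀ v Φ ≈ 0#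
  fitSum₀-cornerα []      Φ Φ≈0 = ≈-trans (fitSum₀-[] Φ) (≈-trans (*-congˡ (Φ≈0 (just letterα ∷ []) [] ≡.refl)) (zeroʳ α))
  fitSum₀-cornerα (u ∷ v) Φ Φ≈0 = go u λ x → fitSum₀-cornerα v (Φ ∘ (x ∷_)) λ r w eq →
    Φ≈0 (x ∷ r) ((u ∧ notα x) ∷ w) (≡.cong ((u ∧ notα x) ∷_) eq)
    where
    go : ∀ u → (∀ x → fitSum₀ v (Φ ∘ (x ∷_)) ≈ 0#) → fitSum₀ (u ∷ v) Φ ≈ 0#
    go false h = ≈-trans (fitSum₀-false v Φ) (h nothing)
    go true  h = ≈-trans (fitSum₀-true v Φ) (≈-trans (+-cong (h nothing) (≈-trans (*-congˡ (h (just letterα))) (zeroʳ α))) (+-identityˡ 0#))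

  -- A last cell β excludes all other symbols from its row.
  fitSum-cornerβ : ∀ {n} (v : Vec Bool n) Φ → (∀ r w → newFree v r ≡ w ∷ʳ false → Φ r ≈ 0#) → fitSum v Φ ≈ β * Φ (cornerβ n)
  fitSum-cornerβ []      Φ Φ≈0 = ≈-trans (fitSum-[] Φ)
    (≈-trans (+-congʳ (≈-trans (*-congˡ (Φ≈0 (just letterα ∷ []) [] ≡.refl)) (zeroʳ α))) (+-identityˡ _))
  fitSum-cornerβ {suc n} (u ∷ v) Φ Φ≈0 = go u (fitSum-cornerβ v (Φ ∘ (nothing ∷_)) (Φ≈0′ nothing)) λ x → fitSum₀-cornerα v (Φ ∘ (x ∷_)) (Φ≈0′ x)
    where
    Φ≈0′ : ∀ x r w → newFree v r ≡ w ∷ʳ false → Φ (x ∷ r) ≈ 0#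
    Φ≈0′ x r w eq = Φ≈0 (x ∷ r) ((u ∧ notα x) ∷ w) (≡.cong ((u ∧ notα x) ∷_) eq)

    go : ∀ u → fitSum v (Φ ∘ (nothing ∷_)) ≈ β * Φ (nothing ∷ cornerβ n) → (∀ x → fitSum₀ v (Φ ∘ (x ∷_)) ≈ 0#) →
         fitSum (u ∷ v) Φ ≈ β * Φ (nothing ∷ cornerβ n)
    go false h h₀ = ≈-trans (fitSum-false v Φ) h
    go true  h h₀ = ≈-trans (fitSum-true v Φ)
      (≈-trans (+-cong h (≈-trans (+-cong (≈-trans (*-congˡ (h₀ (just letterα))) (zeroʳ α)) (≈-trans (*-congˡ (h₀ (just letterβ))) (zeroʳ β))) (+-identityˡ 0#)))
        (+-identityʳ _))

-- Recursion and closed form of the binomial moments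

module TableauMoments {c ℓ₁ ℓ₂} (R : RealField c ℓ₁ ℓ₂) {α β : RealField.Carrier R}
                      (0<α : RealField._<_ R (RealField.0# R) α)
                      (0<β : RealField._<_ R (RealField.0# R) β) where
  open RealField R
  open RealFieldProperties R
  open RandomTableau R 0<α 0<β
  open IntegerCoefficients commutativeRing
  open OrderedFieldProperties R
  open Limits R
  open Moments R
  open Poisson R
  open Sums R
  open TableauSums R 0<α 0<β
  open ≤-Reasoning

  -- This is F n r y of the overview.
  momentSum : ℕ → ℕ → Carrier → Carrier
  momentSum n r y = sumOver (tableaux n) (λ T → wt T * (binom r (A T) * y ^ᶠ free T))

  -- The extra term that Pascal's rule yields for the top rows with α in the second last cell.
  secondLastMoment : ℕ → ℕ → Carrier → Carrier
  secondLastMoment n r y = sumOver (tableaux n) (λ T → wt T * (binom r (A T) * secondLastSum y (free T)))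

  private
    pull : ∀ w b x p → w * (b * (x * p)) ≈ x * (w * (b * p))
    pull = solve 4 (λ w b x p → w :* (b :* (x :* p)) := x :* (w :* (b :* p))) ≈-refl

    sumOver-pull : ∀ n r x (P : Filling n → Carrier) →
      sumOver (tableaux n) (λ T → wt T * (binom r (A T) * (x * P T))) ≈ x * sumOver (tableaux n) (λ T → wt T * (binom r (A T) * P T))
    sumOver-pull n r x P = ≈-trans (sumOver-cong (tableaux n) λ T → pull (wt T) (binom r (A T)) x (P T)) (sumOver-*ˡ (tableaux n) x _)

    Σ-cong : ∀ n {P Q : Filling n → Carrier} → (∀ T → P T ≈ Q T) →
             sumOver (tableaux n) (λ T → wt T * P T) ≈ sumOver (tableaux n) (λ T → wt T * Q T)
    Σ-cong n P≈Q = sumOver-cong (tableaux n) λ T → *-congˡ (P≈Q T)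

    Σ-+ : ∀ n (P Q : Filling n → Carrier) → sumOver (tableaux n) (λ T → wt T * (P T + Q T)) ≈
          sumOver (tableaux n) (λ T → wt T * P T) + sumOver (tableaux n) (λ T → wt T * Q T)
    Σ-+ n P Q = ≈-trans (sumOver-cong (tableaux n) λ T → distribˡ _ _ _) (sumOver-+ (tableaux n) _ _)

    Σ₀-zero : ∀ (P : Filling 0 → Carrier) → P [] ≈ 0# → sumOver (tableaux 0) (λ T → wt T * P T) ≈ 0#
    Σ₀-zero P P≈0 = ≈-trans (+-identityʳ _) (≈-trans (*-congˡ P≈0) (zeroʳ _))

  binom-bit : ∀ r b a → binom (suc r) (bit b ℕ.+ a) ≈ binom (suc r) a + fromℕ (bit b) * binom r a
  binom-bit r false a = solve 2 (λ x y → x := x :+ con (+ 0) :* y) ≈-refl (binom (suc r) a) (binom r a)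
  binom-bit r true  a = ≈-trans (binom-pascal r a)
    (solve 2 (λ x y → x :+ y := x :+ (con (+ 1) :+ con (+ 0)) :* y) ≈-refl (binom (suc r) a) (binom r a))

  momentSum-zero : ∀ n y → momentSum (suc n) 0 y ≈ (α + β * y) * momentSum n 0 (y + α)
  momentSum-zero n y = begin-equality
    momentSum (suc n) 0 y
      -- `binom 0` computes to the constant `fromℕ 1`, so `A` of the enlarged tableau may be
      -- replaced by `A T` without an argument.
      ≈⟨ sumOver-tableaux {n} (λ T → binom 0 (A T) * y ^ᶠ free T) ⟩
    sumOver (tableaux n) (λ T → wt T * fitSum (free T) (λ r → binom 0 (A T) * y ^ᶠ newFree (free T) r))
      ≈⟨ Σ-cong n (λ T → ≈-trans (fitSum-*ˡ (free T) (binom 0 (A T)) _) (*-congˡ (fitSum-free y (free T)))) ⟩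
    sumOver (tableaux n) (λ T → wt T * (binom 0 (A T) * ((α + β * y) * (y + α) ^ᶠ free T)))
      ≈⟨ sumOver-pull n 0 (α + β * y) _ ⟩
    (α + β * y) * momentSum n 0 (y + α) ∎

  momentSum-suc : ∀ n r y → momentSum (suc n) (suc r) y ≈ (α + β * y) * momentSum n (suc r) (y + α) + secondLastMoment n r y
  momentSum-suc n r y = begin-equality
    momentSum (suc n) (suc r) y
      ≈⟨ sumOver-tableaux {n} (λ T → binom (suc r) (A T) * y ^ᶠ free T) ⟩
    sumOver (tableaux n) (λ T → wt T * fitSum (free T) (λ ρ → binom (suc r) (A (ρ ∷ T)) * y ^ᶠ newFree (free T) ρ))
      ≈⟨ Σ-cong n onRow ⟩
    sumOver (tableaux n) (λ T → wt T * (binom (suc r) (A T) * ((α + β * y) * (y + α) ^ᶠ free T) + binom r (A T) * secondLastSum y (free T)))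
      ≈⟨ Σ-+ n _ _ ⟩
    sumOver (tableaux n) (λ T → wt T * (binom (suc r) (A T) * ((α + β * y) * (y + α) ^ᶠ free T))) + secondLastMoment n r y
      ≈⟨ +-congʳ (sumOver-pull n (suc r) (α + β * y) _) ⟩
    (α + β * y) * momentSum n (suc r) (y + α) + secondLastMoment n r y ∎
    where
    onRow : ∀ (T : Filling n) → fitSum (free T) (λ ρ → binom (suc r) (A (ρ ∷ T)) * y ^ᶠ newFree (free T) ρ) ≈
          binom (suc r) (A T) * ((α + β * y) * (y + α) ^ᶠ free T) + binom r (A T) * secondLastSum y (free T)
    onRow T = begin-equality
      fitSum (free T) (λ ρ → binom (suc r) (A (ρ ∷ T)) * y ^ᶠ newFree (free T) ρ)
        ≈⟨ fitSum-cong (free T) (λ ρ → ≈-trans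
             (*-congʳ (≈-trans (fromℕ-cong (≡.cong (_C suc r) (A-∷ ρ T))) (binom-bit r (secondLastα ρ) (A T))))
             (solve 4 (λ b x b′ p → (b :+ x :* b′) :* p := b :* p :+ b′ :* (x :* p)) ≈-refl
               (binom (suc r) (A T)) (fromℕ (bit (secondLastα ρ))) (binom r (A T)) (y ^ᶠ newFree (free T) ρ))) ⟩
      fitSum (free T) (λ ρ → binom (suc r) (A T) * y ^ᶠ newFree (free T) ρ + binom r (A T) * secondLastWeight y (free T) ρ)
        ≈⟨ fitSum-+ (free T) _ _ ⟩
      fitSum (free T) (λ ρ → binom (suc r) (A T) * y ^ᶠ newFree (free T) ρ) + fitSum (free T) (λ ρ → binom r (A T) * secondLastWeight y (free T) ρ)
        ≈⟨ +-cong (≈-trans (fitSum-*ˡ (free T) _ _) (*-congˡ (fitSum-free y (free T)))) (fitSum-*ˡ (free T) _ _) ⟩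
      binom (suc r) (A T) * ((α + β * y) * (y + α) ^ᶠ free T) + binom r (A T) * secondLastSum y (free T) ∎

  secondLastMoment-zero : ∀ r y → secondLastMoment 0 r y ≈ 0#
  secondLastMoment-zero r y = Σ₀-zero (λ T → binom r (A T) * secondLastSum y (free T)) (≈-trans (*-congˡ (secondLastSum-[] y)) (zeroʳ _))

  -- The second last cell of a row is above the last cell of the next row, so it
  -- can only hold α if that last cell is β.
  secondLastMoment-suc : ∀ n r y →
    secondLastMoment (suc n) r y + α * β * (β * y) * momentSum n r y ≈ α * β * (α + β * y) * momentSum n r (y + α)
  secondLastMoment-suc n r y = begin-equality
    secondLastMoment (suc n) r y + α * β * (β * y) * momentSum n r y
      ≈⟨ +-cong (≈-trans (sumOver-tableaux {n} (λ T → binom r (A T) * secondLastSum y (free T))) (Σ-cong n onRow)) (≈-sym (sumOver-pull n r _ _)) ⟩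
    sumOver (tableaux n) (λ T → wt T * (binom r (A T) * (β * secondLastSum y (free T ∷ʳ true)))) +
    sumOver (tableaux n) (λ T → wt T * (binom r (A T) * (α * β * (β * y) * y ^ᶠ free T)))
      ≈⟨ Σ-+ n _ _ ⟨
    sumOver (tableaux n) (λ T → wt T * (binom r (A T) * (β * secondLastSum y (free T ∷ʳ true)) + binom r (A T) * (α * β * (β * y) * y ^ᶠ free T)))
      ≈⟨ Σ-cong n combine ⟩
    sumOver (tableaux n) (λ T → wt T * (binom r (A T) * (α * β * (α + β * y) * (y + α) ^ᶠ free T)))
      ≈⟨ sumOver-pull n r _ _ ⟩
    α * β * (α + β * y) * momentSum n r (y + α) ∎
    where
    onRow : ∀ (T : Filling n) → fitSum (free T) (λ ρ → binom r (A (ρ ∷ T)) * secondLastSum y (newFree (free T) ρ)) ≈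
          binom r (A T) * (β * secondLastSum y (free T ∷ʳ true))
    onRow T = begin-equality
      fitSum (free T) (λ ρ → binom r (A (ρ ∷ T)) * secondLastSum y (newFree (free T) ρ))
        ≈⟨ fitSum-cornerβ (free T) _ (λ ρ w eq → ≈-trans (*-congˡ (≈-trans (≡⇒≈ (≡.cong (secondLastSum y) eq)) (secondLastSum-∷ʳfalse y w))) (zeroʳ _)) ⟩
      β * (binom r (A (cornerβ n ∷ T)) * secondLastSum y (newFree (free T) (cornerβ n)))
        ≈⟨ *-congˡ (*-cong (fromℕ-cong (≡.cong (_C r) (≡.trans (A-∷ (cornerβ n) T) (≡.cong (λ b → bit b ℕ.+ A T) (secondLastα-cornerβ n)))))
                           (≡⇒≈ (≡.cong (secondLastSum y) (newFree-cornerβ (free T))))) ⟩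
      β * (binom r (A T) * secondLastSum y (free T ∷ʳ true))
        ≈⟨ solve 3 (λ b x s → b :* (x :* s) := x :* (b :* s)) ≈-refl β (binom r (A T)) (secondLastSum y (free T ∷ʳ true)) ⟩
      binom r (A T) * (β * secondLastSum y (free T ∷ʳ true)) ∎
      where
      ≡⇒≈ : ∀ {x z} → x ≡ z → x ≈ z
      ≡⇒≈ ≡.refl = ≈-refl

    combine : ∀ (T : Filling n) → binom r (A T) * (β * secondLastSum y (free T ∷ʳ true)) + binom r (A T) * (α * β * (β * y) * y ^ᶠ free T) ≈
                                  binom r (A T) * (α * β * (α + β * y) * (y + α) ^ᶠ free T)
    combine T = begin-equality
      x * (β * s) + x * (α * β * (β * y) * q)       ≈⟨ solve 6 (λ x a b y s q → x :* (b :* s) :+ x :* (a :* b :* (b :* y) :* q) := x :* (b :* (s :+ a :* b :* y :* q))) ≈-refl x α β y s q ⟩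
      x * (β * (s + α * β * y * q))                 ≈⟨ *-congˡ (*-congˡ (secondLastSum-∷ʳtrue y (free T))) ⟩
      x * (β * (α * (α + β * y) * p))               ≈⟨ solve 5 (λ x a b y p → x :* (b :* (a :* (a :+ b :* y) :* p)) := x :* (a :* b :* (a :+ b :* y) :* p)) ≈-refl x α β y p ⟩
      x * (α * β * (α + β * y) * p)                 ∎
      where
      x = binom r (A T)
      s = secondLastSum y (free T ∷ʳ true)
      p = (y + α) ^ᶠ free T
      q = y ^ᶠ free T

  momentSum-recursion : ∀ n r y →
    momentSum (suc (suc n)) (suc r) y + α * β * (β * y) * momentSum n r y ≈
    (α + β * y) * momentSum (suc n) (suc r) (y + α) + α * β * (α + β * y) * momentSum n r (y + α)
  momentSum-recursion n r y = ≈-trans (+-congʳ (momentSum-suc (suc n) r y))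
    (≈-trans (+-assoc _ _ _) (+-congˡ (secondLastMoment-suc n r y)))

  -- Each α counted by `A` lies above a row that consists of a lone β, so `A` is at most n / 2. The
  -- recursion yields this without any further look at tableaux.
  momentSum-small : ∀ n r y → n ℕ.< r ℕ.* 2 → momentSum n r y ≈ 0#
  momentSum-small zero          (suc r) y _ = Σ₀-zero (λ T → binom (suc r) (A T) * y ^ᶠ free T) (zeroˡ _)
  momentSum-small (suc zero)    (suc r) y _ = ≈-trans (momentSum-suc 0 r y)
    (≈-trans (+-cong (≈-trans (*-congˡ (momentSum-small 0 (suc r) (y + α) (s≤s z≤n))) (zeroʳ _)) (secondLastMoment-zero r y)) (+-identityˡ 0#))
  momentSum-small (suc (suc n)) (suc r) y (s≤s (s≤s n<2r)) = begin-equality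
    momentSum (suc (suc n)) (suc r) y
      ≈⟨ +-identityʳ _ ⟨
    momentSum (suc (suc n)) (suc r) y + 0#
      ≈⟨ +-congˡ (≈-trans (*-congˡ (momentSum-small n r y n<2r)) (zeroʳ _)) ⟨
    momentSum (suc (suc n)) (suc r) y + α * β * (β * y) * momentSum n r y
      ≈⟨ momentSum-recursion n r y ⟩
    (α + β * y) * momentSum (suc n) (suc r) (y + α) + α * β * (α + β * y) * momentSum n r (y + α)
      ≈⟨ +-cong (≈-trans (*-congˡ (momentSum-small (suc n) (suc r) (y + α) (s≤s (ℕ.m<n⇒m<1+n n<2r)))) (zeroʳ _))
                (≈-trans (*-congˡ (momentSum-small n r (y + α) n<2r)) (zeroʳ _)) ⟩
    0# + 0#
      ≈⟨ +-identityˡ 0# ⟩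
    0# ∎

  γ : Carrier
  γ = α * β

  w : ℕ → Carrier
  w m = fromℕ m * γ

  zProduct : ℕ → Carrier → Carrier
  zProduct zero    y = 1#
  zProduct (suc m) y = zProduct m y * (α + β * y + w m)

  -- Replacing y by y + α adds γ to βy, which advances the index of every factor by one.
  zProduct-head : ∀ m y → zProduct (suc m) y ≈ (α + β * y) * zProduct m (y + α)
  zProduct-head zero    y = solve 3 (λ a b y → con (+ 1) :* (a :+ b :* y :+ con (+ 0) :* (a :* b)) := (a :+ b :* y) :* con (+ 1)) ≈-refl α β y
  zProduct-head (suc m) y = ≈-trans (*-congʳ (zProduct-head m y))
    (solve 5 (λ a b y z m → (a :+ b :* y) :* z :* (a :+ b :* y :+ (con (+ 1) :+ m) :* (a :* b)) :=
                            (a :+ b :* y) :* (z :* (a :+ b :* (y :+ a) :+ m :* (a :* b)))) ≈-refl α β y (zProduct m (y + α)) (fromℕ m))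

  step : ℕ → Carrier
  step r = (1# + 1#) * fromℕ (suc r)

  -- Up to the factor 2ʳ r! γʳ αʳ, this is the complete homogeneous symmetric
  -- polynomial of degree r in 1, 1 + β, …, 1 + m β.
  h : ℕ → ℕ → Carrier
  h m       zero    = 1#
  h zero    (suc r) = step r * γ * α * h 0 r
  h (suc m) (suc r) = h m (suc r) + step r * γ * (α + w (suc m)) * h (suc m) r

  -- The inverse of the limiting moment `μ r`; carrying it along keeps divisions out of the closed
  -- form.
  scale : ℕ → Carrier
  scale r = 2^ r * fromℕ (r !)

  scale-suc : ∀ r → scale (suc r) ≈ step r * scale r
  scale-suc r = ≈-trans (*-congˡ (fromℕ-* (suc r) (r !)))
    (solve 3 (λ p n f → con (+ 2) :* p :* (n :* f) := con (+ 2) :* n :* (p :* f)) ≈-refl (2^ r) (fromℕ (suc r)) (fromℕ (r !)))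

  +-cancel : ∀ {x y z} → x + z ≈ y + z → x ≈ y
  +-cancel {x} {y} {z} eq = ≈-trans (solve 2 (λ x z → x := (x :+ z) :- z) ≈-refl x z)
    (≈-trans (+-congʳ eq) (solve 2 (λ y z → (y :+ z) :- z := y) ≈-refl y z))

  momentSum-closed : ∀ r m y → momentSum (r ℕ.* 2 ℕ.+ m) r y * scale r ≈ zProduct m y * h m r
  momentSum-closed zero zero    y =
    solve 0 ((con (+ 1) :* con (+ 1) :* ((con (+ 1) :+ con (+ 0)) :* con (+ 1)) :+ con (+ 0)) :* (con (+ 1) :* (con (+ 1) :+ con (+ 0))) := con (+ 1) :* con (+ 1)) ≈-refl
  momentSum-closed zero (suc m) y = begin-equality
    momentSum (suc m) 0 y * scale 0                       ≈⟨ *-congʳ (momentSum-zero m y) ⟩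
    (α + β * y) * momentSum m 0 (y + α) * scale 0         ≈⟨ *-assoc _ _ _ ⟩
    (α + β * y) * (momentSum m 0 (y + α) * scale 0)       ≈⟨ *-congˡ (momentSum-closed 0 m (y + α)) ⟩
    (α + β * y) * (zProduct m (y + α) * 1#)               ≈⟨ *-assoc _ _ _ ⟨
    (α + β * y) * zProduct m (y + α) * 1#                 ≈⟨ *-congʳ (zProduct-head m y) ⟨
    zProduct (suc m) y * 1#                               ∎
  -- Both sides carry the scaled correction term of the recursion until `+-cancel` removes it.
  momentSum-closed (suc r) m y = +-cancel (begin-equality
    momentSum (suc (suc n)) (suc r) y * scale (suc r) + step r * (γ * (β * y) * (zProduct m y * h m r))
      ≈⟨ +-cong (*-congˡ (scale-suc r)) (*-congˡ (*-congˡ (≈-sym (momentSum-closed r m y)))) ⟩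
    momentSum (suc (suc n)) (suc r) y * (step r * scale r) + step r * (γ * (β * y) * (momentSum n r y * scale r))
      ≈⟨ solve 5 (λ F k s g G → F :* (k :* s) :+ k :* (g :* (G :* s)) := (F :+ g :* G) :* (k :* s)) ≈-refl
           (momentSum (suc (suc n)) (suc r) y) (step r) (scale r) (γ * (β * y)) (momentSum n r y) ⟩
    (momentSum (suc (suc n)) (suc r) y + γ * (β * y) * momentSum n r y) * (step r * scale r)
      ≈⟨ *-congʳ (momentSum-recursion n r y) ⟩
    ((α + β * y) * momentSum (suc n) (suc r) (y + α) + γ * (α + β * y) * momentSum n r (y + α)) * (step r * scale r)
      ≈⟨ solve 6 (λ t F g G k s → (t :* F :+ g :* t :* G) :* (k :* s) := t :* (F :* (k :* s)) :+ k :* (g :* (t :* (G :* s)))) ≈-refl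
           (α + β * y) (momentSum (suc n) (suc r) (y + α)) γ (momentSum n r (y + α)) (step r) (scale r) ⟩
    (α + β * y) * (momentSum (suc n) (suc r) (y + α) * (step r * scale r)) + step r * (γ * ((α + β * y) * (momentSum n r (y + α) * scale r)))
      ≈⟨ +-congˡ (*-congˡ (*-congˡ (begin-equality
           (α + β * y) * (momentSum n r (y + α) * scale r)   ≈⟨ *-congˡ (momentSum-closed r m (y + α)) ⟩
           (α + β * y) * (zProduct m (y + α) * h m r)        ≈⟨ *-assoc _ _ _ ⟨
           (α + β * y) * zProduct m (y + α) * h m r          ≈⟨ *-congʳ (zProduct-head m y) ⟨
           zProduct (suc m) y * h m r                        ∎))) ⟩
    (α + β * y) * (momentSum (suc n) (suc r) (y + α) * (step r * scale r)) + step r * (γ * (zProduct (suc m) y * h m r))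
      ≈⟨ previous m ⟩
    zProduct m y * h m (suc r) + step r * (γ * (β * y) * (zProduct m y * h m r)) ∎)
    where
    n = r ℕ.* 2 ℕ.+ m

    -- The last factor of `zProduct (suc m) y` is α + βy + w m. Its part βy gives the correction
    -- term, and the rest gives the increment in the recursion of `h`, which can therefore be free
    -- of y. For m = 0 the size is below 2(r + 1), so `momentSum-small` takes the place of the
    -- induction hypothesis.
    previous : ∀ m → (α + β * y) * (momentSum (suc (r ℕ.* 2 ℕ.+ m)) (suc r) (y + α) * (step r * scale r)) + step r * (γ * (zProduct (suc m) y * h m r)) ≈
                     zProduct m y * h m (suc r) + step r * (γ * (β * y) * (zProduct m y * h m r))
    previous zero = ≈-trans
      (+-congʳ (*-congˡ (*-congʳ (momentSum-small (suc (r ℕ.* 2 ℕ.+ 0)) (suc r) (y + α) (s≤s (s≤s (ℕ.≤-reflexive (ℕ.+-identityʳ _))))))))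
      (solve 6 (λ a b y k s h → (a :+ b :* y) :* (con (+ 0) :* (k :* s)) :+ k :* (a :* b :* (con (+ 1) :* (a :+ b :* y :+ con (+ 0) :* (a :* b)) :* h))
          := con (+ 1) :* (k :* (a :* b) :* a :* h) :+ k :* (a :* b :* (b :* y) :* (con (+ 1) :* h))) ≈-refl α β y (step r) (scale r) (h 0 r))
    previous (suc m) = ≈-trans (+-congʳ (begin-equality
        (α + β * y) * (momentSum (suc (r ℕ.* 2 ℕ.+ suc m)) (suc r) (y + α) * (step r * scale r))
          ≈⟨ *-congˡ (*-cong (size (ℕ.+-suc (r ℕ.* 2) m)) (≈-sym (scale-suc r))) ⟩
        (α + β * y) * (momentSum (suc r ℕ.* 2 ℕ.+ m) (suc r) (y + α) * scale (suc r))
          ≈⟨ *-congˡ (momentSum-closed (suc r) m (y + α)) ⟩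
        (α + β * y) * (zProduct m (y + α) * h m (suc r))
          ≈⟨ *-assoc _ _ _ ⟨
        (α + β * y) * zProduct m (y + α) * h m (suc r)
          ≈⟨ *-congʳ (zProduct-head m y) ⟨
        zProduct (suc m) y * h m (suc r) ∎))
      (solve 8 (λ z h h′ k a b y w → z :* h :+ k :* (a :* b :* (z :* (a :+ b :* y :+ w) :* h′))
           := z :* (h :+ k :* (a :* b) :* (a :+ w) :* h′) :+ k :* (a :* b :* (b :* y) :* (z :* h′))) ≈-refl
         (zProduct (suc m) y) (h m (suc r)) (h (suc m) r) (step r) α β y (w (suc m)))
      where
      size : ∀ {i j} → i ≡ j → momentSum (suc i) (suc r) (y + α) ≈ momentSum (suc j) (suc r) (y + α)
      size ≡.refl = ≈-refl

-- Asymptotics of the moments and the limit law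

module TableauLimit {c ℓ₁ ℓ₂} (R : RealField c ℓ₁ ℓ₂) {α β : RealField.Carrier R}
                    (0<α : RealField._<_ R (RealField.0# R) α)
                    (0<β : RealField._<_ R (RealField.0# R) β) where
  open RealField R
  open RealFieldProperties R
  open RandomTableau R 0<α 0<β
  open IntegerCoefficients commutativeRing
  open OrderedFieldProperties R
  open Limits R
  open Moments R
  open Poisson R
  open Sums R
  open TableauSums R 0<α 0<β
  open TableauMoments R 0<α 0<β
  open ≤-Reasoning

  -- With `bernoulli-upper`, the mean value bounds for a power: its increment lies between z times
  -- the derivatives at the two ends. They compare `h`, a sum of such increments over `m`, with a
  -- power of `w m`.
  bernoulli-lower : ∀ {x z} → 0# ≤ x → 0# ≤ z → ∀ k → x ^ suc k + fromℕ (suc k) * z * x ^ k ≤ (x + z) ^ suc k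
  bernoulli-lower {x} {z} 0≤x 0≤z zero    = ≤-reflexive
    (solve 2 (λ x z → x :* con (+ 1) :+ (con (+ 1) :+ con (+ 0)) :* z :* con (+ 1) := (x :+ z) :* con (+ 1)) ≈-refl x z)
  bernoulli-lower {x} {z} 0≤x 0≤z (suc k) = begin
    x * (x * p) + (1# + n) * z * (x * p)              ≤⟨ x≤x+y (*-nonneg (*-nonneg (fromℕ-nonneg (suc k)) (*-nonneg 0≤z 0≤z)) (^-nonneg 0≤x k)) ⟩
    x * (x * p) + (1# + n) * z * (x * p) + n * (z * z) * p
      ≈⟨ solve 4 (λ x z p n → x :* (x :* p) :+ (con (+ 1) :+ n) :* z :* (x :* p) :+ n :* (z :* z) :* p := (x :+ z) :* (x :* p :+ n :* z :* p)) ≈-refl x z p n ⟩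
    (x + z) * (x * p + n * z * p)                     ≤⟨ *-monoʳ-≤ (+-nonneg 0≤x 0≤z) (bernoulli-lower 0≤x 0≤z k) ⟩
    (x + z) * (x + z) ^ suc k                         ∎
    where
    p = x ^ k
    n = fromℕ (suc k)

  bernoulli-upper : ∀ {x z} → 0# ≤ x → 0# ≤ z → ∀ k → (x + z) ^ suc k ≤ x ^ suc k + fromℕ (suc k) * z * (x + z) ^ k
  bernoulli-upper {x} {z} 0≤x 0≤z zero    = ≤-reflexive
    (solve 2 (λ x z → (x :+ z) :* con (+ 1) := x :* con (+ 1) :+ (con (+ 1) :+ con (+ 0)) :* z :* con (+ 1)) ≈-refl x z)
  bernoulli-upper {x} {z} 0≤x 0≤z (suc k) = begin
    (x + z) * q                                   ≈⟨ distribʳ q x z ⟩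
    x * q + z * q                                 ≤⟨ +-monoˡ-≤ _ (*-monoʳ-≤ 0≤x (bernoulli-upper 0≤x 0≤z k)) ⟩
    x * (x * x ^ k + n * z * (x + z) ^ k) + z * q ≈⟨ solve 6 (λ x z p s n q → x :* (x :* p :+ n :* z :* s) :+ z :* q := (x :* (x :* p) :+ n :* z :* (x :* s)) :+ z :* q) ≈-refl x z (x ^ k) ((x + z) ^ k) n q ⟩
    x * (x * x ^ k) + n * z * (x * (x + z) ^ k) + z * q ≤⟨ +-monoˡ-≤ _ (+-monoʳ-≤ _ (*-monoʳ-≤ (*-nonneg (fromℕ-nonneg (suc k)) 0≤z) (*-monoˡ-≤ (^-nonneg (+-nonneg 0≤x 0≤z) k) (x≤x+y 0≤z)))) ⟩
    x * (x * x ^ k) + n * z * q + z * q           ≈⟨ solve 4 (λ a n z q → a :+ n :* z :* q :+ z :* q := a :+ (con (+ 1) :+ n) :* z :* q) ≈-refl (x * (x * x ^ k)) n z q ⟩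
    x * (x * x ^ k) + (1# + n) * z * q            ∎
    where
    q = (x + z) ^ suc k
    n = fromℕ (suc k)

  0<γ : 0# < γ
  0<γ = *-pos 0<α 0<β

  nonneg-w : ∀ m → 0# ≤ w m
  nonneg-w m = *-nonneg (fromℕ-nonneg m) (<⇒≤ 0<γ)

  w-suc : ∀ m → w (suc m) ≈ w m + γ
  w-suc m = solve 2 (λ n g → (con (+ 1) :+ n) :* g := n :* g :+ g) ≈-refl (fromℕ m) γ

  step-nonneg : ∀ r → 0# ≤ step r
  step-nonneg r = *-nonneg (<⇒≤ (+-pos 0<1 0<1)) (fromℕ-nonneg (suc r))

  step≈ : ∀ r → step r ≈ fromℕ (suc r ℕ.* 2)
  step≈ r = ≈-trans (solve 1 (λ n → con (+ 2) :* n := n :* (con (+ 1) :+ (con (+ 1) :+ con (+ 0)))) ≈-refl (fromℕ (suc r)))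
    (≈-sym (fromℕ-* (suc r) 2))

  h-nonneg : ∀ m r → 0# ≤ h m r
  h-nonneg m       zero    = <⇒≤ 0<1
  h-nonneg zero    (suc r) = *-nonneg (*-nonneg (*-nonneg (step-nonneg r) (<⇒≤ 0<γ)) (<⇒≤ 0<α)) (h-nonneg 0 r)
  h-nonneg (suc m) (suc r) = +-nonneg (h-nonneg m (suc r))
    (*-nonneg (*-nonneg (*-nonneg (step-nonneg r) (<⇒≤ 0<γ)) (+-nonneg (<⇒≤ 0<α) (nonneg-w (suc m)))) (h-nonneg (suc m) r))

  -- As `step r` equals 2r + 2, the increment of `h` in `m` is at least γ times the derivative of
  -- the power at the right end point, hence at least the increment of the power.
  h-lower : ∀ m r → w m ^ (r ℕ.* 2) ≤ h m r
  h-lower m       zero    = ≤-refl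
  h-lower zero    (suc r) = ≤-trans (≤-reflexive (≈-trans (*-congʳ (zeroˡ γ)) (zeroˡ _))) (h-nonneg 0 (suc r))
  h-lower (suc m) (suc r) = begin
    w (suc m) ^ (suc r ℕ.* 2)
      ≤⟨ ^-mono-≤ (nonneg-w (suc m)) (≤-reflexive (w-suc m)) (suc r ℕ.* 2) ⟩
    (w m + γ) ^ (suc r ℕ.* 2)
      ≤⟨ bernoulli-upper (nonneg-w m) (<⇒≤ 0<γ) (suc (r ℕ.* 2)) ⟩
    w m ^ (suc r ℕ.* 2) + fromℕ (suc r ℕ.* 2) * γ * (w m + γ) ^ suc (r ℕ.* 2)
      ≤⟨ +-mono-≤ (h-lower m (suc r)) (*-mono-≤ (^-nonneg (+-nonneg (nonneg-w m) (<⇒≤ 0<γ)) (suc (r ℕ.* 2))) (*-nonneg (step-nonneg r) (<⇒≤ 0<γ))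
           (≤-reflexive (*-congʳ (≈-sym (step≈ r)))) (^-mono-≤ (+-nonneg (nonneg-w m) (<⇒≤ 0<γ)) (≤-reflexive (≈-sym (w-suc m))) (suc (r ℕ.* 2)))) ⟩
    h m (suc r) + step r * γ * (w (suc m) * w (suc m) ^ (r ℕ.* 2))
      ≤⟨ +-monoʳ-≤ _ (*-monoʳ-≤ (*-nonneg (step-nonneg r) (<⇒≤ 0<γ)) (*-mono-≤ (^-nonneg (nonneg-w (suc m)) (r ℕ.* 2)) (+-nonneg (<⇒≤ 0<α) (nonneg-w (suc m)))
           (≤-trans (x≤x+y (<⇒≤ 0<α)) (≤-reflexive (+-comm _ _))) (h-lower (suc m) r))) ⟩
    h m (suc r) + step r * γ * ((α + w (suc m)) * h (suc m) r)
      ≈⟨ +-congˡ (≈-sym (*-assoc _ _ _)) ⟩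
    h m (suc r) + step r * γ * (α + w (suc m)) * h (suc m) r ∎

  private
    -- The base of the upper bound for `h`. Raising `r` by one adds γ, which is the room needed by
    -- `bernoulli-lower`; raising `m` by one adds the same amount, so the two inductions fit
    -- together.
    X : ℕ → ℕ → Carrier
    X m r = α + w m + fromℕ r * γ

    nonneg-X : ∀ m r → 0# ≤ X m r
    nonneg-X m r = +-nonneg (+-nonneg (<⇒≤ 0<α) (nonneg-w m)) (*-nonneg (fromℕ-nonneg r) (<⇒≤ 0<γ))

    X-sucʳ : ∀ m r → X m (suc r) ≈ X m r + γ
    X-sucʳ m r = solve 3 (λ a r g → a :+ (con (+ 1) :+ r) :* g := a :+ r :* g :+ g) ≈-refl (α + w m) (fromℕ r) γ

    X-sucˡ : ∀ m r → X (suc m) r ≈ X m (suc r)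
    X-sucˡ m r = solve 4 (λ a m r g → a :+ (con (+ 1) :+ m) :* g :+ r :* g := a :+ m :* g :+ (con (+ 1) :+ r) :* g) ≈-refl α (fromℕ m) (fromℕ r) γ

    increment : ∀ m r → h m r ≤ X m r ^ (r ℕ.* 2) →
                X m r ^ (suc r ℕ.* 2) + step r * γ * (α + w m) * h m r ≤ X m (suc r) ^ (suc r ℕ.* 2)
    increment m r h≤ = begin
      X m r ^ (suc r ℕ.* 2) + step r * γ * (α + w m) * h m r
        ≈⟨ +-congˡ (*-assoc _ _ _) ⟩
      X m r ^ (suc r ℕ.* 2) + step r * γ * ((α + w m) * h m r)
        ≤⟨ +-monoʳ-≤ _ (*-monoʳ-≤ (*-nonneg (step-nonneg r) (<⇒≤ 0<γ))
             (*-mono-≤ (h-nonneg m r) (nonneg-X m r) (x≤x+y (*-nonneg (fromℕ-nonneg r) (<⇒≤ 0<γ))) h≤)) ⟩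
      X m r ^ (suc r ℕ.* 2) + step r * γ * X m r ^ suc (r ℕ.* 2)
        ≈⟨ +-congˡ (*-congʳ (*-congʳ (step≈ r))) ⟩
      X m r ^ (suc r ℕ.* 2) + fromℕ (suc r ℕ.* 2) * γ * X m r ^ suc (r ℕ.* 2)
        ≤⟨ bernoulli-lower (nonneg-X m r) (<⇒≤ 0<γ) (suc (r ℕ.* 2)) ⟩
      (X m r + γ) ^ (suc r ℕ.* 2)
        ≤⟨ ^-mono-≤ (+-nonneg (nonneg-X m r) (<⇒≤ 0<γ)) (≤-reflexive (≈-sym (X-sucʳ m r))) (suc r ℕ.* 2) ⟩
      X m (suc r) ^ (suc r ℕ.* 2) ∎

  h-upper : ∀ m r → h m r ≤ (α + w m + fromℕ r * γ) ^ (r ℕ.* 2)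
  h-upper m       zero    = ≤-refl
  h-upper zero    (suc r) = begin
    step r * γ * α * h 0 r
      ≤⟨ *-monoˡ-≤ (h-nonneg 0 r) (*-monoʳ-≤ (*-nonneg (step-nonneg r) (<⇒≤ 0<γ)) (x≤x+y (nonneg-w 0))) ⟩
    step r * γ * (α + w 0) * h 0 r
      ≤⟨ ≤-trans (x≤x+y (^-nonneg (nonneg-X 0 r) (suc r ℕ.* 2))) (≤-reflexive (+-comm _ _)) ⟩
    X 0 r ^ (suc r ℕ.* 2) + step r * γ * (α + w 0) * h 0 r
      ≤⟨ increment 0 r (h-upper 0 r) ⟩
    X 0 (suc r) ^ (suc r ℕ.* 2) ∎
  h-upper (suc m) (suc r) = begin
    h m (suc r) + step r * γ * (α + w (suc m)) * h (suc m) r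
      ≤⟨ +-monoˡ-≤ _ (≤-trans (h-upper m (suc r)) (^-mono-≤ (nonneg-X m (suc r)) (≤-reflexive (≈-sym (X-sucˡ m r))) (suc r ℕ.* 2))) ⟩
    X (suc m) r ^ (suc r ℕ.* 2) + step r * γ * (α + w (suc m)) * h (suc m) r
      ≤⟨ increment (suc m) r (h-upper (suc m) r) ⟩
    X (suc m) (suc r) ^ (suc r ℕ.* 2) ∎

  zQuotient : ℕ → ℕ → Carrier
  zQuotient m zero    = 1#
  zQuotient m (suc k) = zQuotient m k * (α + β * 1# + w (k ℕ.+ m))

  zProduct-+ : ∀ m k → zProduct (k ℕ.+ m) 1# ≈ zProduct m 1# * zQuotient m k
  zProduct-+ m zero    = ≈-sym (*-identityʳ _)
  zProduct-+ m (suc k) = ≈-trans (*-congʳ (zProduct-+ m k)) (*-assoc _ _ _)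

  0<factor : ∀ m → 0# < α + β * 1# + w m
  0<factor m = <-≤-trans (+-pos 0<α (*-pos 0<β 0<1)) (x≤x+y (nonneg-w m))

  0<zProduct : ∀ m → 0# < zProduct m 1#
  0<zProduct zero    = 0<1
  0<zProduct (suc m) = *-pos (0<zProduct m) (0<factor m)

  0<zQuotient : ∀ m k → 0# < zQuotient m k
  0<zQuotient m zero    = 0<1
  0<zQuotient m (suc k) = *-pos (0<zQuotient m k) (0<factor (k ℕ.+ m))

  w-+ : ∀ k m → w (k ℕ.+ m) ≈ w m + w k
  w-+ k m = ≈-trans (*-congʳ (fromℕ-+ k m)) (solve 3 (λ k m g → (k :+ m) :* g := m :* g :+ k :* g) ≈-refl (fromℕ k) (fromℕ m) γ)

  zQuotient-lower : ∀ m k → w m ^ k ≤ zQuotient m k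
  zQuotient-lower m zero    = ≤-refl
  zQuotient-lower m (suc k) = ≤-trans
    (*-mono-≤ (^-nonneg (nonneg-w m) k) (<⇒≤ (0<factor (k ℕ.+ m)))
      (≤-trans (x≤x+y (+-nonneg (nonneg-w k) (<⇒≤ (+-pos 0<α (*-pos 0<β 0<1))))) (≤-reflexive (≈-trans (≈-sym (+-assoc _ _ _)) (≈-trans (+-comm _ _) (+-congˡ (≈-sym (w-+ k m)))))))
      (zQuotient-lower m k))
    (≤-reflexive (*-comm _ _))

  -- Independent of `m`, as the `D` of `ratio⇝1` has to be; `β * 1#` is βy at y = 1.
  offset : ℕ → Carrier
  offset k = α + β * 1# + w k

  -- `K` stays fixed while `k` runs, so that one base bounds all the factors.
  zQuotient-upper : ∀ m k K → k ℕ.≤ K → zQuotient m k ≤ (w m + offset K) ^ k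
  zQuotient-upper m zero    K _   = ≤-refl
  zQuotient-upper m (suc k) K k<K = ≤-trans (≤-reflexive (*-comm _ _))
    (*-mono-≤ (<⇒≤ (0<zQuotient m k)) (+-nonneg (nonneg-w m) (<⇒≤ (0<factor K))) factor≤ (zQuotient-upper m k K (ℕ.<⇒≤ k<K)))
    where
    factor≤ : α + β * 1# + w (k ℕ.+ m) ≤ w m + offset K
    factor≤ = begin
      α + β * 1# + w (k ℕ.+ m)      ≈⟨ +-congˡ (w-+ k m) ⟩
      α + β * 1# + (w m + w k)      ≈⟨ solve 3 (λ s x y → s :+ (x :+ y) := x :+ (s :+ y)) ≈-refl (α + β * 1#) (w m) (w k) ⟩
      w m + (α + β * 1# + w k)      ≤⟨ +-monoʳ-≤ _ (+-monoʳ-≤ _ (*-monoˡ-≤ (<⇒≤ 0<γ) (fromℕ-mono-≤ (ℕ.<⇒≤ k<K)))) ⟩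
      w m + offset K                ∎

  law : ℕ → (ℕ → Carrier) → Carrier
  law n f = 𝔼 n (λ T → f (A T))

  0<wt : ∀ {n} (T : Filling n) → 0# < wt T
  0<wt T = *-pos (^-pos 0<α (N letterα T)) (^-pos 0<β (N letterβ T))

  law⁺ : ∀ n → IsPositiveFunctional (law n)
  law⁺ n = record
    { mono  = λ f≤g → sumOver-mono (tableaux n) λ T → *-monoʳ-≤ (<⇒≤ (*-pos (0<wt T) (inv-pos (Z-pos n)))) (f≤g (A T))
    ; +-hom = λ f g → ≈-trans (sumOver-cong (tableaux n) λ T → distribˡ _ _ _) (sumOver-+ (tableaux n) _ _)
    ; *-hom = λ x f → ≈-trans (sumOver-cong (tableaux n) λ T → solve 3 (λ p x y → p :* (x :* y) := x :* (p :* y)) ≈-refl (ℙ T) x (f (A T)))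
                        (sumOver-*ˡ (tableaux n) x (λ T → ℙ T * f (A T)))
    }

  1^ : ∀ k → 1# ^ k ≈ 1#
  1^ zero    = ≈-refl
  1^ (suc k) = ≈-trans (*-identityˡ _) (1^ k)

  momentSum-1 : ∀ n r → momentSum n r 1# ≈ sumOver (tableaux n) (λ T → wt T * binom r (A T))
  momentSum-1 n r = sumOver-cong (tableaux n) λ T → *-congˡ (≈-trans (*-congˡ (1^ (trues (free T)))) (*-identityʳ _))

  Z≈zProduct : ∀ n → Z n ≈ zProduct n 1#
  Z≈zProduct n = begin-equality
    Z n                                                 ≈⟨ sumOver-cong (tableaux n) (λ T → ≈-trans (*-congˡ (binom-0 (A T))) (*-identityʳ _)) ⟨
    sumOver (tableaux n) (λ T → wt T * binom 0 (A T))   ≈⟨ momentSum-1 n 0 ⟨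
    momentSum n 0 1#                                    ≈⟨ solve 1 (λ x → x := x :* (con (+ 1) :* (con (+ 1) :+ con (+ 0)))) ≈-refl (momentSum n 0 1#) ⟩
    momentSum n 0 1# * scale 0                          ≈⟨ momentSum-closed 0 n 1# ⟩
    zProduct n 1# * 1#                                  ≈⟨ *-identityʳ _ ⟩
    zProduct n 1#                                       ∎

  law-binom : ∀ n r → law n (binom r) * Z n ≈ momentSum n r 1#
  law-binom n r = begin-equality
    law n (binom r) * Z n
      ≈⟨ *-congʳ (≈-trans (sumOver-cong (tableaux n) λ T → solve 3 (λ w i b → w :* i :* b := i :* (w :* b)) ≈-refl (wt T) (inv (Z-pos n)) (binom r (A T)))
           (sumOver-*ˡ (tableaux n) (inv (Z-pos n)) (λ T → wt T * binom r (A T)))) ⟩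
    inv (Z-pos n) * M * Z n
      ≈⟨ solve 3 (λ i m z → i :* m :* z := m :* (z :* i)) ≈-refl (inv (Z-pos n)) M (Z n) ⟩
    M * (Z n * inv (Z-pos n))
      ≈⟨ *-congˡ (inv-inverseʳ (Z-pos n)) ⟩
    M * 1#
      ≈⟨ *-identityʳ M ⟩
    M
      ≈⟨ momentSum-1 n r ⟨
    momentSum n r 1# ∎
    where M = sumOver (tableaux n) (λ T → wt T * binom r (A T))

  scale-μ : ∀ r → μ r * scale r ≈ 1#
  scale-μ r = begin-equality
    ½ ^ r * inv! r * (2^ r * fromℕ (r !))       ≈⟨ solve 4 (λ p i q f → p :* i :* (q :* f) := (q :* p) :* (f :* i)) ≈-refl (½ ^ r) (inv! r) (2^ r) (fromℕ (r !)) ⟩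
    (2^ r * ½ ^ r) * (fromℕ (r !) * inv! r)     ≈⟨ *-cong (2^*½^ r) (inv!-inverseʳ r) ⟩
    1# * 1#                                     ≈⟨ *-identityˡ 1# ⟩
    1#                                          ∎

  module _ (r : ℕ) where

    private
      k = r ℕ.* 2

      -- The moment divided by its expected limit. It is the ratio of `h m r` to `zQuotient m k`,
      -- and both grow like `w m ^ k`.
      M : ℕ → Carrier
      M m = law (k ℕ.+ m) (binom r) * scale r

      M*zQuotient : ∀ m → M m * zQuotient m k ≈ h m r
      M*zQuotient m = *-cancelˡ-≈ (0<zProduct m) (begin-equality
        zProduct m 1# * (M m * zQuotient m k)
          ≈⟨ solve 4 (λ z l s q → z :* (l :* s :* q) := l :* (z :* q) :* s) ≈-refl (zProduct m 1#) (law (k ℕ.+ m) (binom r)) (scale r) (zQuotient m k) ⟩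
        law (k ℕ.+ m) (binom r) * (zProduct m 1# * zQuotient m k) * scale r
          ≈⟨ *-congʳ (*-congˡ (≈-trans (Z≈zProduct (k ℕ.+ m)) (zProduct-+ m k))) ⟨
        law (k ℕ.+ m) (binom r) * Z (k ℕ.+ m) * scale r
          ≈⟨ *-congʳ (law-binom (k ℕ.+ m) r) ⟩
        momentSum (k ℕ.+ m) r 1# * scale r
          ≈⟨ momentSum-closed r m 1# ⟩
        zProduct m 1# * h m r ∎)

      nonneg-M : ∀ m → 0# ≤ M m
      nonneg-M m = *-cancelˡ-≤ (0<zQuotient m k) (≤-trans (≤-reflexive (zeroʳ _))
        (≤-trans (h-nonneg m r) (≤-reflexive (≈-trans (≈-sym (M*zQuotient m)) (*-comm _ _)))))

      upper : ∀ m → M m * w m ^ k ≤ (w m + offset k) ^ k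
      upper m = begin
        M m * w m ^ k              ≤⟨ *-monoʳ-≤ (nonneg-M m) (zQuotient-lower m k) ⟩
        M m * zQuotient m k        ≈⟨ M*zQuotient m ⟩
        h m r                      ≤⟨ h-upper m r ⟩
        (α + w m + fromℕ r * γ) ^ k ≤⟨ ^-mono-≤ (nonneg-X m r) X≤ k ⟩
        (w m + offset k) ^ k       ∎
        where
        X≤ : α + w m + fromℕ r * γ ≤ w m + offset k
        X≤ = begin
          α + w m + w r                ≤⟨ +-monoʳ-≤ _ (*-monoˡ-≤ (<⇒≤ 0<γ) (fromℕ-mono-≤ (ℕ.m≤m*n r 2))) ⟩
          α + w m + w k                ≤⟨ x≤x+y (<⇒≤ (*-pos 0<β 0<1)) ⟩
          α + w m + w k + β * 1#       ≈⟨ solve 4 (λ a x y b → a :+ x :+ y :+ b := x :+ (a :+ b :+ y)) ≈-refl α (w m) (w k) (β * 1#) ⟩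
          w m + offset k               ∎

      lower : ∀ m → w m ^ k ≤ M m * (w m + offset k) ^ k
      lower m = begin
        w m ^ k                       ≤⟨ h-lower m r ⟩
        h m r                         ≈⟨ M*zQuotient m ⟨
        M m * zQuotient m k           ≤⟨ *-monoʳ-≤ (nonneg-M m) (zQuotient-upper m k k ℕ.≤-refl) ⟩
        M m * (w m + offset k) ^ k    ∎

    law-moment : (λ n → law n (binom r)) ⇝ μ r
    law-moment = ⇝-shift k (⇝-cong unscale (*-identityʳ _)
      (⇝-*ˡ (μ r) (ratio⇝1 k 0<γ M nonneg-M upper lower (<⇒≤ (0<factor k)))))
      where
      unscale : ∀ m → μ r * M m ≈ law (k ℕ.+ m) (binom r)
      unscale m = ≈-trans (solve 3 (λ u l s → u :* (l :* s) := (u :* s) :* l) ≈-refl (μ r) (law (k ℕ.+ m) (binom r)) (scale r))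
        (≈-trans (*-congʳ (scale-μ r)) (*-identityˡ _))

theorem3p5 : ∀ {c ℓ₁ ℓ₂} (R : RealField c ℓ₁ ℓ₂) →
    let open RealField R
        open RealFieldProperties R
    in ∀ {α β : Carrier} (0<α : 0# < α) (0<β : 0# < β) →
       let open RandomTableau R 0<α 0<β
       in ∃[ p ] (IsPoissonPMF ½ p × ConvergesInDistribution 𝔼 (λ n T → A T) p)
theorem3p5 R 0<α 0<β = poisson , isPoissonPMF , momentsConverge⇒poissonLimit law⁺ law-moment
  where
  open Poisson R
  open TableauLimit R 0<α 0<β
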